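{- Let $x \in \mathbb{Z}_{\geq 0}^n$ be the frequency vector of an insertion-only stream of length $m$. Suppose that $\|x\|_0 \leq k$. Then there exists a streaming algorithm that, with probability at least $1 - \delta$, computes a $(1 \pm \varepsilon)$-approximation to $\|x\|_2^2$ using space (in bits) $$O\left(\frac{1}{\varepsilon^2}\log\left(\frac{1}{\delta}\right)\left(\log\frac{k}{\varepsilon} + \log\log m\right) + \log n \cdot \log\frac{1}{\delta} \right).$$
   Context: Insertion-only streaming model: elements of the universe $[n]=\{1,\dots,n\}$ arrive one at a time, and $x_i$ is the number of occurrences of $i$ in the stream, so $\|x\|_2^2=\sum_i x_i^2$ is the second frequency moment $F_2$. Here $\|x\|_0$ is the number of non-zero entries of $x$. A streaming algorithm makes one pass over the stream, may use internal randomness, and its space is the number of bits of memory it maintains. A $(1\pm\varepsilon)$-approximation to a quantity $Q\ge 0$ is a value in $[(1-\varepsilon)Q,(1+\varepsilon)Q]$. The parameters $n$, $k$, $\varepsilon,\delta\in(0,1)$ are given to the algorithm. The paper's convention is that $n=\mathrm{poly}(m)$. Logarithms are base $2$; $O(\cdot)$ hides absolute constants.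
   Formalization: Each logarithm in the space bound is rounded up to an integer (log log m is read as 0 for m ≤ 1), since the literal bound tends to 0 as δ → 1 and then fails; ε and δ are rational, and the space bound and accuracy hold jointly with probability at least 1 − δ. -}

module Defs where

open import Data.Bool.Base using (Bool; if_then_else_)
open import Data.Fin.Base using (Fin)
import Data.Fin.Properties as Fin
open import Data.Integer.Base as ℤ using (+_)
open import Data.List.Base using (List; []; _∷_; length; filter; allFin)
open import Data.Nat.Base as ℕ using (ℕ; suc)
import Data.Nat.Properties as ℕ
open import Data.Nat.Logarithm using (⌈log₂_⌉)
open import Data.Product.Base using (_×_; _,_)
open import Data.Rational.Base using (ℚ; 0ℚ; 1ℚ; _/_; _+_; _-_; _*_; _÷_; 1/_; _≤_; ceiling; Positive)
import Data.Rational.Properties as ℚ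
open import Data.Vec.Functional using (Vector)
open import Relation.Nullary.Decidable using (Dec; does; ¬?; _×-dec_)
open import Relation.Unary using (Decidable)

import Algebra.Properties.CommutativeMonoid.Sum ℕ.+-0-commutativeMonoid as ℕΣ
import Algebra.Properties.CommutativeMonoid.Sum ℚ.+-0-commutativeMonoid as ℚΣ

fromℕ : ℕ → ℚ
fromℕ a = + a / 1

frequency : ∀ {n} → List (Fin n) → Vector ℕ n
frequency σ i = length (filter (i Fin.≟_) σ)

‖_‖₀ : ∀ {n} → Vector ℕ n → ℕ
‖_‖₀ {n} x = length (filter (λ i → ¬? (x i ℕ.≟ 0)) (allFin n))

‖_‖₂² : ∀ {n} → Vector ℕ n → ℕ
‖ x ‖₂² = ℕΣ.sum (λ i → x i ℕ.^ 2)

_isA1±_ApproxOf_ : ℚ → ℚ → ℚ → Set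
v isA1± ε ApproxOf q = (1ℚ - ε) * q ≤ v × v ≤ (1ℚ + ε) * q

_isA1±_ApproxOf?_ : ∀ v ε q → Dec (v isA1± ε ApproxOf q)
v isA1± ε ApproxOf? q = ((1ℚ - ε) * q ℚ.≤? v) ×-dec (v ℚ.≤? (1ℚ + ε) * q)

-- Randomised computations: `uniform d f` draws i uniformly from Fin (suc d),
-- independently of all earlier draws, and continues as f i.
data Rand (A : Set) : Set where
  return  : A → Rand A
  uniform : (d : ℕ) → (Fin (suc d) → Rand A) → Rand A

infixl 1 _>>=_

_>>=_ : ∀ {A B : Set} → Rand A → (A → Rand B) → Rand B
return a    >>= g = g a
uniform d f >>= g = uniform d (λ i → f i >>= g)

Pr : ∀ {A : Set} {P : A → Set} → Decidable P → Rand A → ℚ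
Pr P? (return a)    = if does (P? a) then 1ℚ else 0ℚ
Pr P? (uniform d f) = (+ 1 / suc d) * ℚΣ.sum (λ i → Pr P? (f i))

Memory : Set
Memory = List Bool

-- The memory is all that persists between updates: random bits that are needed
-- again later have to be stored in it, and neither the length of the stream nor
-- the current position in it is available unless it is stored there.
record StreamingAlgorithm (n : ℕ) : Set where
  field
    init   : Rand Memory
    update : Memory → Fin n → Rand Memory
    output : Memory → Rand ℚ

module _ {n : ℕ} (𝒜 : StreamingAlgorithm n) where
  open StreamingAlgorithm 𝒜

  -- Returns the largest number of bits held from the given state on,
  -- together with the output.
  runFrom : Memory → List (Fin n) → Rand (ℕ × ℚ)
  runFrom s []      = output s >>= λ v → return (length s , v)
  runFrom s (i ∷ σ) = update s i >>= λ s′ → runFrom s′ σ >>= λ (peak , v) →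
    return (length s ℕ.⊔ peak , v)

  run : List (Fin n) → Rand (ℕ × ℚ)
  run σ = init >>= λ s → runFrom s σ

-- ⌈log₂ q⌉ for rational q ≥ 1; since powers of two are integers, q may be
-- rounded up first.
⌈log₂ℚ_⌉ : ℚ → ℕ
⌈log₂ℚ q ⌉ = ⌈log₂ ℤ.∣ ceiling q ∣ ⌉

-- The expression inside O(·), with each logarithm rounded up. Without rounding,
-- log (1/δ) tends to 0 as δ tends to 1, and no fixed constant C would do
-- (consider n = k = 1 and streams of all lengths, with no memory at all).
-- For m ≥ 2, ⌈log₂ ⌈log₂ m⌉⌉ is ⌈log₂ log₂ m⌉; for m ≤ 1 it is 0.
spaceBound : (n k : ℕ) (ε δ : ℚ) .{{_ : Positive ε}} .{{_ : Positive δ}} → (m : ℕ) → ℚ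
spaceBound n k ε δ m =
    1/ (ε * ε) * fromℕ ⌈log₂ℚ 1/ δ ⌉
      * (fromℕ ⌈log₂ℚ fromℕ k ÷ ε ⌉ + fromℕ ⌈log₂ ⌈log₂ m ⌉ ⌉)
  + fromℕ ⌈log₂ n ⌉ * fromℕ ⌈log₂ℚ 1/ δ ⌉
  where instance
    _ = ℚ.pos⇒nonZero ε
    _ = ℚ.pos⇒nonZero δ
    _ = ℚ.pos⇒nonZero (ε * ε) {{ℚ.pos*pos⇒pos ε ε}}

-- The memory bound is part of the event rather than a worst-case requirement:
-- as the algorithm is not told m, a worst-case bound o(log m) is unattainable.
-- (On the stream 1, 1, 1, … infinitely many memory states must be reachable, and
-- then every breadth-first layer of the transition graph is nonempty, so more
-- than t states are reachable within t steps.) An algorithm that is told m can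
-- make the bound worst-case by aborting when it is exceeded.
Succeeds : (bound ε q : ℚ) → ℕ × ℚ → Set
Succeeds bound ε q (space , v) = fromℕ space ≤ bound × v isA1± ε ApproxOf q

succeeds? : ∀ bound ε q → Decidable (Succeeds bound ε q)
succeeds? bound ε q (space , v) = (fromℕ space ℚ.≤? bound) ×-dec (v isA1± ε ApproxOf? q)

{-# OPTIONS --safe #-}

module Submission where

-- Reading the counts c of B = β + 1 hashed buckets, quad c = B Σ c_b² - (Σ c_b)² has mean β F₂ and
-- variance at most 2 β F₂² for a fully random hash function. The square of quad c - β F₂ is linear in
-- the n⁴ products x_i x_j x_k x_l, so a greedily chosen list of poly(n, B) hash functions keeps the
-- variance at most 3 β F₂² for all streams at once, and a seed costs only O(log n + log B) bits. The counts
-- are kept by Morris counters of base 1 + 1/A with A of order k / ε², whose squared errors sum to at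
-- most ‖x‖₁² / A ≤ k F₂ / A in the mean. The median of log (1/δ) + O(1) independent copies fails
-- with probability at most δ / 2. Since E (X + 1) = O(A log m) for each counter X and the counters
-- are independent given the seeds, Markov's inequality for the product of all X + 1 bounds the
-- total length of their codes with probability at least 1 - δ / 2.

open import Defs
open import Data.Bool.Base using (Bool; true; false; if_then_else_)
open import Data.Fin.Base using (Fin; zero; suc; toℕ)
import Data.Fin.Properties as Fin
open import Data.Integer.Base as ℤ using (ℤ)
import Data.Integer.DivMod as ℤ
import Data.Integer.Properties as ℤ
import Data.Integer.Tactic.RingSolver as ℤ-Solver
open import Data.List.Base using (List; []; _∷_; _++_; length; filter; tabulate)
open import Data.List.Membership.Propositional using (_∈_; lose)
open import Data.List.Membership.Propositional.Properties using (∈-filter⁺; ∈-filter⁻)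
import Data.List.Properties as List
open import Data.List.Relation.Unary.All as All using (All; []; _∷_)
import Data.List.Relation.Unary.All.Properties as All
open import Data.List.Relation.Unary.Any using (Any; here; there)
open import Data.Nat.Base as ℕ using (ℕ; zero; suc; z≤n; s≤s; pred; _^_; _<ᵇ_)
open import Data.Nat.Binary.Base as ℕᵇ using (ℕᵇ; 2[1+_]; 1+[2_]; fromℕ')
import Data.Nat.Binary.Properties as ℕᵇ
open import Data.Nat.Induction using (<-rec)
open import Data.Nat.Logarithm using (⌈log₂_⌉; ⌈log₂⌉-mono-≤; ⌈log₂⌈n/2⌉⌉≡⌈log₂n⌉∸1; ⌈log₂2^n⌉≡n)
import Data.Nat.Properties as ℕ
import Data.Nat.Tactic.RingSolver as ℕ-Solver
open import Data.Product.Base using (Σ-syntax; _×_; _,_; proj₁; proj₂; ∃-syntax; map₁)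
open import Data.Rational.Base hiding (_⊔_; _⊓_)
import Data.Rational.Properties as ℚ
import Data.Rational.Unnormalised.Base as ℚᵘ
import Data.Rational.Unnormalised.Properties as ℚᵘ
open import Data.Sum.Base using (inj₁; inj₂)
open import Data.Vec.Base using (Vec; []; _∷_; lookup; replicate)
import Data.Vec.Properties as Vec
open import Function.Base using (_∘_)
open import Level using (0ℓ)
open import Relation.Binary.Bundles using (module DecTotalOrder)
open import Relation.Binary.PropositionalEquality
open import Relation.Nullary using (¬_; Dec; yes; no; contradiction)
open import Relation.Nullary.Decidable using (does; ¬?; dec⇒maybe; dec-true)
open import Relation.Unary using (Decidable)
open import Tactic.RingSolver using (solve-∀)
open import Tactic.RingSolver.Core.AlmostCommutativeRing using (AlmostCommutativeRing; fromCommutativeRing)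
import Algebra.Properties.CommutativeMonoid.Sum ℕ.+-0-commutativeMonoid as ℕΣ
import Algebra.Properties.CommutativeMonoid.Sum ℚ.+-0-commutativeMonoid as ℚΣ
import Algebra.Properties.CommutativeMonoid.Sum ℚ.*-1-commutativeMonoid as ℚΠ
import Data.List.Extrema (DecTotalOrder.totalOrder ℚ.≤-decTotalOrder) as Extrema

open ℚΣ using (sum)
open ℚΠ using () renaming (sum to ∏; sum-cong-≗ to ∏-cong)

-- Only the memory kept between updates is counted, so the obstacle is randomness that has to
-- persist: a fully random hash function would take about n log B bits. Here the list of hash
-- functions is fixed together with the program, and only an index into it is stored. This use of
-- the probabilistic method takes the place of the usual 4-wise independent family over a finite
-- field. Both tail bounds rest on products instead of sums. Means of independent factors multiply,
-- so Markov's inequality for the product of R factors of mean M costs only R further bits at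
-- failure probability 2^-R; applied to a sum of lengths it would cost a factor 2^R. The same device
-- replaces a Chernoff bound for the median: every copy carries a penalty of mean at most 2 that is
-- at least 1, and at least 16 if the copy is inaccurate. If half of the R copies are inaccurate,
-- the product of the penalties is at least 4^R, against a mean of at most 2^R.

private variable
  Ω Ω′ Index Index′ Store : Set

-- Rational arithmetic and positive functionals

ring : AlmostCommutativeRing 0ℓ 0ℓ
ring = fromCommutativeRing ℚ.+-*-commutativeRing λ x → dec⇒maybe (0ℚ ℚ.≟ x)

2ℚ 3ℚ : ℚ
2ℚ = ℤ.+ 2 / 1
3ℚ = ℤ.+ 3 / 1

0≤1 : 0ℚ ≤ 1ℚ
0≤1 = ℚ.nonNegative⁻¹ 1ℚ

0≤+ : ∀ {p q} → 0ℚ ≤ p → 0ℚ ≤ q → 0ℚ ≤ p + q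
0≤+ = ℚ.+-mono-≤

*-monoˡ : ∀ {r p q} → 0ℚ ≤ r → p ≤ q → r * p ≤ r * q
*-monoˡ {r} 0≤r = ℚ.*-monoˡ-≤-nonNeg r {{nonNegative 0≤r}}

*-monoʳ : ∀ {r p q} → 0ℚ ≤ r → p ≤ q → p * r ≤ q * r
*-monoʳ {r} 0≤r = ℚ.*-monoʳ-≤-nonNeg r {{nonNegative 0≤r}}

*-mono : ∀ {p s q r} → 0ℚ ≤ p → 0ℚ ≤ s → p ≤ q → r ≤ s → p * r ≤ q * s
*-mono 0≤p 0≤s p≤q r≤s = ℚ.≤-trans (*-monoˡ 0≤p r≤s) (*-monoʳ 0≤s p≤q)

0≤* : ∀ {p q} → 0ℚ ≤ p → 0ℚ ≤ q → 0ℚ ≤ p * q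
0≤* {p} {q} 0≤p 0≤q = subst (_≤ p * q) (ℚ.*-zeroʳ p) (*-monoˡ 0≤p 0≤q)

*-cancel-≤ : ∀ {r p q} → 0ℚ < r → r * p ≤ r * q → p ≤ q
*-cancel-≤ {r} 0<r = ℚ.*-cancelˡ-≤-pos r {{positive 0<r}}

p≤q⇒0≤q-p : ∀ {p q} → p ≤ q → 0ℚ ≤ q - p
p≤q⇒0≤q-p {p} {q} p≤q = subst (_≤ q - p) (ℚ.+-inverseʳ p) (ℚ.+-monoˡ-≤ (- p) p≤q)

0≤q-p⇒p≤q : ∀ {q p} → 0ℚ ≤ q - p → p ≤ q
0≤q-p⇒p≤q {q} {p} 0≤ = subst₂ _≤_ (ℚ.+-identityˡ p) (cancel q p) (ℚ.+-monoˡ-≤ p 0≤)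
  where
  cancel : ∀ q p → q - p + p ≡ q
  cancel = solve-∀ ring

-- Turns an inequality into a certificate: the ring solver rewrites the difference of the two sides
-- into an expression that is visibly non-negative.
≤-via : ∀ {q p r} → q - p ≡ r → 0ℚ ≤ r → p ≤ q
≤-via eq 0≤r = 0≤q-p⇒p≤q (subst (0ℚ ≤_) (sym eq) 0≤r)

0≤p² : ∀ p → 0ℚ ≤ p * p
0≤p² p with ℚ.≤-total 0ℚ p
... | inj₁ 0≤p = 0≤* 0≤p 0≤p
... | inj₂ p≤0 = subst (0ℚ ≤_) (neg² p) (0≤* 0≤-p 0≤-p)
  where
  0≤-p : 0ℚ ≤ - p
  0≤-p = ℚ.neg-antimono-≤ p≤0
  neg² : ∀ p → - p * - p ≡ p * p
  neg² = solve-∀ ring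

p²≤q²⇒p≤q : ∀ {q p} → 0ℚ ≤ q → p * p ≤ q * q → p ≤ q
p²≤q²⇒p≤q {q} {p} 0≤q p²≤q² with p ℚ.≤? q
... | yes p≤q = p≤q
... | no p≰q = contradiction (ℚ.<-≤-trans q²<p² p²≤q²) (ℚ.<-irrefl refl)
  where
  q<p : q < p
  q<p = ℚ.≰⇒> p≰q
  q²<p² : q * q < p * p
  q²<p² = ℚ.≤-<-trans (*-monoˡ 0≤q (ℚ.<⇒≤ q<p))
    (ℚ.*-monoˡ-<-pos p {{positive (ℚ.≤-<-trans 0≤q q<p)}} q<p)

-- Opaque copies of fromℕ and of the weights in Pr: unfolding them would make conversion
-- checking normalise fractions.
opaque
  ι : ℕ → ℚ
  ι = fromℕ

  recip : ℕ → ℚ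
  recip d = ℤ.+ 1 / suc d

opaque
  unfolding ι recip

  ι-fromℕ : ∀ a → ι a ≡ fromℕ a
  ι-fromℕ a = refl

  recip-/ : ∀ d → recip d ≡ ℤ.+ 1 / suc d
  recip-/ d = refl

  ι-0 : ι 0 ≡ 0ℚ
  ι-0 = refl

  ι-1 : ι 1 ≡ 1ℚ
  ι-1 = refl

  fromℕᵘ : ∀ a → toℚᵘ (ι a) ℚᵘ.≃ ℚᵘ.mkℚᵘ (ℤ.+ a) 0
  fromℕᵘ a = ℚ.toℚᵘ-fromℚᵘ (ℚᵘ.mkℚᵘ (ℤ.+ a) 0)

  ι-+ : ∀ a b → ι (a ℕ.+ b) ≡ ι a + ι b
  ι-+ a b = ℚ.toℚᵘ-injective (begin
    toℚᵘ (ι (a ℕ.+ b)) ≈⟨ fromℕᵘ (a ℕ.+ b) ⟩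
    ℚᵘ.mkℚᵘ (ℤ.+ (a ℕ.+ b)) 0 ≈⟨ ℚᵘ.*≡* (cong (ℤ._* ℤ.1ℤ) (sym (cong₂ ℤ._+_ (ℤ.*-identityʳ (ℤ.+ a)) (ℤ.*-identityʳ (ℤ.+ b))))) ⟩
    ℚᵘ.mkℚᵘ (ℤ.+ a) 0 ℚᵘ.+ ℚᵘ.mkℚᵘ (ℤ.+ b) 0 ≈⟨ ℚᵘ.+-cong (fromℕᵘ a) (fromℕᵘ b) ⟨
    toℚᵘ (ι a) ℚᵘ.+ toℚᵘ (ι b) ≈⟨ ℚ.toℚᵘ-homo-+ (ι a) (ι b) ⟨
    toℚᵘ (ι a + ι b)           ∎)
    where open ℚᵘ.≃-Reasoning

  ι-* : ∀ a b → ι (a ℕ.* b) ≡ ι a * ι b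
  ι-* a b = ℚ.toℚᵘ-injective (begin
    toℚᵘ (ι (a ℕ.* b)) ≈⟨ fromℕᵘ (a ℕ.* b) ⟩
    ℚᵘ.mkℚᵘ (ℤ.+ (a ℕ.* b)) 0 ≈⟨ ℚᵘ.*≡* (cong (ℤ._* ℤ.1ℤ) (ℤ.pos-* a b)) ⟩
    ℚᵘ.mkℚᵘ (ℤ.+ a) 0 ℚᵘ.* ℚᵘ.mkℚᵘ (ℤ.+ b) 0 ≈⟨ ℚᵘ.*-cong (fromℕᵘ a) (fromℕᵘ b) ⟨
    toℚᵘ (ι a) ℚᵘ.* toℚᵘ (ι b) ≈⟨ ℚ.toℚᵘ-homo-* (ι a) (ι b) ⟨
    toℚᵘ (ι a * ι b)           ∎)
    where open ℚᵘ.≃-Reasoning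

  ι-mono : ∀ {a b} → a ℕ.≤ b → ι a ≤ ι b
  ι-mono {a} {b} a≤b = ℚ.toℚᵘ-cancel-≤ (begin
    toℚᵘ (ι a) ≃⟨ fromℕᵘ a ⟩
    ℚᵘ.mkℚᵘ (ℤ.+ a) 0 ≤⟨ ℚᵘ.*≤* (ℤ.*-monoʳ-≤-nonNeg ℤ.1ℤ (ℤ.+≤+ a≤b)) ⟩
    ℚᵘ.mkℚᵘ (ℤ.+ b) 0 ≃⟨ fromℕᵘ b ⟨
    toℚᵘ (ι b) ∎)
    where open ℚᵘ.≤-Reasoning

  recip-* : ∀ d → recip d * ι (suc d) ≡ 1ℚ
  recip-* d = ℚ.toℚᵘ-injective (begin
    toℚᵘ (recip d * ι (suc d)) ≈⟨ ℚ.toℚᵘ-homo-* (recip d) (ι (suc d)) ⟩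
    toℚᵘ (recip d) ℚᵘ.* toℚᵘ (ι (suc d)) ≈⟨ ℚᵘ.*-cong (ℚ.toℚᵘ-fromℚᵘ (ℚᵘ.mkℚᵘ (ℤ.+ 1) d)) (fromℕᵘ (suc d)) ⟩
    ℚᵘ.mkℚᵘ (ℤ.+ 1) d ℚᵘ.* ℚᵘ.mkℚᵘ (ℤ.+ suc d) 0 ≈⟨ ℚᵘ.*≡* (ℤ.*-assoc (ℤ.+ 1) (ℤ.+ suc d) (ℤ.+ 1)) ⟩
    ℚᵘ.mkℚᵘ (ℤ.+ 1) 0 ∎)
    where open ℚᵘ.≃-Reasoning

  0≤recip : ∀ d → 0ℚ ≤ recip d
  0≤recip d = ℚ.nonNegative⁻¹ _ {{ℚ.normalize-nonNeg 1 (suc d)}}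

ι-suc : ∀ a → ι (suc a) ≡ 1ℚ + ι a
ι-suc a = trans (ι-+ 1 a) (cong (_+ ι a) ι-1)

0≤ι : ∀ a → 0ℚ ≤ ι a
0≤ι a = subst (_≤ ι a) ι-0 (ι-mono {0} {a} ℕ.z≤n)

1≤ι : ∀ a .{{_ : ℕ.NonZero a}} → 1ℚ ≤ ι a
1≤ι (suc a) = subst (_≤ ι (suc a)) ι-1 (ι-mono {1} {suc a} (ℕ.s≤s ℕ.z≤n))

0<ι : ∀ a .{{_ : ℕ.NonZero a}} → 0ℚ < ι a
0<ι a = ℚ.<-≤-trans (ℚ.positive⁻¹ 1ℚ) (1≤ι a)

ι-cancel-≤ : ∀ {a b} → ι a ≤ ι b → a ℕ.≤ b
ι-cancel-≤ {a} {b} a≤b with a ℕ.≤? b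
... | yes p = p
... | no a≰b = contradiction (ℚ.<-≤-trans b<1+b (ℚ.≤-trans (ι-mono (ℕ.≰⇒> a≰b)) a≤b)) (ℚ.<-irrefl refl)
  where
  b<1+b : ι b < ι (suc b)
  b<1+b = subst₂ _<_ (ℚ.+-identityˡ (ι b)) (sym (ι-suc b)) (ℚ.+-monoˡ-< (ι b) (ℚ.positive⁻¹ 1ℚ))

-- Finite sums, expectations and their iterations share this interface, so that Cauchy-Schwarz, the
-- greedy argument and exchanges of summation are proved once. The total mass is left free because
-- sums are not normalised.
record PositiveFunctional (I : Set) : Set where
  field
    ⟦_⟧  : (I → ℚ) → ℚ
    mono : ∀ {φ ψ} → (∀ i → φ i ≤ ψ i) → ⟦ φ ⟧ ≤ ⟦ ψ ⟧
    +-homo : ∀ φ ψ → ⟦ (λ i → φ i + ψ i) ⟧ ≡ ⟦ φ ⟧ + ⟦ ψ ⟧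
    *-homo : ∀ c φ → ⟦ (λ i → c * φ i) ⟧ ≡ c * ⟦ φ ⟧

  -- Without function extensionality, congruence is obtained from monotonicity in both directions.
  cong-⟦⟧ : ∀ {φ ψ} → (∀ i → φ i ≡ ψ i) → ⟦ φ ⟧ ≡ ⟦ ψ ⟧
  cong-⟦⟧ φ≗ψ = ℚ.≤-antisym (mono (ℚ.≤-reflexive ∘ φ≗ψ)) (mono (ℚ.≤-reflexive ∘ sym ∘ φ≗ψ))

  *-homoʳ : ∀ c φ → ⟦ (λ i → φ i * c) ⟧ ≡ ⟦ φ ⟧ * c
  *-homoʳ c φ = trans (cong-⟦⟧ λ i → ℚ.*-comm (φ i) c) (trans (*-homo c φ) (ℚ.*-comm c _))

  const-⟦⟧ : ∀ c → ⟦ (λ _ → c) ⟧ ≡ c * ⟦ (λ _ → 1ℚ) ⟧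
  const-⟦⟧ c = trans (cong-⟦⟧ λ _ → sym (ℚ.*-identityʳ c)) (*-homo c _)

  0-homo : ⟦ (λ _ → 0ℚ) ⟧ ≡ 0ℚ
  0-homo = trans (const-⟦⟧ 0ℚ) (ℚ.*-zeroˡ ⟦ (λ _ → 1ℚ) ⟧)

  nonneg : ∀ {φ} → (∀ i → 0ℚ ≤ φ i) → 0ℚ ≤ ⟦ φ ⟧
  nonneg {φ} 0≤φ = subst (_≤ ⟦ φ ⟧) 0-homo (mono 0≤φ)

open PositiveFunctional public

opaque
  ∑ : ∀ n → PositiveFunctional (Fin n)
  ⟦ ∑ n ⟧ = sum
  ∑ n .mono {φ} {ψ} = go n φ ψ
    where
    go : ∀ n (φ ψ : Fin n → ℚ) → (∀ i → φ i ≤ ψ i) → sum φ ≤ sum ψ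
    go zero    φ ψ φ≤ψ = ℚ.≤-refl
    go (suc n) φ ψ φ≤ψ = ℚ.+-mono-≤ (φ≤ψ zero) (go n _ _ (φ≤ψ ∘ suc))
  ∑ n .+-homo = ℚΣ.∑-distrib-+
  ∑ n .*-homo c = go n
    where
    go : ∀ n (φ : Fin n → ℚ) → sum (λ i → c * φ i) ≡ c * sum φ
    go zero    φ = sym (ℚ.*-zeroʳ c)
    go (suc n) φ = trans (cong (_+_ (c * φ zero)) (go n (φ ∘ suc))) (sym (ℚ.*-distribˡ-+ c _ _))

  ∑-sum : ∀ {n} (φ : Fin n → ℚ) → ⟦ ∑ n ⟧ φ ≡ sum φ
  ∑-sum φ = refl

  ∑-zero : ∀ (φ : Fin 0 → ℚ) → ⟦ ∑ 0 ⟧ φ ≡ 0ℚ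
  ∑-zero φ = refl

  ∑-suc : ∀ {n} (φ : Fin (suc n) → ℚ) → ⟦ ∑ (suc n) ⟧ φ ≡ φ zero + ⟦ ∑ n ⟧ (φ ∘ suc)
  ∑-suc φ = refl

∑-homo : ∀ (S : PositiveFunctional Index) n (φ : Fin n → Index → ℚ) →
  ⟦ S ⟧ (λ i → ⟦ ∑ n ⟧ λ k → φ k i) ≡ ⟦ ∑ n ⟧ λ k → ⟦ S ⟧ (φ k)
∑-homo S zero    φ = trans (cong-⟦⟧ S λ i → ∑-zero λ k → φ k i) (trans (0-homo S) (sym (∑-zero λ k → ⟦ S ⟧ (φ k))))
∑-homo S (suc n) φ = begin
  (⟦ S ⟧ λ i → ⟦ ∑ (suc n) ⟧ λ k → φ k i)                  ≡⟨ cong-⟦⟧ S (λ i → ∑-suc λ k → φ k i) ⟩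
  (⟦ S ⟧ λ i → φ zero i + ⟦ ∑ n ⟧ λ k → φ (suc k) i)       ≡⟨ S .+-homo (φ zero) _ ⟩
  ⟦ S ⟧ (φ zero) + ⟦ S ⟧ (λ i → ⟦ ∑ n ⟧ λ k → φ (suc k) i) ≡⟨ cong (_+_ (⟦ S ⟧ (φ zero))) (∑-homo S n (φ ∘ suc)) ⟩
  ⟦ S ⟧ (φ zero) + ⟦ ∑ n ⟧ (λ k → ⟦ S ⟧ (φ (suc k))) ≡⟨ ∑-suc (λ k → ⟦ S ⟧ (φ k)) ⟨
  (⟦ ∑ (suc n) ⟧ λ k → ⟦ S ⟧ (φ k)) ∎
  where open ≡-Reasoning

∑-const : ∀ n c → ⟦ ∑ n ⟧ (λ _ → c) ≡ ι n * c
∑-const zero    c = trans (∑-zero λ _ → c) (sym (trans (cong (_* c) ι-0) (ℚ.*-zeroˡ c)))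
∑-const (suc n) c = begin
  ⟦ ∑ (suc n) ⟧ (λ _ → c) ≡⟨ ∑-suc (λ _ → c) ⟩
  c + ⟦ ∑ n ⟧ (λ _ → c)   ≡⟨ cong (_+_ c) (∑-const n c) ⟩
  c + ι n * c             ≡⟨ collect c (ι n) ⟩
  (1ℚ + ι n) * c          ≡⟨ cong (_* c) (ι-suc n) ⟨
  ι (suc n) * c           ∎
  where
  open ≡-Reasoning
  collect : ∀ c m → c + m * c ≡ (1ℚ + m) * c
  collect = solve-∀ ring

-- The averaging principle, made constructive by a finite search: if the search fails, every term
-- exceeds `c`, and the first term makes the inequality between the sums strict.
∑≤⇒∃≤ : ∀ {n} (φ : Fin (suc n) → ℚ) {c} → ⟦ ∑ (suc n) ⟧ φ ≤ ι (suc n) * c → ∃[ i ] φ i ≤ c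
∑≤⇒∃≤ {n} φ {c} Σ≤ with Fin.any? (λ i → φ i ℚ.≤? c)
... | yes found = found
... | no ∄ = contradiction (ℚ.<-≤-trans Σ> Σ≤) (ℚ.<-irrefl refl)
  where
  c<φ : ∀ i → c < φ i
  c<φ i = ℚ.≰⇒> λ φ≤c → ∄ (i , φ≤c)
  Σ> : ι (suc n) * c < ⟦ ∑ (suc n) ⟧ φ
  Σ> = subst₂ _<_ (trans (sym (∑-suc λ _ → c)) (∑-const (suc n) c)) (sym (∑-suc φ))
    (ℚ.+-mono-<-≤ (c<φ zero) (∑ n .mono (ℚ.<⇒≤ ∘ c<φ ∘ suc)))

-- Expectations of randomised computations

infixr 7 _⊗_

_⊗_ : PositiveFunctional Index → PositiveFunctional Index′ → PositiveFunctional (Index × Index′)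
⟦ S ⊗ T ⟧ φ = ⟦ S ⟧ λ i → ⟦ T ⟧ λ j → φ (i , j)
(S ⊗ T) .mono φ≤ψ = S .mono λ i → T .mono λ j → φ≤ψ (i , j)
(S ⊗ T) .+-homo φ ψ = trans (cong-⟦⟧ S λ i → T .+-homo _ _) (S .+-homo _ _)
(S ⊗ T) .*-homo c φ = trans (cong-⟦⟧ S λ i → T .*-homo c _) (S .*-homo c _)

⊗-* : (S : PositiveFunctional Index) (T : PositiveFunctional Index′) (φ : Index → ℚ) (ψ : Index′ → ℚ) →
  ⟦ S ⊗ T ⟧ (λ (i , j) → φ i * ψ j) ≡ ⟦ S ⟧ φ * ⟦ T ⟧ ψ
⊗-* S T φ ψ = trans (cong-⟦⟧ S λ i → T .*-homo (φ i) ψ) (*-homoʳ S (⟦ T ⟧ ψ) φ)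

𝔼 : Rand Ω → PositiveFunctional Ω
⟦ 𝔼 (return a) ⟧ φ = φ a
⟦ 𝔼 (uniform d f) ⟧ φ = recip d * ⟦ ∑ (suc d) ⟧ (λ i → ⟦ 𝔼 (f i) ⟧ φ)
𝔼 (return a) .mono φ≤ψ = φ≤ψ a
𝔼 (uniform d f) .mono φ≤ψ = *-monoˡ (0≤recip d) (∑ (suc d) .mono λ i → 𝔼 (f i) .mono φ≤ψ)
𝔼 (return a) .+-homo φ ψ = refl
𝔼 (uniform d f) .+-homo φ ψ = trans
  (cong (recip d *_) (trans (cong-⟦⟧ (∑ (suc d)) λ i → 𝔼 (f i) .+-homo φ ψ) (∑ (suc d) .+-homo _ _)))
  (ℚ.*-distribˡ-+ (recip d) _ _)
𝔼 (return a) .*-homo c φ = refl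
𝔼 (uniform d f) .*-homo c φ = trans
  (cong (recip d *_) (trans (cong-⟦⟧ (∑ (suc d)) λ i → 𝔼 (f i) .*-homo c φ) (∑ (suc d) .*-homo c _)))
  (swapˡ (recip d) c _)
  where
  swapˡ : ∀ x y z → x * (y * z) ≡ y * (x * z)
  swapˡ = solve-∀ ring

𝔼-const : ∀ (r : Rand Ω) c → ⟦ 𝔼 r ⟧ (λ _ → c) ≡ c
𝔼-const (return a) c = refl
𝔼-const (uniform d f) c = begin
  recip d * ⟦ ∑ (suc d) ⟧ (λ i → ⟦ 𝔼 (f i) ⟧ (λ _ → c)) ≡⟨ cong (recip d *_) (cong-⟦⟧ (∑ (suc d)) λ i → 𝔼-const (f i) c) ⟩
  recip d * ⟦ ∑ (suc d) ⟧ (λ _ → c) ≡⟨ cong (recip d *_) (∑-const (suc d) c) ⟩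
  recip d * (ι (suc d) * c) ≡⟨ ℚ.*-assoc (recip d) _ c ⟨
  recip d * ι (suc d) * c   ≡⟨ cong (_* c) (recip-* d) ⟩
  1ℚ * c ≡⟨ ℚ.*-identityˡ c ⟩
  c      ∎
  where open ≡-Reasoning

-- Means of polynomial expressions are computed by bringing them into this shape with the ring
-- solver; where no last term is left, `ψ` is the zero function.
𝔼-affine : ∀ (r : Rand Ω) a b (φ ψ : Ω → ℚ) →
  ⟦ 𝔼 r ⟧ (λ x → a + (b * φ x + ψ x)) ≡ a + (b * ⟦ 𝔼 r ⟧ φ + ⟦ 𝔼 r ⟧ ψ)
𝔼-affine r a b φ ψ = trans (𝔼 r .+-homo (λ _ → a) (λ x → b * φ x + ψ x)) (cong₂ _+_ (𝔼-const r a)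
  (trans (𝔼 r .+-homo (λ x → b * φ x) ψ) (cong (_+ ⟦ 𝔼 r ⟧ ψ) (𝔼 r .*-homo b φ))))

𝔼->>= : ∀ (r : Rand Ω) (f : Ω → Rand Ω′) φ → ⟦ 𝔼 (r >>= f) ⟧ φ ≡ ⟦ 𝔼 r ⟧ λ a → ⟦ 𝔼 (f a) ⟧ φ
𝔼->>= (return a)    f φ = refl
𝔼->>= (uniform d g) f φ = cong (recip d *_) (cong-⟦⟧ (∑ (suc d)) λ i → 𝔼->>= (g i) f φ)

𝔼-comm : ∀ (S : PositiveFunctional Index) (r : Rand Ω) (g : Index → Ω → ℚ) →
  ⟦ S ⟧ (λ i → ⟦ 𝔼 r ⟧ (g i)) ≡ ⟦ 𝔼 r ⟧ λ a → ⟦ S ⟧ λ i → g i a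
𝔼-comm S (return a)    g = refl
𝔼-comm S (uniform d f) g = trans (S .*-homo (recip d) _) (cong (recip d *_)
  (trans (∑-homo S (suc d) _) (cong-⟦⟧ (∑ (suc d)) λ i → 𝔼-comm S (f i) g)))

indicator : ∀ {P : Ω → Set} → Decidable P → Ω → ℚ
indicator P? a = if does (P? a) then 1ℚ else 0ℚ

Pr≡𝔼 : ∀ {P : Ω → Set} (P? : Decidable P) r → Pr P? r ≡ ⟦ 𝔼 r ⟧ (indicator P?)
Pr≡𝔼 P? (return a)    = refl
Pr≡𝔼 P? (uniform d f) = cong₂ _*_ (sym (recip-/ d)) (trans (sym (∑-sum _)) (cong-⟦⟧ (∑ (suc d)) λ i → Pr≡𝔼 P? (f i)))

-- The probabilistic method as a descent through the tree of draws, each time into a branch whose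
-- mean is still at most `c`.
𝔼≤⇒∃≤ : ∀ (r : Rand Ω) {φ c} → ⟦ 𝔼 r ⟧ φ ≤ c → ∃[ a ] φ a ≤ c
𝔼≤⇒∃≤ (return a) φ≤c = a , φ≤c
𝔼≤⇒∃≤ (uniform d f) {φ} {c} E≤c = 𝔼≤⇒∃≤ (f (proj₁ found)) (proj₂ found)
  where
  Σ≤ : ⟦ ∑ (suc d) ⟧ (λ i → ⟦ 𝔼 (f i) ⟧ φ) ≤ ι (suc d) * c
  Σ≤ = subst (_≤ ι (suc d) * c) cancel (*-monoˡ (0≤ι (suc d)) E≤c)
    where
    E : ℚ
    E = ⟦ ∑ (suc d) ⟧ λ i → ⟦ 𝔼 (f i) ⟧ φ
    commute : ∀ x y z → x * (y * z) ≡ y * x * z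
    commute = solve-∀ ring
    cancel : ι (suc d) * (recip d * ⟦ ∑ (suc d) ⟧ (λ i → ⟦ 𝔼 (f i) ⟧ φ)) ≡ ⟦ ∑ (suc d) ⟧ (λ i → ⟦ 𝔼 (f i) ⟧ φ)
    cancel = trans (commute (ι (suc d)) (recip d) _) (trans (cong (_* E) (recip-* d)) (ℚ.*-identityˡ E))
  found : ∃[ i ] ⟦ 𝔼 (f i) ⟧ φ ≤ c
  found = ∑≤⇒∃≤ _ Σ≤

Always : (Ω → Set) → Rand Ω → Set
Always P (return a)    = P a
Always P (uniform d f) = ∀ i → Always P (f i)

always : ∀ {P : Ω → Set} → (∀ a → P a) → ∀ r → Always P r
always p (return a)    = p a
always p (uniform d f) i = always p (f i)

Always->>= : ∀ {P : Ω → Set} {Q : Ω′ → Set} r {f : Ω → Rand Ω′} →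
  Always P r → (∀ a → P a → Always Q (f a)) → Always Q (r >>= f)
Always->>= (return a)    p q = q a p
Always->>= (uniform d g) p q i = Always->>= (g i) (p i) q

always-map : ∀ {P Q : Ω → Set} (r : Rand Ω) → (∀ a → P a → Q a) → Always P r → Always Q r
always-map (return a)    f p = f a p
always-map (uniform d g) f p i = always-map (g i) f (p i)

𝔼-cong-Always : ∀ (r : Rand Ω) {φ ψ} → Always (λ a → φ a ≡ ψ a) r → ⟦ 𝔼 r ⟧ φ ≡ ⟦ 𝔼 r ⟧ ψ
𝔼-cong-Always (return a)    eq = eq
𝔼-cong-Always (uniform d f) eq = cong (recip d *_) (cong-⟦⟧ (∑ (suc d)) λ i → 𝔼-cong-Always (f i) (eq i))

-- Independent draws and processes run in parallel

sequence : ∀ {N} → (Fin N → Rand Ω) → Rand (Vec Ω N)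
sequence {N = zero}  r = return []
sequence {N = suc N} r = r zero >>= λ a → sequence (r ∘ suc) >>= λ v → return (a ∷ v)

𝔼-sequence-suc : ∀ {N} (r : Fin (suc N) → Rand Ω) φ →
  ⟦ 𝔼 (sequence r) ⟧ φ ≡ ⟦ 𝔼 (r zero) ⟧ λ a → ⟦ 𝔼 (sequence (r ∘ suc)) ⟧ λ v → φ (a ∷ v)
𝔼-sequence-suc r φ = trans (𝔼->>= (r zero) _ φ) (cong-⟦⟧ (𝔼 (r zero)) λ a → 𝔼->>= (sequence (r ∘ suc)) _ φ)

𝔼-sequence-∏ : ∀ {N} (r : Fin N → Rand Ω) (g : Fin N → Ω → ℚ) →
  ⟦ 𝔼 (sequence r) ⟧ (λ v → ∏ λ b → g b (lookup v b)) ≡ ∏ λ b → ⟦ 𝔼 (r b) ⟧ (g b)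
𝔼-sequence-∏ {N = zero}  r g = refl
𝔼-sequence-∏ {N = suc N} r g = begin
  ⟦ 𝔼 (sequence r) ⟧ (λ v → ∏ λ b → g b (lookup v b))
    ≡⟨ 𝔼-sequence-suc r _ ⟩
  (⟦ 𝔼 (r zero) ⟧ λ a → ⟦ 𝔼 (sequence (r ∘ suc)) ⟧ λ v → g zero a * ∏ λ b → g (suc b) (lookup v b))
    ≡⟨ ⊗-* (𝔼 (r zero)) (𝔼 (sequence (r ∘ suc))) (g zero) (λ v → ∏ λ b → g (suc b) (lookup v b)) ⟩
  ⟦ 𝔼 (r zero) ⟧ (g zero) * ⟦ 𝔼 (sequence (r ∘ suc)) ⟧ (λ v → ∏ λ b → g (suc b) (lookup v b))
    ≡⟨ cong (⟦ 𝔼 (r zero) ⟧ (g zero) *_) (𝔼-sequence-∏ (r ∘ suc) (g ∘ suc)) ⟩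
  ⟦ 𝔼 (r zero) ⟧ (g zero) * ∏ (λ b → ⟦ 𝔼 (r (suc b)) ⟧ (g (suc b))) ∎
  where open ≡-Reasoning

𝔼-sequence-lookup : ∀ {N} (r : Fin N → Rand Ω) b (h : Ω → ℚ) →
  ⟦ 𝔼 (sequence r) ⟧ (λ v → h (lookup v b)) ≡ ⟦ 𝔼 (r b) ⟧ h
𝔼-sequence-lookup r zero    h = trans (𝔼-sequence-suc r _) (cong-⟦⟧ (𝔼 (r zero)) λ a → 𝔼-const (sequence (r ∘ suc)) (h a))
𝔼-sequence-lookup r (suc b) h = trans (𝔼-sequence-suc r _)
  (trans (cong-⟦⟧ (𝔼 (r zero)) λ a → 𝔼-sequence-lookup (r ∘ suc) b h) (𝔼-const (r zero) _))

Always-sequence : ∀ {N} {P : Fin N → Ω → Set} (r : Fin N → Rand Ω) →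
  (∀ b → Always (P b) (r b)) → Always (λ v → ∀ b → P b (lookup v b)) (sequence r)
Always-sequence {N = zero}  r p = λ ()
Always-sequence {N = suc N} r p = Always->>= (r zero) (p zero) λ a pa →
  Always->>= (sequence (r ∘ suc)) (Always-sequence (r ∘ suc) (p ∘ suc)) λ v pv → λ { zero → pa ; (suc b) → pv b }

steps : (Store → Index → Rand Store) → Store → List Index → Rand Store
steps step s []      = return s
steps step s (i ∷ σ) = step s i >>= λ s′ → steps step s′ σ

parallel : ∀ {N} → (Fin N → Store → Index → Rand Store) → Vec Store N → Index → Rand (Vec Store N)
parallel step v i = sequence λ b → step b (lookup v b) i

module _ {N} (step : Fin N → Store → Index → Rand Store) where

  -- Every component draws its own randomness and reads only its own state, so that components
  -- started from fixed states stay independent. After one update the remaining expectation is again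
  -- a product of functions of the separate components, to which independence within that update
  -- applies.
  𝔼-parallel-∏ : ∀ (g : Fin N → Store → ℚ) v σ →
    ⟦ 𝔼 (steps (parallel step) v σ) ⟧ (λ w → ∏ λ b → g b (lookup w b))
      ≡ ∏ λ b → ⟦ 𝔼 (steps (step b) (lookup v b) σ) ⟧ (g b)
  𝔼-parallel-∏ g v []      = refl
  𝔼-parallel-∏ g v (i ∷ σ) = begin
    ⟦ 𝔼 (steps (parallel step) v (i ∷ σ)) ⟧ (λ w → ∏ λ b → g b (lookup w b))
      ≡⟨ 𝔼->>= (parallel step v i) _ _ ⟩
    (⟦ 𝔼 (parallel step v i) ⟧ λ w → ⟦ 𝔼 (steps (parallel step) w σ) ⟧ λ w → ∏ λ b → g b (lookup w b))
      ≡⟨ cong-⟦⟧ (𝔼 (parallel step v i)) (λ w → 𝔼-parallel-∏ g w σ) ⟩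
    (⟦ 𝔼 (parallel step v i) ⟧ λ w → ∏ λ b → ⟦ 𝔼 (steps (step b) (lookup w b) σ) ⟧ (g b))
      ≡⟨ 𝔼-sequence-∏ _ (λ b s → ⟦ 𝔼 (steps (step b) s σ) ⟧ (g b)) ⟩
    ∏ (λ b → ⟦ 𝔼 (step b (lookup v b) i) ⟧ λ s → ⟦ 𝔼 (steps (step b) s σ) ⟧ (g b))
      ≡⟨ ∏-cong (λ b → sym (𝔼->>= (step b (lookup v b) i) _ (g b))) ⟩
    ∏ (λ b → ⟦ 𝔼 (steps (step b) (lookup v b) (i ∷ σ)) ⟧ (g b)) ∎
    where open ≡-Reasoning

  𝔼-parallel-lookup : ∀ b (h : Store → ℚ) v σ →
    ⟦ 𝔼 (steps (parallel step) v σ) ⟧ (λ w → h (lookup w b)) ≡ ⟦ 𝔼 (steps (step b) (lookup v b) σ) ⟧ h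
  𝔼-parallel-lookup b h v []      = refl
  𝔼-parallel-lookup b h v (i ∷ σ) = begin
    ⟦ 𝔼 (steps (parallel step) v (i ∷ σ)) ⟧ (λ w → h (lookup w b))
      ≡⟨ 𝔼->>= (parallel step v i) _ _ ⟩
    (⟦ 𝔼 (parallel step v i) ⟧ λ w → ⟦ 𝔼 (steps (parallel step) w σ) ⟧ λ w → h (lookup w b))
      ≡⟨ cong-⟦⟧ (𝔼 (parallel step v i)) (λ w → 𝔼-parallel-lookup b h w σ) ⟩
    (⟦ 𝔼 (parallel step v i) ⟧ λ w → ⟦ 𝔼 (steps (step b) (lookup w b) σ) ⟧ h)
      ≡⟨ 𝔼-sequence-lookup _ b (λ s → ⟦ 𝔼 (steps (step b) s σ) ⟧ h) ⟩
    (⟦ 𝔼 (step b (lookup v b) i) ⟧ λ s → ⟦ 𝔼 (steps (step b) s σ) ⟧ h)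
      ≡⟨ 𝔼->>= (step b (lookup v b) i) _ h ⟨
    ⟦ 𝔼 (steps (step b) (lookup v b) (i ∷ σ)) ⟧ h ∎
    where open ≡-Reasoning

-- Greedy sampling: the cross terms have mean zero, so some outcome increases the squared
-- deviation by at most its variance.
module _ (S : PositiveFunctional Index) (r : Rand Ω) (g : Index → Ω → ℚ) where

  μ : Index → ℚ
  μ i = ⟦ 𝔼 r ⟧ (g i)

  -- Second moments in place of variances: leaving the squared means in only enlarges the bound, and
  -- second moments can be estimated entry by entry.
  V : ℚ
  V = ⟦ S ⟧ λ i → ⟦ 𝔼 r ⟧ λ a → g i a * g i a

  deviation : ℕ → (ℕ → Ω) → Index → ℚ
  deviation t as i = ⟦ ∑ t ⟧ λ τ → g i (as (toℕ τ)) - μ i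

  greedy : ∀ (D : Index → ℚ) → ∃[ a ] ⟦ S ⟧ (λ i → (g i a - μ i + D i) * (g i a - μ i + D i)) ≤ ⟦ S ⟧ (λ i → D i * D i) + V
  greedy D = 𝔼≤⇒∃≤ r (begin
    (⟦ 𝔼 r ⟧ λ a → ⟦ S ⟧ λ i → (g i a - μ i + D i) * (g i a - μ i + D i))
      ≡⟨ 𝔼-comm S r _ ⟨
    (⟦ S ⟧ λ i → ⟦ 𝔼 r ⟧ λ a → (g i a - μ i + D i) * (g i a - μ i + D i))
      ≤⟨ S .mono pointwise ⟩
    (⟦ S ⟧ λ i → D i * D i + ⟦ 𝔼 r ⟧ λ a → g i a * g i a)
      ≡⟨ S .+-homo _ _ ⟩
    ⟦ S ⟧ (λ i → D i * D i) + V ∎)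
    where
    open ℚ.≤-Reasoning
    expand : ∀ x m d → (x - m + d) * (x - m + d) ≡ (d - m) * (d - m) + (2ℚ * (d - m) * x + x * x)
    expand = solve-∀ ring
    collect : ∀ m d v → d * d + v - ((d - m) * (d - m) + (2ℚ * (d - m) * m + v)) ≡ m * m
    collect = solve-∀ ring
    variance : ∀ i → ⟦ 𝔼 r ⟧ (λ a → (g i a - μ i + D i) * (g i a - μ i + D i))
      ≡ (D i - μ i) * (D i - μ i) + (2ℚ * (D i - μ i) * μ i + ⟦ 𝔼 r ⟧ λ a → g i a * g i a)
    variance i = trans (cong-⟦⟧ (𝔼 r) λ a → expand (g i a) (μ i) (D i))
      (𝔼-affine r ((D i - μ i) * (D i - μ i)) (2ℚ * (D i - μ i)) (g i) (λ a → g i a * g i a))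
    pointwise : ∀ i → ⟦ 𝔼 r ⟧ (λ a → (g i a - μ i + D i) * (g i a - μ i + D i)) ≤ D i * D i + ⟦ 𝔼 r ⟧ λ a → g i a * g i a
    pointwise i = subst (_≤ D i * D i + ⟦ 𝔼 r ⟧ (λ a → g i a * g i a)) (sym (variance i))
      (≤-via (collect (μ i) (D i) (⟦ 𝔼 r ⟧ λ a → g i a * g i a)) (0≤p² (μ i)))

  -- For independent samples the mean squared deviation grows by at most `V` per sample; the greedy
  -- choice achieves the same growth deterministically.
  derandomise : ∀ t → Σ[ as ∈ (ℕ → Ω) ]
    ⟦ S ⟧ (λ i → deviation t as i * deviation t as i) ≤ ι t * V
  -- The sequence is total, so it needs values even when none is used; any outcome of `r` will do.
  derandomise zero    = (λ _ → proj₁ (greedy λ _ → 0ℚ)) , ℚ.≤-reflexive (begin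
    ⟦ S ⟧ (λ i → deviation 0 _ i * deviation 0 _ i) ≡⟨ cong-⟦⟧ S (λ i → cong₂ _*_ (∑-zero _) (∑-zero _)) ⟩
    ⟦ S ⟧ (λ _ → 0ℚ)                                ≡⟨ 0-homo S ⟩
    0ℚ                                              ≡⟨ ℚ.*-zeroˡ V ⟨
    0ℚ * V                                          ≡⟨ cong (_* V) ι-0 ⟨
    ι 0 * V                                         ∎)
    where open ≡-Reasoning
  derandomise (suc t) = as′ , (begin
    ⟦ S ⟧ (λ i → deviation (suc t) as′ i * deviation (suc t) as′ i)
      ≡⟨ cong-⟦⟧ S (λ i → cong (λ d → d * d) (∑-suc λ τ → g i (as′ (toℕ τ)) - μ i)) ⟩
    ⟦ S ⟧ (λ i → (g i a - μ i + deviation t as i) * (g i a - μ i + deviation t as i))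
      ≤⟨ proj₂ (greedy (deviation t as)) ⟩
    ⟦ S ⟧ (λ i → deviation t as i * deviation t as i) + V
      ≤⟨ ℚ.+-monoˡ-≤ V (proj₂ (derandomise t)) ⟩
    ι t * V + V    ≡⟨ collect (ι t) V ⟩
    (1ℚ + ι t) * V ≡⟨ cong (_* V) (ι-suc t) ⟨
    ι (suc t) * V  ∎)
    where
    open ℚ.≤-Reasoning
    as : ℕ → Ω
    as = proj₁ (derandomise t)
    a : Ω
    a = proj₁ (greedy (deviation t as))
    as′ : ℕ → Ω
    as′ zero    = a
    as′ (suc τ) = as τ
    collect : ∀ t v → t * v + v ≡ (1ℚ + t) * v
    collect = solve-∀ ring

-- Morris counters

recip-pred : ∀ c .{{_ : ℕ.NonZero c}} → recip (pred c) * ι c ≡ 1ℚ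
recip-pred c = trans (cong (λ m → recip (pred c) * ι m) (sym (ℕ.suc-pred c))) (recip-* (pred c))

recip-*ʳ : ∀ d → ι (suc d) * recip d ≡ 1ℚ
recip-*ʳ d = trans (ℚ.*-comm (ι (suc d)) (recip d)) (recip-* d)

∑-threshold : ∀ {a N} u v → a ℕ.≤ N → ⟦ ∑ N ⟧ (λ i → if toℕ i <ᵇ a then u else v) ≡ ι a * (u - v) + ι N * v
∑-threshold {N = N} u v z≤n = trans (∑-const N v)
  (trans (sym (ℚ.+-identityˡ (ι N * v))) (cong (_+ ι N * v) (sym (trans (cong (_* (u - v)) ι-0) (ℚ.*-zeroˡ (u - v))))))
∑-threshold {suc a} {suc N} u v (s≤s a≤N) = begin
  ⟦ ∑ (suc N) ⟧ (λ i → if toℕ i <ᵇ suc a then u else v) ≡⟨ ∑-suc {N} (λ i → if toℕ i <ᵇ suc a then u else v) ⟩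
  u + ⟦ ∑ N ⟧ (λ i → if toℕ i <ᵇ a then u else v)       ≡⟨ cong (_+_ u) (∑-threshold u v a≤N) ⟩
  u + (ι a * (u - v) + ι N * v)                         ≡⟨ collect (ι a) (ι N) u v ⟩
  (1ℚ + ι a) * (u - v) + (1ℚ + ι N) * v                 ≡⟨ cong₂ (λ x y → x * (u - v) + y * v) (ι-suc a) (ι-suc N) ⟨
  ι (suc a) * (u - v) + ι (suc N) * v                   ∎
  where
  open ≡-Reasoning
  collect : ∀ a n u v → u + (a * (u - v) + n * v) ≡ (1ℚ + a) * (u - v) + (1ℚ + n) * v
  collect = solve-∀ ring

count : (Index → Bool) → List Index → ℕ
count hit []      = 0
count hit (i ∷ σ) = if hit i then suc (count hit σ) else count hit σ

-- A Morris counter of base 1 + 1/A, where A = suc A⁻: its estimate is A (growth x - 1), and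
-- it is incremented with probability 1 / growth x = (A / (1 + A)) ^ x.
module Morris (A⁻ : ℕ) where

  A : ℕ
  A = suc A⁻

  α : ℚ
  α = recip A⁻

  growth : ℕ → ℚ
  growth zero    = 1ℚ
  growth (suc x) = growth x * (1ℚ + α)

  estimate : ℕ → ℚ
  estimate x = ι A * (growth x - 1ℚ)

  increment : ℕ → Rand ℕ
  -- `uniform` takes the predecessor of the number of outcomes, hence the `pred`. Exactly `A ^ x` of
  -- the `suc A ^ x` outcomes increment, so the probability is an exact rational.
  increment x = uniform (pred (suc A ^ x)) λ i → return (if toℕ i <ᵇ A ^ x then suc x else x)

  0≤α : 0ℚ ≤ α
  0≤α = 0≤recip A⁻

  0≤growth : ∀ x → 0ℚ ≤ growth x
  0≤growth zero    = 0≤1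
  0≤growth (suc x) = 0≤* (0≤growth x) (0≤+ 0≤1 0≤α)

  odds : ℕ → ℚ
  odds x = recip (pred (suc A ^ x)) * ι (A ^ x)

  pow-growth : ∀ x → ι (A ^ x) * growth x ≡ ι (suc A ^ x)
  pow-growth zero    = ℚ.*-identityʳ (ι 1)
  pow-growth (suc x) = begin
    ι (A ℕ.* A ^ x) * (growth x * (1ℚ + α))  ≡⟨ cong (_* (growth x * (1ℚ + α))) (ι-* A (A ^ x)) ⟩
    ι A * ι (A ^ x) * (growth x * (1ℚ + α))  ≡⟨ regroup (ι A) (ι (A ^ x)) (growth x) α ⟩
    (ι A * α + ι A) * (ι (A ^ x) * growth x) ≡⟨ cong₂ (λ p q → (p + ι A) * q) (recip-*ʳ A⁻) (pow-growth x) ⟩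
    (1ℚ + ι A) * ι (suc A ^ x)               ≡⟨ cong (_* ι (suc A ^ x)) (ι-suc A) ⟨
    ι (suc A) * ι (suc A ^ x)                ≡⟨ ι-* (suc A) (suc A ^ x) ⟨
    ι (suc A ℕ.* suc A ^ x)                  ∎
    where
    open ≡-Reasoning
    regroup : ∀ a p g α → a * p * (g * (1ℚ + α)) ≡ (a * α + a) * (p * g)
    regroup = solve-∀ ring

  suc-pred-^ : ∀ x → suc (pred (suc A ^ x)) ≡ suc A ^ x
  suc-pred-^ x = ℕ.suc-pred (suc A ^ x) {{ℕ.m^n≢0 (suc A) x}}

  odds-growth : ∀ x → odds x * growth x ≡ 1ℚ
  odds-growth x = trans (ℚ.*-assoc (recip (pred (suc A ^ x))) (ι (A ^ x)) (growth x))
    (trans (cong (recip (pred (suc A ^ x)) *_) (pow-growth x)) (recip-pred (suc A ^ x) {{ℕ.m^n≢0 (suc A) x}}))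

  𝔼-increment : ∀ x φ → ⟦ 𝔼 (increment x) ⟧ φ ≡ odds x * (φ (suc x) - φ x) + φ x
  𝔼-increment x φ = begin
    ρ * ⟦ ∑ (suc d) ⟧ (λ i → φ (if toℕ i <ᵇ a then suc x else x))
      ≡⟨ cong (ρ *_) (cong-⟦⟧ (∑ (suc d)) λ i → push (toℕ i <ᵇ a)) ⟩
    ρ * ⟦ ∑ (suc d) ⟧ (λ i → if toℕ i <ᵇ a then φ (suc x) else φ x)
      ≡⟨ cong (ρ *_) (∑-threshold (φ (suc x)) (φ x) a≤) ⟩
    ρ * (ι a * (φ (suc x) - φ x) + ι (suc d) * φ x)
      ≡⟨ regroup ρ (ι a) (ι (suc d)) (φ (suc x) - φ x) (φ x) ⟩
    odds x * (φ (suc x) - φ x) + ρ * ι (suc d) * φ x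
      ≡⟨ cong (λ q → odds x * (φ (suc x) - φ x) + q * φ x) (recip-* d) ⟩
    odds x * (φ (suc x) - φ x) + 1ℚ * φ x
      ≡⟨ cong (_+_ (odds x * (φ (suc x) - φ x))) (ℚ.*-identityˡ (φ x)) ⟩
    odds x * (φ (suc x) - φ x) + φ x ∎
    where
    open ≡-Reasoning
    d a : ℕ
    d = pred (suc A ^ x)
    a = A ^ x
    ρ : ℚ
    ρ = recip d
    a≤ : a ℕ.≤ suc d
    a≤ = subst (a ℕ.≤_) (sym (suc-pred-^ x)) (ℕ.^-monoˡ-≤ x (ℕ.n≤1+n A))
    push : ∀ b → φ (if b then suc x else x) ≡ (if b then φ (suc x) else φ x)
    push true  = refl
    push false = refl
    regroup : ∀ r a n u v → r * (a * u + n * v) ≡ r * a * u + r * n * v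
    regroup = solve-∀ ring

  growth≡1+α*estimate : ∀ x → growth x ≡ 1ℚ + α * estimate x
  growth≡1+α*estimate x = begin
    growth x                       ≡⟨ split (growth x) ⟩
    1ℚ + 1ℚ * (growth x - 1ℚ)      ≡⟨ cong (λ q → 1ℚ + q * (growth x - 1ℚ)) (recip-* A⁻) ⟨
    1ℚ + α * ι A * (growth x - 1ℚ) ≡⟨ cong (_+_ 1ℚ) (ℚ.*-assoc α (ι A) (growth x - 1ℚ)) ⟩
    1ℚ + α * estimate x            ∎
    where
    open ≡-Reasoning
    split : ∀ g → g ≡ 1ℚ + 1ℚ * (g - 1ℚ)
    split = solve-∀ ring

  -- An increment raises the estimate by the reciprocal of its own probability, so that a hit raises
  -- the mean estimate by exactly 1.
  estimate-suc : ∀ x → estimate (suc x) ≡ estimate x + growth x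
  estimate-suc x = begin
    ι A * (growth x * (1ℚ + α) - 1ℚ)  ≡⟨ regroup (ι A) (growth x) α ⟩
    estimate x + growth x * (ι A * α) ≡⟨ cong (λ q → estimate x + growth x * q) (recip-*ʳ A⁻) ⟩
    estimate x + growth x * 1ℚ        ≡⟨ cong (_+_ (estimate x)) (ℚ.*-identityʳ (growth x)) ⟩
    estimate x + growth x             ∎
    where
    open ≡-Reasoning
    regroup : ∀ a g α → a * (g * (1ℚ + α) - 1ℚ) ≡ a * (g - 1ℚ) + g * (a * α)
    regroup = solve-∀ ring

  module _ (hit : Index → Bool) where

    step : ℕ → Index → Rand ℕ
    step x i = if hit i then increment x else return x

    -- By `odds-growth`, every hit adds exactly `α` to the mean of `growth`. The affine form allows
    -- the linear bound of `counter≤` to be averaged directly.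
    𝔼-growth : ∀ a b x σ → ⟦ 𝔼 (steps step x σ) ⟧ (λ X → a + b * growth X) ≡ a + b * (growth x + ι (count hit σ) * α)
    𝔼-growth a b x []      = cong (λ q → a + b * q) (sym (trans (cong (λ n → growth x + n * α) ι-0) (drop (growth x) α)))
      where
      drop : ∀ g α → g + 0ℚ * α ≡ g
      drop = solve-∀ ring
    𝔼-growth a b x (i ∷ σ) with hit i
    ... | false = 𝔼-growth a b x σ
    ... | true  = begin
      ⟦ 𝔼 (increment x >>= λ x′ → steps step x′ σ) ⟧ (λ X → a + b * growth X)
        ≡⟨ 𝔼->>= (increment x) (λ x′ → steps step x′ σ) (λ X → a + b * growth X) ⟩
      (⟦ 𝔼 (increment x) ⟧ λ x′ → ⟦ 𝔼 (steps step x′ σ) ⟧ λ X → a + b * growth X)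
        ≡⟨ cong-⟦⟧ (𝔼 (increment x)) (λ x′ → 𝔼-growth a b x′ σ) ⟩
      (⟦ 𝔼 (increment x) ⟧ λ x′ → a + b * (growth x′ + n * α))
        ≡⟨ 𝔼-increment x (λ x′ → a + b * (growth x′ + n * α)) ⟩
      odds x * (a + b * (g * (1ℚ + α) + n * α) - (a + b * (g + n * α))) + (a + b * (g + n * α))
        ≡⟨ regroup a b (odds x) g α n ⟩
      a + b * (g + (odds x * g + n) * α)
        ≡⟨ cong (λ q → a + b * (g + (q + n) * α)) (odds-growth x) ⟩
      a + b * (g + (1ℚ + n) * α)
        ≡⟨ cong (λ q → a + b * (g + q * α)) (ι-suc (count hit σ)) ⟨
      a + b * (g + ι (suc (count hit σ)) * α) ∎
      where
      open ≡-Reasoning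
      n g : ℚ
      n = ι (count hit σ)
      g = growth x
      regroup : ∀ a b o g α n → o * (a + b * (g * (1ℚ + α) + n * α) - (a + b * (g + n * α))) + (a + b * (g + n * α))
        ≡ a + b * (g + (o * g + n) * α)
      regroup = solve-∀ ring

    -- A jump of size g taken with probability 1/g has variance g - 1, which is `α` times the
    -- current estimate. Summed over the n hits still to come this is α (n e + n (n - 1) / 2); the
    -- larger n² keeps the potential simple. The target `t` and the start `x` stay general for the
    -- induction.
    𝔼-error² : ∀ t x σ → let n = ι (count hit σ) in
      ⟦ 𝔼 (steps step x σ) ⟧ (λ X → (estimate X - t) * (estimate X - t))
        ≤ (estimate x + n - t) * (estimate x + n - t) + α * (n * estimate x + n * n)
    𝔼-error² t x []      = ℚ.≤-reflexive (trans (start (estimate x) t α)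
      (cong (λ n → (estimate x + n - t) * (estimate x + n - t) + α * (n * estimate x + n * n)) (sym ι-0)))
      where
      start : ∀ e t α → (e - t) * (e - t) ≡ (e + 0ℚ - t) * (e + 0ℚ - t) + α * (0ℚ * e + 0ℚ * 0ℚ)
      start = solve-∀ ring
    𝔼-error² t x (i ∷ σ) with hit i
    ... | false = 𝔼-error² t x σ
    ... | true  = begin
      ⟦ 𝔼 (increment x >>= λ x′ → steps step x′ σ) ⟧ (λ X → (estimate X - t) * (estimate X - t))
        ≡⟨ 𝔼->>= (increment x) (λ x′ → steps step x′ σ) (λ X → (estimate X - t) * (estimate X - t)) ⟩
      (⟦ 𝔼 (increment x) ⟧ λ x′ → ⟦ 𝔼 (steps step x′ σ) ⟧ λ X → (estimate X - t) * (estimate X - t))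
        ≤⟨ 𝔼 (increment x) .mono (λ x′ → 𝔼-error² t x′ σ) ⟩
      (⟦ 𝔼 (increment x) ⟧ λ x′ → bound n (estimate x′))
        ≡⟨ 𝔼-increment x (λ x′ → bound n (estimate x′)) ⟩
      odds x * (bound n (estimate (suc x)) - bound n e) + bound n e
        ≡⟨ cong (λ q → odds x * (bound n q - bound n e) + bound n e) (estimate-suc x) ⟩
      odds x * (bound n (e + g) - bound n e) + bound n e
        ≡⟨ regroup (odds x) e g n t α ⟩
      odds x * g * (2ℚ * (e + n - t) + g + α * n) + bound n e
        ≡⟨ cong₂ (λ p q → p * (2ℚ * (e + n - t) + q + α * n) + bound n e) (odds-growth x) (growth≡1+α*estimate x) ⟩
      1ℚ * (2ℚ * (e + n - t) + (1ℚ + α * e) + α * n) + bound n e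
        ≤⟨ ≤-via (slack e n t α) (0≤* 0≤α (0≤+ 0≤1 (0≤ι (count hit σ)))) ⟩
      bound (1ℚ + n) e
        ≡⟨ cong (λ q → bound q e) (ι-suc (count hit σ)) ⟨
      bound (ι (suc (count hit σ))) e ∎
      where
      open ℚ.≤-Reasoning
      n g e : ℚ
      n = ι (count hit σ)
      g = growth x
      e = estimate x
      bound : ℚ → ℚ → ℚ
      bound n e = (e + n - t) * (e + n - t) + α * (n * e + n * n)
      regroup : ∀ o e g n t α →
        o * ((e + g + n - t) * (e + g + n - t) + α * (n * (e + g) + n * n) - ((e + n - t) * (e + n - t) + α * (n * e + n * n)))
          + ((e + n - t) * (e + n - t) + α * (n * e + n * n))
        ≡ o * g * (2ℚ * (e + n - t) + g + α * n) + ((e + n - t) * (e + n - t) + α * (n * e + n * n))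
      regroup = solve-∀ ring
      slack : ∀ e n t α →
        (e + (1ℚ + n) - t) * (e + (1ℚ + n) - t) + α * ((1ℚ + n) * e + (1ℚ + n) * (1ℚ + n))
          - (1ℚ * (2ℚ * (e + n - t) + (1ℚ + α * e) + α * n) + ((e + n - t) * (e + n - t) + α * (n * e + n * n)))
        ≡ α * (1ℚ + n)
      slack = solve-∀ ring

  growth-+ : ∀ x y → growth (x ℕ.+ y) ≡ growth x * growth y
  growth-+ zero    y = sym (ℚ.*-identityˡ (growth y))
  growth-+ (suc x) y = trans (cong (_* (1ℚ + α)) (growth-+ x y)) (commute (growth x) (growth y) (1ℚ + α))
    where
    commute : ∀ a b c → a * b * c ≡ a * c * b
    commute = solve-∀ ring

  bernoulli : ∀ x → 1ℚ + ι x * α ≤ growth x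
  bernoulli zero    = ℚ.≤-reflexive (trans (cong (λ n → 1ℚ + n * α) ι-0) (drop α))
    where
    drop : ∀ α → 1ℚ + 0ℚ * α ≡ 1ℚ
    drop = solve-∀ ring
  bernoulli (suc x) = begin
    1ℚ + ι (suc x) * α        ≡⟨ cong (λ n → 1ℚ + n * α) (ι-suc x) ⟩
    1ℚ + (1ℚ + ι x) * α       ≤⟨ ≤-via (slack (ι x) α) (0≤* (0≤ι x) (0≤p² α)) ⟩
    (1ℚ + ι x * α) * (1ℚ + α) ≤⟨ *-monoʳ (0≤+ 0≤1 0≤α) (bernoulli x) ⟩
    growth x * (1ℚ + α)       ∎
    where
    open ℚ.≤-Reasoning
    slack : ∀ n α → (1ℚ + n * α) * (1ℚ + α) - (1ℚ + (1ℚ + n) * α) ≡ n * (α * α)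
    slack = solve-∀ ring

  -- By Bernoulli's inequality (1 + 1/A)^A is at least 2, so every `A` increments at least double
  -- the growth.
  2^≤growth : ∀ ℓ → ι (2 ^ ℓ) ≤ growth (ℓ ℕ.* A)
  2^≤growth zero    = ℚ.≤-reflexive ι-1
  2^≤growth (suc ℓ) = begin
    ι (2 ℕ.* 2 ^ ℓ)           ≡⟨ ι-* 2 (2 ^ ℓ) ⟩
    ι 2 * ι (2 ^ ℓ)           ≤⟨ *-mono (0≤ι 2) (0≤growth (ℓ ℕ.* A)) ι2≤ (2^≤growth ℓ) ⟩
    growth A * growth (ℓ ℕ.* A) ≡⟨ growth-+ A (ℓ ℕ.* A) ⟨
    growth (A ℕ.+ ℓ ℕ.* A)      ∎
    where
    open ℚ.≤-Reasoning
    ι2≤ : ι 2 ≤ growth A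
    ι2≤ = begin
      ι 2          ≡⟨ trans (ι-suc 1) (cong (_+_ 1ℚ) ι-1) ⟩
      1ℚ + 1ℚ      ≡⟨ cong (_+_ 1ℚ) (recip-*ʳ A⁻) ⟨
      1ℚ + ι A * α ≤⟨ bernoulli A ⟩
      growth A     ∎

  -- A linear bound on log₂ (growth x), tangent near growth x = 2 ^ ℓ.
  counter≤ : ∀ ℓ {h} → 0ℚ ≤ h → h * ι (2 ^ ℓ) ≡ 1ℚ → ∀ x → ι x ≤ ι (ℓ ℕ.* A) + ι A * h * growth x
  counter≤ ℓ {h} 0≤h h*2^ℓ≡1 x with ℕ.≤-total x (ℓ ℕ.* A)
  ... | inj₁ x≤ℓA = begin
    ι x                              ≤⟨ ι-mono x≤ℓA ⟩
    ι (ℓ ℕ.* A)                      ≡⟨ ℚ.+-identityʳ (ι (ℓ ℕ.* A)) ⟨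
    ι (ℓ ℕ.* A) + 0ℚ                 ≤⟨ ℚ.+-monoʳ-≤ (ι (ℓ ℕ.* A)) (0≤* (0≤* (0≤ι A) 0≤h) (0≤growth x)) ⟩
    ι (ℓ ℕ.* A) + ι A * h * growth x ∎
    where open ℚ.≤-Reasoning
  ... | inj₂ ℓA≤x = begin
    ι x                                               ≡⟨ cong ι x≡ ⟨
    ι (ℓ ℕ.* A ℕ.+ j)                                 ≡⟨ ι-+ (ℓ ℕ.* A) j ⟩
    ι (ℓ ℕ.* A) + ι j                                 ≡⟨ cong (_+_ (ι (ℓ ℕ.* A))) ιj≡ ⟩
    ι (ℓ ℕ.* A) + ι A * h * (ι (2 ^ ℓ) * (ι j * α)) ≤⟨ ℚ.+-monoʳ-≤ (ι (ℓ ℕ.* A)) (*-monoˡ (0≤* (0≤ι A) 0≤h) grown) ⟩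
    ι (ℓ ℕ.* A) + ι A * h * growth x                  ∎
    where
    open ℚ.≤-Reasoning
    j : ℕ
    j = x ℕ.∸ ℓ ℕ.* A
    x≡ : ℓ ℕ.* A ℕ.+ j ≡ x
    x≡ = ℕ.m+[n∸m]≡n ℓA≤x
    regroup : ∀ a h p j α → a * h * (p * (j * α)) ≡ a * α * (h * p) * j
    regroup = solve-∀ ring
    unit : ∀ j → 1ℚ * 1ℚ * j ≡ j
    unit = solve-∀ ring
    ιj≡ : ι j ≡ ι A * h * (ι (2 ^ ℓ) * (ι j * α))
    ιj≡ = sym (trans (regroup (ι A) h (ι (2 ^ ℓ)) (ι j) α)
      (trans (cong₂ (λ p q → p * q * ι j) (recip-*ʳ A⁻) h*2^ℓ≡1) (unit (ι j))))
    jα≤ : ι j * α ≤ growth j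
    jα≤ = ℚ.≤-trans (≤-via (drop (ι j * α)) 0≤1) (bernoulli j)
      where
      drop : ∀ p → 1ℚ + p - p ≡ 1ℚ
      drop = solve-∀ ring
    grown : ι (2 ^ ℓ) * (ι j * α) ≤ growth x
    grown = begin
      ι (2 ^ ℓ) * (ι j * α)     ≤⟨ *-mono (0≤ι (2 ^ ℓ)) (0≤growth j) (2^≤growth ℓ) jα≤ ⟩
      growth (ℓ ℕ.* A) * growth j ≡⟨ growth-+ (ℓ ℕ.* A) j ⟨
      growth (ℓ ℕ.* A ℕ.+ j)      ≡⟨ cong growth x≡ ⟩
      growth x                    ∎

  -- In place of Jensen's inequality for the logarithm, the tangent bound `counter≤` with h = 2^-ℓ
  -- is averaged through `𝔼-growth`. The summand 3 pays for the `suc`, for h A and for h n, each of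
  -- which is at most `A`.
  𝔼-counter : ∀ (hit : Index → Bool) ℓ σ → count hit σ ℕ.≤ 2 ^ ℓ →
    ⟦ 𝔼 (steps (step hit) 0 σ) ⟧ (λ X → ι (suc X)) ≤ ι (A ℕ.* (ℓ ℕ.+ 3))
  𝔼-counter hit ℓ σ n≤2^ℓ = begin
    ⟦ 𝔼 (steps (step hit) 0 σ) ⟧ (λ X → ι (suc X))
      ≤⟨ 𝔼 (steps (step hit) 0 σ) .mono pointwise ⟩
    ⟦ 𝔼 (steps (step hit) 0 σ) ⟧ (λ X → (1ℚ + ι (ℓ ℕ.* A)) + ι A * h * growth X)
      ≡⟨ 𝔼-growth hit (1ℚ + ι (ℓ ℕ.* A)) (ι A * h) 0 σ ⟩
    (1ℚ + ι (ℓ ℕ.* A)) + ι A * h * (1ℚ + n * α)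
      ≡⟨ regroup (ι (ℓ ℕ.* A)) (ι A) h n α ⟩
    1ℚ + ι (ℓ ℕ.* A) + h * ι A + ι A * α * (h * n)
      ≡⟨ cong (λ q → 1ℚ + ι (ℓ ℕ.* A) + h * ι A + q * (h * n)) (recip-*ʳ A⁻) ⟩
    1ℚ + ι (ℓ ℕ.* A) + h * ι A + 1ℚ * (h * n)
      ≤⟨ ℚ.+-mono-≤ (ℚ.+-mono-≤ (ℚ.+-monoˡ-≤ (ι (ℓ ℕ.* A)) 1≤ιA) (*-monoʳ (0≤ι A) h≤1)) (*-monoˡ 0≤1 hn≤ιA) ⟩
    ι A + ι (ℓ ℕ.* A) + 1ℚ * ι A + 1ℚ * ι A
      ≡⟨ cong (λ q → ι A + q + 1ℚ * ι A + 1ℚ * ι A) (ι-* ℓ A) ⟩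
    ι A + ι ℓ * ι A + 1ℚ * ι A + 1ℚ * ι A
      ≡⟨ collect (ι A) (ι ℓ) ⟩
    ι A * (ι ℓ + (1ℚ + (1ℚ + 1ℚ)))
      ≡⟨ cong (λ q → ι A * (ι ℓ + q)) (trans (ι-suc 2) (cong (_+_ 1ℚ) (trans (ι-suc 1) (cong (_+_ 1ℚ) ι-1)))) ⟨
    ι A * (ι ℓ + ι 3)
      ≡⟨ cong (ι A *_) (ι-+ ℓ 3) ⟨
    ι A * ι (ℓ ℕ.+ 3)
      ≡⟨ ι-* A (ℓ ℕ.+ 3) ⟨
    ι (A ℕ.* (ℓ ℕ.+ 3)) ∎
    where
    open ℚ.≤-Reasoning
    n h : ℚ
    n = ι (count hit σ)
    h = recip (pred (2 ^ ℓ))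
    0≤h : 0ℚ ≤ h
    0≤h = 0≤recip (pred (2 ^ ℓ))
    h*2^ℓ≡1 : h * ι (2 ^ ℓ) ≡ 1ℚ
    h*2^ℓ≡1 = recip-pred (2 ^ ℓ) {{ℕ.m^n≢0 2 ℓ}}
    1≤ιA : 1ℚ ≤ ι A
    1≤ιA = 1≤ι A
    h≤1 : h ≤ 1ℚ
    h≤1 = begin
      h               ≡⟨ ℚ.*-identityʳ h ⟨
      h * 1ℚ          ≤⟨ *-monoˡ 0≤h (1≤ι (2 ^ ℓ) {{ℕ.m^n≢0 2 ℓ}}) ⟩
      h * ι (2 ^ ℓ) ≡⟨ h*2^ℓ≡1 ⟩
      1ℚ              ∎
    hn≤ιA : h * n ≤ ι A
    hn≤ιA = begin
      h * n           ≤⟨ *-monoˡ 0≤h (ι-mono n≤2^ℓ) ⟩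
      h * ι (2 ^ ℓ) ≡⟨ h*2^ℓ≡1 ⟩
      1ℚ              ≤⟨ 1≤ιA ⟩
      ι A             ∎
    pointwise : ∀ X → ι (suc X) ≤ (1ℚ + ι (ℓ ℕ.* A)) + ι A * h * growth X
    pointwise X = begin
      ι (suc X)                               ≡⟨ ι-suc X ⟩
      1ℚ + ι X                                ≤⟨ ℚ.+-monoʳ-≤ 1ℚ (counter≤ ℓ 0≤h h*2^ℓ≡1 X) ⟩
      1ℚ + (ι (ℓ ℕ.* A) + ι A * h * growth X) ≡⟨ ℚ.+-assoc 1ℚ (ι (ℓ ℕ.* A)) (ι A * h * growth X) ⟨
      (1ℚ + ι (ℓ ℕ.* A)) + ι A * h * growth X ∎
    regroup : ∀ l a h n α → (1ℚ + l) + a * h * (1ℚ + n * α) ≡ 1ℚ + l + h * a + a * α * (h * n)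
    regroup = solve-∀ ring
    collect : ∀ a l → a + l * a + 1ℚ * a + 1ℚ * a ≡ a * (l + (1ℚ + (1ℚ + 1ℚ)))
    collect = solve-∀ ring

-- The quadratic form of a bucket vector

δ : ∀ {n} → Fin n → Fin n → ℚ
δ i j = if does (i Fin.≟ j) then 1ℚ else 0ℚ

∑-+ : ∀ {n} (φ ψ : Fin n → ℚ) → ⟦ ∑ n ⟧ (λ i → φ i + ψ i) ≡ ⟦ ∑ n ⟧ φ + ⟦ ∑ n ⟧ ψ
∑-+ {n} = ∑ n .+-homo

∑-* : ∀ {n} c (φ : Fin n → ℚ) → ⟦ ∑ n ⟧ (λ i → c * φ i) ≡ c * ⟦ ∑ n ⟧ φ
∑-* {n} = ∑ n .*-homo

∑-δ : ∀ {n} (i : Fin n) (φ : Fin n → ℚ) → ⟦ ∑ n ⟧ (λ j → δ i j * φ j) ≡ φ i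
∑-δ {suc n} zero φ = begin
  ⟦ ∑ (suc n) ⟧ (λ j → δ zero j * φ j)         ≡⟨ ∑-suc (λ j → δ zero j * φ j) ⟩
  1ℚ * φ zero + ⟦ ∑ n ⟧ (λ j → 0ℚ * φ (suc j)) ≡⟨ cong₂ _+_ (ℚ.*-identityˡ (φ zero)) (∑-* 0ℚ (φ ∘ suc)) ⟩
  φ zero + 0ℚ * ⟦ ∑ n ⟧ (φ ∘ suc)              ≡⟨ cong (_+_ (φ zero)) (ℚ.*-zeroˡ (⟦ ∑ n ⟧ (φ ∘ suc))) ⟩
  φ zero + 0ℚ                                  ≡⟨ ℚ.+-identityʳ (φ zero) ⟩
  φ zero                                       ∎
  where open ≡-Reasoning
∑-δ {suc n} (suc i) φ = begin
  ⟦ ∑ (suc n) ⟧ (λ j → δ (suc i) j * φ j)         ≡⟨ ∑-suc (λ j → δ (suc i) j * φ j) ⟩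
  0ℚ * φ zero + ⟦ ∑ n ⟧ (λ j → δ i j * φ (suc j)) ≡⟨ cong₂ _+_ (ℚ.*-zeroˡ (φ zero)) (∑-δ i (φ ∘ suc)) ⟩
  0ℚ + φ (suc i)                                  ≡⟨ ℚ.+-identityˡ (φ (suc i)) ⟩
  φ (suc i)                                       ∎
  where open ≡-Reasoning

∑-affine² : ∀ {n} (c e : Fin n → ℚ) μ →
  ⟦ ∑ n ⟧ (λ b → (c b + μ * e b) * (c b + μ * e b))
    ≡ ⟦ ∑ n ⟧ (λ b → c b * c b) + (2ℚ * μ * ⟦ ∑ n ⟧ (λ b → c b * e b) + μ * μ * ⟦ ∑ n ⟧ (λ b → e b * e b))
∑-affine² {n} c e μ = begin
  ⟦ ∑ n ⟧ (λ b → (c b + μ * e b) * (c b + μ * e b))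
    ≡⟨ cong-⟦⟧ (∑ n) (λ b → expand (c b) (e b) μ) ⟩
  ⟦ ∑ n ⟧ (λ b → c b * c b + (2ℚ * μ * (c b * e b) + μ * μ * (e b * e b)))
    ≡⟨ ∑-+ (λ b → c b * c b) (λ b → 2ℚ * μ * (c b * e b) + μ * μ * (e b * e b)) ⟩
  ⟦ ∑ n ⟧ (λ b → c b * c b) + ⟦ ∑ n ⟧ (λ b → 2ℚ * μ * (c b * e b) + μ * μ * (e b * e b))
    ≡⟨ cong (_+_ (⟦ ∑ n ⟧ λ b → c b * c b)) (trans (∑-+ (λ b → 2ℚ * μ * (c b * e b)) (λ b → μ * μ * (e b * e b)))
         (cong₂ _+_ (∑-* (2ℚ * μ) (λ b → c b * e b)) (∑-* (μ * μ) (λ b → e b * e b)))) ⟩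
  _ ∎
  where
  open ≡-Reasoning
  expand : ∀ c e μ → (c + μ * e) * (c + μ * e) ≡ c * c + (2ℚ * μ * (c * e) + μ * μ * (e * e))
  expand = solve-∀ ring

-- With a, b and c the values of `S` at φψ, ψψ and φφ, the value at the square of bφ - aψ is b (c b
-- - a²); it is non-negative, and the positive factor b cancels.
cauchy-schwarz : ∀ (S : PositiveFunctional Index) (φ ψ : Index → ℚ) → 0ℚ < ⟦ S ⟧ (λ i → ψ i * ψ i) →
  ⟦ S ⟧ (λ i → φ i * ψ i) * ⟦ S ⟧ (λ i → φ i * ψ i) ≤ ⟦ S ⟧ (λ i → φ i * φ i) * ⟦ S ⟧ (λ i → ψ i * ψ i)
cauchy-schwarz S φ ψ 0<ψψ = *-cancel-≤ {b} {a * a} {c * b} 0<ψψ (≤-via (sym expanded) (nonneg S λ i → 0≤p² (b * φ i - a * ψ i)))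
  where
  open ≡-Reasoning
  a b c : ℚ
  a = ⟦ S ⟧ λ i → φ i * ψ i
  b = ⟦ S ⟧ λ i → ψ i * ψ i
  c = ⟦ S ⟧ λ i → φ i * φ i
  expand : ∀ a b p q → (b * p - a * q) * (b * p - a * q) ≡ b * b * (p * p) + (- (2ℚ * a * b) * (p * q) + a * a * (q * q))
  expand = solve-∀ ring
  collect : ∀ a b c → b * b * c + (- (2ℚ * a * b) * a + a * a * b) ≡ b * (c * b) - b * (a * a)
  collect = solve-∀ ring
  expanded : ⟦ S ⟧ (λ i → (b * φ i - a * ψ i) * (b * φ i - a * ψ i)) ≡ b * (c * b) - b * (a * a)
  expanded = begin
    ⟦ S ⟧ (λ i → (b * φ i - a * ψ i) * (b * φ i - a * ψ i))
      ≡⟨ cong-⟦⟧ S (λ i → expand a b (φ i) (ψ i)) ⟩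
    ⟦ S ⟧ (λ i → b * b * (φ i * φ i) + (- (2ℚ * a * b) * (φ i * ψ i) + a * a * (ψ i * ψ i)))
      ≡⟨ S .+-homo (λ i → b * b * (φ i * φ i)) (λ i → - (2ℚ * a * b) * (φ i * ψ i) + a * a * (ψ i * ψ i)) ⟩
    ⟦ S ⟧ (λ i → b * b * (φ i * φ i)) + ⟦ S ⟧ (λ i → - (2ℚ * a * b) * (φ i * ψ i) + a * a * (ψ i * ψ i))
      ≡⟨ cong₂ _+_ (S .*-homo (b * b) (λ i → φ i * φ i))
           (trans (S .+-homo (λ i → - (2ℚ * a * b) * (φ i * ψ i)) (λ i → a * a * (ψ i * ψ i)))
             (cong₂ _+_ (S .*-homo (- (2ℚ * a * b)) (λ i → φ i * ψ i)) (S .*-homo (a * a) (λ i → ψ i * ψ i)))) ⟩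
    b * b * c + (- (2ℚ * a * b) * a + a * a * b)
      ≡⟨ collect a b c ⟩
    b * (c * b) - b * (a * a) ∎

-- quad c is B² times the variance of the entries of c. It replaces the usual sum of squared
-- signed counters, so that no random signs are needed.
module Buckets (β⁻ : ℕ) where

  β B : ℕ
  β = suc β⁻
  B = suc β

  -- B² times the covariance of the entries of `c` and `e`. It vanishes when `e` is constant, and
  -- the mean of a random unit vector is constant: this plays the part of a random sign of mean
  -- zero.
  form : (c e : Fin B → ℚ) → ℚ
  form c e = ι B * ⟦ ∑ B ⟧ (λ b → c b * e b) - ⟦ ∑ B ⟧ c * ⟦ ∑ B ⟧ e

  quad : (Fin B → ℚ) → ℚ
  quad c = form c c

  ∑-affine : ∀ (c e : Fin B → ℚ) μ → ⟦ ∑ B ⟧ (λ b → c b + μ * e b) ≡ ⟦ ∑ B ⟧ c + μ * ⟦ ∑ B ⟧ e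
  ∑-affine c e μ = trans (∑-+ c (λ b → μ * e b)) (cong (_+_ (⟦ ∑ B ⟧ c)) (∑-* μ e))

  quad-affine : ∀ c e μ → quad (λ b → c b + μ * e b) ≡ quad c + (2ℚ * μ * form c e + μ * μ * quad e)
  quad-affine c e μ = trans
    (cong₂ (λ p q → ι B * p - q * q) (∑-affine² c e μ) (∑-affine c e μ))
    (regroup (ι B) (⟦ ∑ B ⟧ λ b → c b * c b) (⟦ ∑ B ⟧ λ b → c b * e b) (⟦ ∑ B ⟧ λ b → e b * e b) (⟦ ∑ B ⟧ c) (⟦ ∑ B ⟧ e) μ)
    where
    regroup : ∀ B cc ce ee c e μ →
      B * (cc + (2ℚ * μ * ce + μ * μ * ee)) - (c + μ * e) * (c + μ * e)
        ≡ B * cc - c * c + (2ℚ * μ * (B * ce - c * e) + μ * μ * (B * ee - e * e))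
    regroup = solve-∀ ring

  ∑-centred² : ∀ (c : Fin B → ℚ) → let s = ⟦ ∑ B ⟧ c in
    ⟦ ∑ B ⟧ (λ b → (ι B * c b - s) * (ι B * c b - s)) ≡ ι B * quad c
  ∑-centred² c = begin
    ⟦ ∑ B ⟧ (λ b → (ι B * c b - s) * (ι B * c b - s))
      ≡⟨ cong-⟦⟧ (∑ B) (λ b → expand (ι B) (c b) s) ⟩
    ⟦ ∑ B ⟧ (λ b → (ι B * ι B * (c b * c b)) + (- (2ℚ * ι B * s) * c b + s * s))
      ≡⟨ ∑-+ (λ b → ι B * ι B * (c b * c b)) (λ b → - (2ℚ * ι B * s) * c b + s * s) ⟩
    ⟦ ∑ B ⟧ (λ b → ι B * ι B * (c b * c b)) + ⟦ ∑ B ⟧ (λ b → - (2ℚ * ι B * s) * c b + s * s)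
      ≡⟨ cong₂ _+_ (∑-* (ι B * ι B) (λ b → c b * c b))
           (trans (∑-+ (λ b → - (2ℚ * ι B * s) * c b) (λ _ → s * s)) (cong₂ _+_ (∑-* (- (2ℚ * ι B * s)) c) (∑-const B (s * s)))) ⟩
    ι B * ι B * ⟦ ∑ B ⟧ (λ b → c b * c b) + (- (2ℚ * ι B * s) * s + ι B * (s * s))
      ≡⟨ collect (ι B) (⟦ ∑ B ⟧ λ b → c b * c b) s ⟩
    ι B * quad c ∎
    where
    open ≡-Reasoning
    s : ℚ
    s = ⟦ ∑ B ⟧ c
    expand : ∀ B c s → (B * c - s) * (B * c - s) ≡ B * B * (c * c) + (- (2ℚ * B * s) * c + s * s)
    expand = solve-∀ ring
    collect : ∀ B cc s → B * B * cc + (- (2ℚ * B * s) * s + B * (s * s)) ≡ B * (B * cc - s * s)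
    collect = solve-∀ ring

  0≤quad : ∀ c → 0ℚ ≤ quad c
  0≤quad c = *-cancel-≤ (0<ι B) (subst₂ _≤_ (sym (ℚ.*-zeroʳ (ι B))) (∑-centred² c)
    (nonneg (∑ B) λ b → 0≤p² (ι B * c b - ⟦ ∑ B ⟧ c)))

  quad≤ : ∀ c → quad c ≤ ι B * ⟦ ∑ B ⟧ (λ b → c b * c b)
  quad≤ c = ≤-via (cancel (ι B * ⟦ ∑ B ⟧ λ b → c b * c b) (⟦ ∑ B ⟧ c * ⟦ ∑ B ⟧ c)) (0≤p² (⟦ ∑ B ⟧ c))
    where
    cancel : ∀ p q → p - (p - q) ≡ q
    cancel = solve-∀ ring

  draw : Rand (Fin B)
  draw = uniform β return

  δ-refl : ∀ {n} (i : Fin n) → δ i i ≡ 1ℚ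
  δ-refl zero    = refl
  δ-refl (suc i) = δ-refl i

  ∑-δ1 : ∀ {n} (ω : Fin n) → ⟦ ∑ n ⟧ (δ ω) ≡ 1ℚ
  ∑-δ1 {n} ω = trans (cong-⟦⟧ (∑ n) λ b → sym (ℚ.*-identityʳ (δ ω b))) (∑-δ ω λ _ → 1ℚ)

  form-δ : ∀ c ω → form c (δ ω) ≡ ι B * c ω - ⟦ ∑ B ⟧ c
  form-δ c ω = cong₂ (λ p q → ι B * p - q)
    (trans (cong-⟦⟧ (∑ B) λ b → ℚ.*-comm (c b) (δ ω b)) (∑-δ ω c))
    (trans (cong (⟦ ∑ B ⟧ c *_) (∑-δ1 ω)) (ℚ.*-identityʳ (⟦ ∑ B ⟧ c)))

  quad-δ : ∀ ω → quad (δ ω) ≡ ι β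
  quad-δ ω = begin
    form (δ ω) (δ ω) ≡⟨ form-δ (δ ω) ω ⟩
    ι B * δ ω ω - ⟦ ∑ B ⟧ (δ ω) ≡⟨ cong₂ (λ p q → ι B * p - q) (δ-refl ω) (∑-δ1 ω) ⟩
    ι B * 1ℚ - 1ℚ        ≡⟨ cong (λ p → p * 1ℚ - 1ℚ) (ι-suc β) ⟩
    (1ℚ + ι β) * 1ℚ - 1ℚ ≡⟨ cancel (ι β) ⟩
    ι β                  ∎
    where
    open ≡-Reasoning
    cancel : ∀ p → (1ℚ + p) * 1ℚ - 1ℚ ≡ p
    cancel = solve-∀ ring

  𝔼-form-δ : ∀ c → ⟦ 𝔼 draw ⟧ (λ ω → form c (δ ω)) ≡ 0ℚ
  𝔼-form-δ c = begin
    ⟦ 𝔼 draw ⟧ (λ ω → form c (δ ω))                    ≡⟨ cong-⟦⟧ (𝔼 draw) (λ ω → trans (form-δ c ω) (shape (ι B) (c ω) s)) ⟩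
    ⟦ 𝔼 draw ⟧ (λ ω → - s + (ι B * c ω + 0ℚ))          ≡⟨ 𝔼-affine draw (- s) (ι B) c (λ _ → 0ℚ) ⟩
    - s + (ι B * ⟦ 𝔼 draw ⟧ c + ⟦ 𝔼 draw ⟧ (λ _ → 0ℚ)) ≡⟨ cong (λ q → - s + (ι B * ⟦ 𝔼 draw ⟧ c + q)) (𝔼-const draw 0ℚ) ⟩
    - s + (ι B * (recip β * s) + 0ℚ)                   ≡⟨ regroup (ι B) (recip β) s ⟩
    - s + recip β * ι B * s                            ≡⟨ cong (λ q → - s + q * s) (recip-* β) ⟩
    - s + 1ℚ * s                                       ≡⟨ cancel s ⟩
    0ℚ                                                 ∎
    where
    open ≡-Reasoning
    s : ℚ
    s = ⟦ ∑ B ⟧ c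
    shape : ∀ B c s → B * c - s ≡ - s + (B * c + 0ℚ)
    shape = solve-∀ ring
    regroup : ∀ B r s → - s + (B * (r * s) + 0ℚ) ≡ - s + r * B * s
    regroup = solve-∀ ring
    cancel : ∀ s → - s + 1ℚ * s ≡ 0ℚ
    cancel = solve-∀ ring

  -- The values averaged are the entries of `c`, scaled by B and centred, so that `∑-centred²`
  -- applies.
  𝔼-form-δ² : ∀ c → ⟦ 𝔼 draw ⟧ (λ ω → form c (δ ω) * form c (δ ω)) ≡ quad c
  𝔼-form-δ² c = begin
    recip β * ⟦ ∑ B ⟧ (λ ω → form c (δ ω) * form c (δ ω)) ≡⟨ cong (recip β *_) (cong-⟦⟧ (∑ B) λ ω → cong (λ q → q * q) (form-δ c ω)) ⟩
    recip β * ⟦ ∑ B ⟧ (λ ω → (ι B * c ω - ⟦ ∑ B ⟧ c) * (ι B * c ω - ⟦ ∑ B ⟧ c))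
                                                            ≡⟨ cong (recip β *_) (∑-centred² c) ⟩
    recip β * (ι B * quad c) ≡⟨ ℚ.*-assoc (recip β) (ι B) (quad c) ⟨
    recip β * ι B * quad c   ≡⟨ cong (_* quad c) (recip-* β) ⟩
    1ℚ * quad c              ≡⟨ ℚ.*-identityˡ (quad c) ⟩
    quad c                   ∎
    where open ≡-Reasoning

  Hash : ℕ → Set
  Hash n = Vec (Fin B) n

  load : ∀ {n} → Hash n → (Fin n → ℚ) → Fin B → ℚ
  load {n} f x b = ⟦ ∑ n ⟧ λ i → δ (lookup f i) b * x i

  F₂ : ∀ {n} → (Fin n → ℚ) → ℚ
  F₂ {n} x = ⟦ ∑ n ⟧ λ i → x i * x i

  excess : ∀ {n} → Hash n → (Fin n → ℚ) → ℚ
  excess f x = quad (load f x) - ι β * F₂ x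

  excess² : ∀ {n} → Hash n → (Fin n → ℚ) → ℚ
  excess² f x = excess f x * excess f x

  random : ∀ n → Rand (Hash n)
  random n = sequence λ _ → draw

  quad-cong : ∀ {c e} → (∀ b → c b ≡ e b) → quad c ≡ quad e
  quad-cong c≗e = cong₂ (λ p q → ι B * p - q * q)
    (cong-⟦⟧ (∑ B) λ b → cong₂ _*_ (c≗e b) (c≗e b)) (cong-⟦⟧ (∑ B) c≗e)

  quad-load-∷ : ∀ {n} ω (f : Hash n) x → let c = load f (x ∘ suc) in
    quad (load (ω ∷ f) x) ≡ quad c + (2ℚ * x zero * form c (δ ω) + x zero * x zero * ι β)
  quad-load-∷ ω f x = begin
    quad (load (ω ∷ f) x)
      ≡⟨ quad-cong (λ b → trans (∑-suc (λ i → δ (lookup (ω ∷ f) i) b * x i)) (commute (δ ω b) (x zero) (c b))) ⟩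
    quad (λ b → c b + x zero * δ ω b)
      ≡⟨ quad-affine c (δ ω) (x zero) ⟩
    quad c + (2ℚ * x zero * form c (δ ω) + x zero * x zero * quad (δ ω))
      ≡⟨ cong (λ q → quad c + (2ℚ * x zero * form c (δ ω) + x zero * x zero * q)) (quad-δ ω) ⟩
    quad c + (2ℚ * x zero * form c (δ ω) + x zero * x zero * ι β) ∎
    where
    open ≡-Reasoning
    c : Fin B → ℚ
    c = load f (x ∘ suc)
    commute : ∀ d y c → d * y + c ≡ c + y * d
    commute = solve-∀ ring

  -- The diagonal term x₀² β is the same for every bucket and cancels against `F₂`. What remains has
  -- mean zero by `𝔼-form-δ`, so revealing the buckets item by item makes `excess` a martingale.
  excess-∷ : ∀ {n} ω (f : Hash n) x →
    excess (ω ∷ f) x ≡ excess f (x ∘ suc) + 2ℚ * x zero * form (load f (x ∘ suc)) (δ ω)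
  excess-∷ ω f x = trans (cong₂ (λ p q → p - ι β * q) (quad-load-∷ ω f x) (∑-suc λ i → x i * x i))
    (cancel (quad (load f (x ∘ suc))) (form (load f (x ∘ suc)) (δ ω)) (x zero) (ι β) (F₂ (x ∘ suc)))
    where
    cancel : ∀ q l y β F → q + (2ℚ * y * l + y * y * β) - β * (y * y + F) ≡ q - β * F + 2ℚ * y * l
    cancel = solve-∀ ring

  -- The bucket of the first item is averaged innermost, with the hash of all other items held
  -- fixed, as the martingale argument requires.
  𝔼-random-suc : ∀ {n} (φ : Hash (suc n) → ℚ) →
    ⟦ 𝔼 (random (suc n)) ⟧ φ ≡ ⟦ 𝔼 (random n) ⟧ λ f → ⟦ 𝔼 draw ⟧ λ ω → φ (ω ∷ f)
  𝔼-random-suc {n} φ = trans (𝔼-sequence-suc (λ _ → draw) φ) (𝔼-comm (𝔼 draw) (random n) λ ω f → φ (ω ∷ f))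

  excess-[] : ∀ (f : Hash 0) x → excess f x ≡ 0ℚ
  excess-[] f x = begin
    ι B * ⟦ ∑ B ⟧ (λ b → load f x b * load f x b) - ⟦ ∑ B ⟧ (load f x) * ⟦ ∑ B ⟧ (load f x) - ι β * F₂ x
      ≡⟨ cong₂ (λ p q → p - ι β * q) (quad-cong λ b → ∑-zero (λ i → δ (lookup f i) b * x i)) (∑-zero λ i → x i * x i) ⟩
    ι B * ⟦ ∑ B ⟧ (λ b → 0ℚ * 0ℚ) - ⟦ ∑ B ⟧ (λ _ → 0ℚ) * ⟦ ∑ B ⟧ (λ _ → 0ℚ) - ι β * 0ℚ
      ≡⟨ cong (λ p → ι B * p - p * p - ι β * 0ℚ) (0-homo (∑ B)) ⟩
    ι B * 0ℚ - 0ℚ * 0ℚ - ι β * 0ℚ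
      ≡⟨ cancel (ι B) (ι β) ⟩
    0ℚ ∎
    where
    open ≡-Reasoning
    cancel : ∀ B β → B * 0ℚ - 0ℚ * 0ℚ - β * 0ℚ ≡ 0ℚ
    cancel = solve-∀ ring

  𝔼-excess : ∀ n (x : Fin n → ℚ) → ⟦ 𝔼 (random n) ⟧ (λ f → excess f x) ≡ 0ℚ
  𝔼-excess zero    x = excess-[] [] x
  𝔼-excess (suc n) x = begin
    ⟦ 𝔼 (random (suc n)) ⟧ (λ f → excess f x)
      ≡⟨ 𝔼-random-suc (λ f → excess f x) ⟩
    (⟦ 𝔼 (random n) ⟧ λ f → ⟦ 𝔼 draw ⟧ λ ω → excess (ω ∷ f) x)
      ≡⟨ cong-⟦⟧ (𝔼 (random n)) step ⟩
    ⟦ 𝔼 (random n) ⟧ (λ f → excess f (x ∘ suc))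
      ≡⟨ 𝔼-excess n (x ∘ suc) ⟩
    0ℚ ∎
    where
    open ≡-Reasoning
    shape : ∀ e y l → e + 2ℚ * y * l ≡ e + (2ℚ * y * l + 0ℚ)
    shape = solve-∀ ring
    cancel : ∀ e y → e + (2ℚ * y * 0ℚ + 0ℚ) ≡ e
    cancel = solve-∀ ring
    step : ∀ f → ⟦ 𝔼 draw ⟧ (λ ω → excess (ω ∷ f) x) ≡ excess f (x ∘ suc)
    step f = begin
      ⟦ 𝔼 draw ⟧ (λ ω → excess (ω ∷ f) x)
        ≡⟨ cong-⟦⟧ (𝔼 draw) (λ ω → trans (excess-∷ ω f x) (shape e (x zero) (l ω))) ⟩
      ⟦ 𝔼 draw ⟧ (λ ω → e + (2ℚ * x zero * l ω + 0ℚ))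
        ≡⟨ 𝔼-affine draw e (2ℚ * x zero) l (λ _ → 0ℚ) ⟩
      e + (2ℚ * x zero * ⟦ 𝔼 draw ⟧ l + ⟦ 𝔼 draw ⟧ (λ _ → 0ℚ))
        ≡⟨ cong₂ (λ p q → e + (2ℚ * x zero * p + q)) (𝔼-form-δ (load f (x ∘ suc))) (𝔼-const draw 0ℚ) ⟩
      e + (2ℚ * x zero * 0ℚ + 0ℚ)
        ≡⟨ cancel e (x zero) ⟩
      e ∎
      where
      e : ℚ
      e = excess f (x ∘ suc)
      l : Fin B → ℚ
      l ω = form (load f (x ∘ suc)) (δ ω)

  -- Martingale differences are orthogonal: an item of frequency y adds 4 y² times the mean of
  -- `quad` for the other items, that is 4 y² β F. The step from 2 β F² to 2 β (y² + F)² pays for it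
  -- exactly and leaves 2 β y⁴ over.
  𝔼-excess² : ∀ n (x : Fin n → ℚ) →
    ⟦ 𝔼 (random n) ⟧ (λ f → excess² f x) ≤ 2ℚ * ι β * (F₂ x * F₂ x)
  𝔼-excess² zero    x = subst (_≤ 2ℚ * ι β * (F₂ x * F₂ x)) (sym (cong (λ q → q * q) (excess-[] [] x)))
    (0≤* (0≤* (ℚ.nonNegative⁻¹ 2ℚ) (0≤ι β)) (0≤p² (F₂ x)))
  𝔼-excess² (suc n) x = begin
    ⟦ 𝔼 (random (suc n)) ⟧ (λ f → excess² f x)
      ≡⟨ 𝔼-random-suc (λ f → excess² f x) ⟩
    (⟦ 𝔼 (random n) ⟧ λ f → ⟦ 𝔼 draw ⟧ λ ω → excess² (ω ∷ f) x)
      ≡⟨ cong-⟦⟧ (𝔼 (random n)) step ⟩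
    ⟦ 𝔼 (random n) ⟧ (λ f → 2ℚ * y * (2ℚ * y) * (ι β * F) + (2ℚ * y * (2ℚ * y) * excess f x′ + excess² f x′))
      ≡⟨ 𝔼-affine (random n) (2ℚ * y * (2ℚ * y) * (ι β * F)) (2ℚ * y * (2ℚ * y)) (λ f → excess f x′) (λ f → excess² f x′) ⟩
    2ℚ * y * (2ℚ * y) * (ι β * F) + (2ℚ * y * (2ℚ * y) * ⟦ 𝔼 (random n) ⟧ (λ f → excess f x′) + Z²)
      ≡⟨ cong (λ q → 2ℚ * y * (2ℚ * y) * (ι β * F) + (2ℚ * y * (2ℚ * y) * q + Z²)) (𝔼-excess n x′) ⟩
    2ℚ * y * (2ℚ * y) * (ι β * F) + (2ℚ * y * (2ℚ * y) * 0ℚ + Z²)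
      ≤⟨ ℚ.+-monoʳ-≤ (2ℚ * y * (2ℚ * y) * (ι β * F)) (ℚ.+-monoʳ-≤ (2ℚ * y * (2ℚ * y) * 0ℚ) (𝔼-excess² n x′)) ⟩
    2ℚ * y * (2ℚ * y) * (ι β * F) + (2ℚ * y * (2ℚ * y) * 0ℚ + 2ℚ * ι β * (F * F))
      ≤⟨ ≤-via (slack y (ι β) F) (0≤* (0≤* (ℚ.nonNegative⁻¹ 2ℚ) (0≤ι β)) (0≤p² (y * y))) ⟩
    2ℚ * ι β * ((y * y + F) * (y * y + F))
      ≡⟨ cong (λ q → 2ℚ * ι β * (q * q)) (∑-suc λ i → x i * x i) ⟨
    2ℚ * ι β * (F₂ x * F₂ x) ∎
    where
    open ℚ.≤-Reasoning
    y F Z² : ℚ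
    y = x zero
    x′ : Fin n → ℚ
    x′ = x ∘ suc
    F = F₂ x′
    Z² = ⟦ 𝔼 (random n) ⟧ λ f → excess² f x′
    slack : ∀ y β F → 2ℚ * β * ((y * y + F) * (y * y + F)) - (2ℚ * y * (2ℚ * y) * (β * F) + (2ℚ * y * (2ℚ * y) * 0ℚ + 2ℚ * β * (F * F)))
      ≡ 2ℚ * β * (y * y * (y * y))
    slack = solve-∀ ring
    expand : ∀ e y l → (e + 2ℚ * y * l) * (e + 2ℚ * y * l) ≡ e * e + (2ℚ * e * (2ℚ * y) * l + 2ℚ * y * (2ℚ * y) * (l * l))
    expand = solve-∀ ring
    -- Writes `quad` as `excess` plus β F, so that the linear term disappears by `𝔼-excess`.
    collect : ∀ q y βF → (q - βF) * (q - βF) + (2ℚ * (q - βF) * (2ℚ * y) * 0ℚ + 2ℚ * y * (2ℚ * y) * q)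
      ≡ 2ℚ * y * (2ℚ * y) * βF + (2ℚ * y * (2ℚ * y) * (q - βF) + (q - βF) * (q - βF))
    collect = solve-∀ ring
    step : ∀ f → ⟦ 𝔼 draw ⟧ (λ ω → excess² (ω ∷ f) x)
      ≡ 2ℚ * y * (2ℚ * y) * (ι β * F) + (2ℚ * y * (2ℚ * y) * excess f x′ + excess² f x′)
    step f = begin-equality
      ⟦ 𝔼 draw ⟧ (λ ω → excess² (ω ∷ f) x)
        ≡⟨ cong-⟦⟧ (𝔼 draw) (λ ω → trans (cong (λ q → q * q) (excess-∷ ω f x)) (expand e y (l ω))) ⟩
      ⟦ 𝔼 draw ⟧ (λ ω → e * e + (2ℚ * e * (2ℚ * y) * l ω + 2ℚ * y * (2ℚ * y) * (l ω * l ω)))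
        ≡⟨ 𝔼-affine draw (e * e) (2ℚ * e * (2ℚ * y)) l (λ ω → 2ℚ * y * (2ℚ * y) * (l ω * l ω)) ⟩
      e * e + (2ℚ * e * (2ℚ * y) * ⟦ 𝔼 draw ⟧ l + ⟦ 𝔼 draw ⟧ (λ ω → 2ℚ * y * (2ℚ * y) * (l ω * l ω)))
        ≡⟨ cong₂ (λ p q → e * e + (2ℚ * e * (2ℚ * y) * p + q)) (𝔼-form-δ (load f x′))
             (trans (𝔼 draw .*-homo (2ℚ * y * (2ℚ * y)) (λ ω → l ω * l ω)) (cong (2ℚ * y * (2ℚ * y) *_) (𝔼-form-δ² (load f x′)))) ⟩
      e * e + (2ℚ * e * (2ℚ * y) * 0ℚ + 2ℚ * y * (2ℚ * y) * quad (load f x′))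
        ≡⟨ collect (quad (load f x′)) y (ι β * F) ⟩
      2ℚ * y * (2ℚ * y) * (ι β * F) + (2ℚ * y * (2ℚ * y) * e + e * e) ∎
      where
      e : ℚ
      e = excess f x′
      l : Fin B → ℚ
      l ω = form (load f x′) (δ ω)

-- A small family of hash functions

module Derandomised (β⁻ n : ℕ) where
  open Buckets β⁻

  Pair : Set
  Pair = Fin n × Fin n

  pairs : PositiveFunctional Pair
  pairs = ∑ n ⊗ ∑ n

  quads : PositiveFunctional (Pair × Pair)
  quads = pairs ⊗ pairs

  -- The matrix of `excess f` as a quadratic form in x; its diagonal is zero.
  entry : Hash n → Pair → ℚ
  entry f (i , j) = ι B * δ (lookup f j) (lookup f i) - 1ℚ - ι β * δ i j

  entries : Pair × Pair → Hash n → ℚ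
  entries (p , q) f = entry f p * entry f q

  product : (Fin n → ℚ) → Pair → ℚ
  product x (i , j) = x i * x j

  products : (Fin n → ℚ) → Pair × Pair → ℚ
  products x (p , q) = product x p * product x q

  ∑-load² : ∀ f x → ⟦ ∑ B ⟧ (λ b → load f x b * load f x b)
    ≡ ⟦ pairs ⟧ λ (i , j) → δ (lookup f j) (lookup f i) * product x (i , j)
  ∑-load² f x = begin
    ⟦ ∑ B ⟧ (λ b → load f x b * load f x b)
      ≡⟨ cong-⟦⟧ (∑ B) (λ b → ⊗-* (∑ n) (∑ n) (term b) (term b)) ⟨
    (⟦ ∑ B ⟧ λ b → ⟦ pairs ⟧ λ (i , j) → term b i * term b j)
      ≡⟨ ∑-homo pairs B (λ b (i , j) → term b i * term b j) ⟨
    (⟦ pairs ⟧ λ (i , j) → ⟦ ∑ B ⟧ λ b → term b i * term b j)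
      ≡⟨ cong-⟦⟧ pairs (λ (i , j) → trans
           (cong-⟦⟧ (∑ B) λ b → regroup (δ (lookup f i) b) (x i) (δ (lookup f j) b) (x j))
           (∑-δ (lookup f i) λ b → δ (lookup f j) b * (x i * x j))) ⟩
    (⟦ pairs ⟧ λ (i , j) → δ (lookup f j) (lookup f i) * product x (i , j)) ∎
    where
    open ≡-Reasoning
    term : Fin B → Fin n → ℚ
    term b i = δ (lookup f i) b * x i
    regroup : ∀ d x e y → d * x * (e * y) ≡ d * (e * (x * y))
    regroup = solve-∀ ring

  ∑-load : ∀ f x → ⟦ ∑ B ⟧ (load f x) ≡ ⟦ ∑ n ⟧ x
  ∑-load f x = trans (∑-homo (∑ B) n (λ i b → δ (lookup f i) b * x i))
    (cong-⟦⟧ (∑ n) λ i → ∑-δ (lookup f i) λ _ → x i)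

  F₂-pairs : ∀ x → F₂ x ≡ ⟦ pairs ⟧ λ (i , j) → δ i j * product x (i , j)
  F₂-pairs x = cong-⟦⟧ (∑ n) λ i → sym (∑-δ i λ j → x i * x j)

  excess-entries : ∀ f x → excess f x ≡ ⟦ pairs ⟧ λ p → entry f p * product x p
  excess-entries f x = begin
    excess f x
      ≡⟨ cong₂ (λ p q → ι B * ⟦ ∑ B ⟧ (λ b → load f x b * load f x b) - p * p - ι β * q) (∑-load f x) (F₂-pairs x) ⟩
    ι B * ⟦ ∑ B ⟧ (λ b → load f x b * load f x b) - ⟦ ∑ n ⟧ x * ⟦ ∑ n ⟧ x - ι β * ⟦ pairs ⟧ d
      ≡⟨ cong₂ (λ p q → ι B * p - q - ι β * ⟦ pairs ⟧ d) (∑-load² f x) (sym (⊗-* (∑ n) (∑ n) x x)) ⟩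
    ι B * ⟦ pairs ⟧ c - ⟦ pairs ⟧ (product x) - ι β * ⟦ pairs ⟧ d
      ≡⟨ regroup (ι B) (⟦ pairs ⟧ c) (⟦ pairs ⟧ (product x)) (ι β) (⟦ pairs ⟧ d) ⟩
    ι B * ⟦ pairs ⟧ c + (- 1ℚ * ⟦ pairs ⟧ (product x) + - ι β * ⟦ pairs ⟧ d)
      ≡⟨ cong₂ _+_ (sym (pairs .*-homo (ι B) c))
           (trans (cong₂ _+_ (sym (pairs .*-homo (- 1ℚ) (product x))) (sym (pairs .*-homo (- ι β) d)))
             (sym (pairs .+-homo (λ p → - 1ℚ * product x p) (λ p → - ι β * d p)))) ⟩
    ⟦ pairs ⟧ (λ p → ι B * c p) + ⟦ pairs ⟧ (λ p → - 1ℚ * product x p + - ι β * d p)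
      ≡⟨ pairs .+-homo (λ p → ι B * c p) (λ p → - 1ℚ * product x p + - ι β * d p) ⟨
    ⟦ pairs ⟧ (λ p → ι B * c p + (- 1ℚ * product x p + - ι β * d p))
      ≡⟨ cong-⟦⟧ pairs (λ (i , j) → factor (ι B) (δ (lookup f j) (lookup f i)) (ι β) (δ i j) (x i * x j)) ⟩
    ⟦ pairs ⟧ (λ p → entry f p * product x p) ∎
    where
    open ≡-Reasoning
    c d : Pair → ℚ
    c (i , j) = δ (lookup f j) (lookup f i) * product x (i , j)
    d (i , j) = δ i j * product x (i , j)
    regroup : ∀ B c e β d → B * c - e - β * d ≡ B * c + (- 1ℚ * e + - β * d)
    regroup = solve-∀ ring
    factor : ∀ B c β d y → B * (c * y) + (- 1ℚ * y + - β * (d * y)) ≡ (B * c - 1ℚ - β * d) * y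
    factor = solve-∀ ring

  -- Separates the hash function from the stream: the coefficients `entries` depend on `f` alone. A
  -- list of hash functions that approximates the means of these coefficients therefore serves all
  -- streams at once.
  excess²-entries : ∀ f x → excess² f x ≡ ⟦ quads ⟧ λ q → entries q f * products x q
  excess²-entries f x = begin
    excess² f x
      ≡⟨ cong₂ _*_ (excess-entries f x) (excess-entries f x) ⟩
    ⟦ pairs ⟧ (λ p → entry f p * product x p) * ⟦ pairs ⟧ (λ p → entry f p * product x p)
      ≡⟨ ⊗-* pairs pairs (λ p → entry f p * product x p) (λ p → entry f p * product x p) ⟨
    (⟦ quads ⟧ λ (p , q) → entry f p * product x p * (entry f q * product x q))
      ≡⟨ cong-⟦⟧ quads (λ (p , q) → interchange (entry f p) (product x p) (entry f q) (product x q)) ⟩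
    (⟦ quads ⟧ λ q → entries q f * products x q) ∎
    where
    open ≡-Reasoning
    interchange : ∀ a b c d → a * b * (c * d) ≡ a * c * (b * d)
    interchange = solve-∀ ring

  ∑-product² : ∀ x → ⟦ pairs ⟧ (λ p → product x p * product x p) ≡ F₂ x * F₂ x
  ∑-product² x = trans (cong-⟦⟧ pairs λ (i , j) → interchange (x i) (x j)) (⊗-* (∑ n) (∑ n) (λ i → x i * x i) (λ i → x i * x i))
    where
    interchange : ∀ a b → a * b * (a * b) ≡ a * a * (b * b)
    interchange = solve-∀ ring

  ∑-products² : ∀ x → ⟦ quads ⟧ (λ q → products x q * products x q) ≡ F₂ x * F₂ x * (F₂ x * F₂ x)
  ∑-products² x = begin
    ⟦ quads ⟧ (λ q → products x q * products x q)
      ≡⟨ cong-⟦⟧ quads (λ (p , q) → interchange (product x p) (product x q)) ⟩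
    (⟦ quads ⟧ λ (p , q) → product x p * product x p * (product x q * product x q))
      ≡⟨ ⊗-* pairs pairs (λ p → product x p * product x p) (λ p → product x p * product x p) ⟩
    ⟦ pairs ⟧ (λ p → product x p * product x p) * ⟦ pairs ⟧ (λ p → product x p * product x p)
      ≡⟨ cong (λ q → q * q) (∑-product² x) ⟩
    F₂ x * F₂ x * (F₂ x * F₂ x) ∎
    where
    open ≡-Reasoning
    interchange : ∀ a b → a * b * (a * b) ≡ a * a * (b * b)
    interchange = solve-∀ ring

  entry²≤B² : ∀ f p → entry f p * entry f p ≤ ι B * ι B
  entry²≤B² f (i , j) = subst (λ b → (b * δ (lookup f j) (lookup f i) - 1ℚ - ι β * δ i j) * (b * δ (lookup f j) (lookup f i) - 1ℚ - ι β * δ i j) ≤ b * b)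
    (sym (ι-suc β)) (cases (does (lookup f j Fin.≟ lookup f i)) (does (i Fin.≟ j)))
    where
    bit : Bool → ℚ
    bit b = if b then 1ℚ else 0ℚ
    gap₁₁ : ∀ b → (1ℚ + b) * (1ℚ + b) - ((1ℚ + b) * 1ℚ - 1ℚ - b * 1ℚ) * ((1ℚ + b) * 1ℚ - 1ℚ - b * 1ℚ) ≡ (1ℚ + b) * (1ℚ + b)
    gap₁₁ = solve-∀ ring
    gap₁₀ : ∀ b → (1ℚ + b) * (1ℚ + b) - ((1ℚ + b) * 1ℚ - 1ℚ - b * 0ℚ) * ((1ℚ + b) * 1ℚ - 1ℚ - b * 0ℚ) ≡ 1ℚ + b + b
    gap₁₀ = solve-∀ ring
    gap₀₁ : ∀ b → (1ℚ + b) * (1ℚ + b) - ((1ℚ + b) * 0ℚ - 1ℚ - b * 1ℚ) * ((1ℚ + b) * 0ℚ - 1ℚ - b * 1ℚ) ≡ 0ℚ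
    gap₀₁ = solve-∀ ring
    gap₀₀ : ∀ b → (1ℚ + b) * (1ℚ + b) - ((1ℚ + b) * 0ℚ - 1ℚ - b * 0ℚ) * ((1ℚ + b) * 0ℚ - 1ℚ - b * 0ℚ) ≡ b * (1ℚ + 1ℚ + b)
    gap₀₀ = solve-∀ ring
    -- The two tests are generalised to arbitrary bits. The combination of distinct buckets with
    -- equal items cannot occur, but satisfies the bound as well.
    cases : ∀ x y → ((1ℚ + ι β) * bit x - 1ℚ - ι β * bit y) * ((1ℚ + ι β) * bit x - 1ℚ - ι β * bit y) ≤ (1ℚ + ι β) * (1ℚ + ι β)
    cases true  true  = ≤-via (gap₁₁ (ι β)) (0≤p² (1ℚ + ι β))
    cases true  false = ≤-via (gap₁₀ (ι β)) (0≤+ (0≤+ 0≤1 (0≤ι β)) (0≤ι β))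
    cases false true  = ≤-via (gap₀₁ (ι β)) ℚ.≤-refl
    cases false false = ≤-via (gap₀₀ (ι β)) (0≤* (0≤ι β) (0≤+ (0≤+ 0≤1 0≤1) (0≤ι β)))

  -- There are n⁴ coefficients with squares at most B⁴, so `t` is at least `V`: the squared
  -- deviation of the whole list is then at most t², and that of its average at most 1. The `suc`
  -- keeps `t` non-zero when n is 0.
  t : ℕ
  t = (B ℕ.* suc n) ^ 4

  t⁻ : ℕ
  t⁻ = pred t

  instance
    t≢0 : ℕ.NonZero t
    t≢0 = ℕ.m^n≢0 (B ℕ.* suc n) 4

  suc-t⁻ : suc t⁻ ≡ t
  suc-t⁻ = ℕ.suc-pred t

  variance≤t : V quads (random n) entries ≤ ι t
  variance≤t = begin
    (⟦ quads ⟧ λ q → ⟦ 𝔼 (random n) ⟧ λ f → entries q f * entries q f)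
      ≤⟨ quads .mono (λ q → ℚ.≤-trans (𝔼 (random n) .mono (λ f → entries²≤ q f)) (ℚ.≤-reflexive (𝔼-const (random n) B⁴))) ⟩
    ⟦ quads ⟧ (λ _ → B⁴)
      ≡⟨ cong-⟦⟧ pairs (λ _ → pairs-const B⁴) ⟩
    ⟦ pairs ⟧ (λ _ → ι n * (ι n * B⁴))
      ≡⟨ pairs-const (ι n * (ι n * B⁴)) ⟩
    ι n * (ι n * (ι n * (ι n * B⁴)))
      ≡⟨ regroup (ι n) (ι B) ⟩
    ι B * ι n * (ι B * ι n * (ι B * ι n * (ι B * ι n * 1ℚ)))
      ≡⟨ cong (λ q → q * (q * (q * (q * 1ℚ)))) (ι-* B n) ⟨
    ι b * (ι b * (ι b * (ι b * 1ℚ)))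
      ≡⟨ trans (ι-* b (b ℕ.* (b ℕ.* (b ℕ.* 1)))) (cong (ι b *_) (trans (ι-* b (b ℕ.* (b ℕ.* 1))) (cong (ι b *_)
           (trans (ι-* b (b ℕ.* 1)) (cong (ι b *_) (trans (ι-* b 1) (cong (ι b *_) ι-1))))))) ⟨
    ι (b ^ 4)
      ≤⟨ ι-mono (ℕ.^-monoˡ-≤ 4 (ℕ.*-monoʳ-≤ B (ℕ.n≤1+n n))) ⟩
    ι t ∎
    where
    open ℚ.≤-Reasoning
    B⁴ : ℚ
    B⁴ = ι B * ι B * (ι B * ι B)
    b : ℕ
    b = B ℕ.* n
    pairs-const : ∀ c → ⟦ pairs ⟧ (λ _ → c) ≡ ι n * (ι n * c)
    pairs-const c = trans (cong-⟦⟧ (∑ n) λ _ → ∑-const n c) (∑-const n (ι n * c))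
    regroup : ∀ n B → n * (n * (n * (n * (B * B * (B * B))))) ≡ B * n * (B * n * (B * n * (B * n * 1ℚ)))
    regroup = solve-∀ ring
    interchange : ∀ a b → a * b * (a * b) ≡ a * a * (b * b)
    interchange = solve-∀ ring
    entries²≤ : ∀ q f → entries q f * entries q f ≤ B⁴
    entries²≤ (p , q) f = subst (_≤ B⁴) (sym (interchange (entry f p) (entry f q)))
      (*-mono (0≤p² (entry f p)) (0≤p² (ι B)) (entry²≤B² f p) (entry²≤B² f q))

  -- Determined by n and β alone and hence available to the update function without being stored;
  -- the memory holds only an index.
  hashes : ℕ → Hash n
  hashes = proj₁ (derandomise quads (random n) entries t)

  drawSeed : Rand (Fin (suc t⁻))
  drawSeed = uniform t⁻ return

  private
    dev : Pair × Pair → ℚ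
    dev = deviation quads (random n) entries t hashes

    mean : Pair × Pair → ℚ
    mean q = ⟦ 𝔼 (random n) ⟧ (entries q)

  dev²≤ : ⟦ quads ⟧ (λ q → dev q * dev q) ≤ ι t * ι t
  dev²≤ = ℚ.≤-trans (proj₂ (derandomise quads (random n) entries t)) (*-monoˡ (0≤ι t) variance≤t)

  ∑-entries : ∀ q → ⟦ ∑ t ⟧ (λ τ → entries q (hashes (toℕ τ))) ≡ dev q + ι t * mean q
  ∑-entries q = begin
    ⟦ ∑ t ⟧ (λ τ → entries q (hashes (toℕ τ)))
      ≡⟨ cong-⟦⟧ (∑ t) (λ τ → split (entries q (hashes (toℕ τ))) (mean q)) ⟩
    ⟦ ∑ t ⟧ (λ τ → entries q (hashes (toℕ τ)) - mean q + mean q)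
      ≡⟨ ∑-+ (λ τ → entries q (hashes (toℕ τ)) - mean q) (λ (_ : Fin t) → mean q) ⟩
    dev q + ⟦ ∑ t ⟧ (λ _ → mean q)
      ≡⟨ cong (_+_ (dev q)) (∑-const t (mean q)) ⟩
    dev q + ι t * mean q ∎
    where
    open ≡-Reasoning
    split : ∀ e m → e ≡ e - m + m
    split = solve-∀ ring

  -- The coefficients are split into mean and deviation. The means give `𝔼-excess²`; for the
  -- deviations Cauchy-Schwarz yields at most t F₂², since their norm is at most t and the vector of
  -- products has norm F₂².
  ∑-excess² : ∀ x → 0ℚ < F₂ x →
    ⟦ ∑ t ⟧ (λ τ → excess² (hashes (toℕ τ)) x) ≤ ι t * (2ℚ * ι β * (F₂ x * F₂ x) + F₂ x * F₂ x)
  ∑-excess² x 0<F = begin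
    ⟦ ∑ t ⟧ (λ τ → excess² (hashes (toℕ τ)) x)
      ≡⟨ cong-⟦⟧ (∑ t) (λ τ → excess²-entries (hashes (toℕ τ)) x) ⟩
    (⟦ ∑ t ⟧ λ τ → ⟦ quads ⟧ λ q → entries q (hashes (toℕ τ)) * products x q)
      ≡⟨ ∑-homo quads t (λ τ q → entries q (hashes (toℕ τ)) * products x q) ⟨
    (⟦ quads ⟧ λ q → ⟦ ∑ t ⟧ λ τ → entries q (hashes (toℕ τ)) * products x q)
      ≡⟨ cong-⟦⟧ quads (λ q → trans (*-homoʳ (∑ t) (products x q) (λ τ → entries q (hashes (toℕ τ))))
           (trans (cong (_* products x q) (∑-entries q)) (distrib (dev q) (ι t) (mean q) (products x q)))) ⟩
    ⟦ quads ⟧ (λ q → dev q * products x q + ι t * (mean q * products x q))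
      ≡⟨ quads .+-homo (λ q → dev q * products x q) (λ q → ι t * (mean q * products x q)) ⟩
    ⟦ quads ⟧ (λ q → dev q * products x q) + ⟦ quads ⟧ (λ q → ι t * (mean q * products x q))
      ≡⟨ cong (_+_ (⟦ quads ⟧ λ q → dev q * products x q))
           (trans (quads .*-homo (ι t) (λ q → mean q * products x q)) (cong (ι t *_) mean-excess²)) ⟩
    ⟦ quads ⟧ (λ q → dev q * products x q) + ι t * ⟦ 𝔼 (random n) ⟧ (λ f → excess² f x)
      ≤⟨ ℚ.+-mono-≤ dev≤ (*-monoˡ (0≤ι t) (𝔼-excess² n x)) ⟩
    ι t * F⁴ + ι t * (2ℚ * ι β * F⁴)
      ≡⟨ collect (ι t) F⁴ (2ℚ * ι β * F⁴) ⟩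
    ι t * (2ℚ * ι β * F⁴ + F⁴) ∎
    where
    open ℚ.≤-Reasoning
    F⁴ : ℚ
    F⁴ = F₂ x * F₂ x
    distrib : ∀ d t m p → (d + t * m) * p ≡ d * p + t * (m * p)
    distrib = solve-∀ ring
    collect : ∀ t f g → t * f + t * g ≡ t * (g + f)
    collect = solve-∀ ring
    interchange : ∀ t f → t * t * (f * f) ≡ t * f * (t * f)
    interchange = solve-∀ ring
    mean-excess² : ⟦ quads ⟧ (λ q → mean q * products x q) ≡ ⟦ 𝔼 (random n) ⟧ λ f → excess² f x
    mean-excess² = begin-equality
      ⟦ quads ⟧ (λ q → mean q * products x q)
        ≡⟨ cong-⟦⟧ quads (λ q → *-homoʳ (𝔼 (random n)) (products x q) (entries q)) ⟨
      (⟦ quads ⟧ λ q → ⟦ 𝔼 (random n) ⟧ λ f → entries q f * products x q)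
        ≡⟨ 𝔼-comm quads (random n) (λ q f → entries q f * products x q) ⟩
      (⟦ 𝔼 (random n) ⟧ λ f → ⟦ quads ⟧ λ q → entries q f * products x q)
        ≡⟨ cong-⟦⟧ (𝔼 (random n)) (λ f → excess²-entries f x) ⟨
      (⟦ 𝔼 (random n) ⟧ λ f → excess² f x) ∎
    0<F⁴ : 0ℚ < F⁴
    0<F⁴ = subst (_< F⁴) (ℚ.*-zeroʳ (F₂ x)) (ℚ.*-monoʳ-<-pos (F₂ x) {{positive 0<F}} 0<F)
    0<∑products² : 0ℚ < ⟦ quads ⟧ (λ q → products x q * products x q)
    0<∑products² = subst (0ℚ <_) (sym (∑-products² x))
      (subst (_< F⁴ * F⁴) (ℚ.*-zeroʳ F⁴) (ℚ.*-monoʳ-<-pos F⁴ {{positive 0<F⁴}} 0<F⁴))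
    dev≤ : ⟦ quads ⟧ (λ q → dev q * products x q) ≤ ι t * F⁴
    dev≤ = p²≤q²⇒p≤q (0≤* (0≤ι t) (ℚ.<⇒≤ 0<F⁴)) (begin
      ⟦ quads ⟧ (λ q → dev q * products x q) * ⟦ quads ⟧ (λ q → dev q * products x q)
        ≤⟨ cauchy-schwarz quads dev (products x) 0<∑products² ⟩
      ⟦ quads ⟧ (λ q → dev q * dev q) * ⟦ quads ⟧ (λ q → products x q * products x q)
        ≤⟨ *-monoʳ (ℚ.<⇒≤ 0<∑products²) dev²≤ ⟩
      ι t * ι t * ⟦ quads ⟧ (λ q → products x q * products x q)
        ≡⟨ cong (ι t * ι t *_) (∑-products² x) ⟩
      ι t * ι t * (F⁴ * F⁴)
        ≡⟨ interchange (ι t) F⁴ ⟩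
      ι t * F⁴ * (ι t * F⁴) ∎)

  𝔼-seed-excess² : ∀ x → 0ℚ < F₂ x →
    ⟦ 𝔼 drawSeed ⟧ (λ τ → excess² (hashes (toℕ τ)) x) ≤ 3ℚ * ι β * (F₂ x * F₂ x)
  𝔼-seed-excess² x 0<F = begin
    recip t⁻ * ⟦ ∑ (suc t⁻) ⟧ (λ τ → excess² (hashes (toℕ τ)) x)
      ≡⟨ cong (λ N → recip t⁻ * ⟦ ∑ N ⟧ (λ τ → excess² (hashes (toℕ τ)) x)) suc-t⁻ ⟩
    recip t⁻ * ⟦ ∑ t ⟧ (λ τ → excess² (hashes (toℕ τ)) x)
      ≤⟨ *-monoˡ (0≤recip t⁻) (∑-excess² x 0<F) ⟩
    recip t⁻ * (ι t * (2ℚ * ι β * F⁴ + F⁴))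
      ≡⟨ ℚ.*-assoc (recip t⁻) (ι t) (2ℚ * ι β * F⁴ + F⁴) ⟨
    recip t⁻ * ι t * (2ℚ * ι β * F⁴ + F⁴)
      ≡⟨ cong (_* (2ℚ * ι β * F⁴ + F⁴)) (recip-pred t) ⟩
    1ℚ * (2ℚ * ι β * F⁴ + F⁴)
      -- As β ≥ 1, the additional F₂² caused by the deviations fits into the third β F₂².
      ≤⟨ ≤-via (slack (ι β) F⁴) (0≤* (p≤q⇒0≤q-p (1≤ι β)) (0≤p² (F₂ x))) ⟩
    3ℚ * ι β * F⁴ ∎
    where
    open ℚ.≤-Reasoning
    F⁴ : ℚ
    F⁴ = F₂ x * F₂ x
    slack : ∀ β f → 3ℚ * β * f - 1ℚ * (2ℚ * β * f + f) ≡ (β - 1ℚ) * f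
    slack = solve-∀ ring

-- Prefix codes and streaming machines

-- length-encode says that x is encoded in at most overhead + 2 log₂ (weight x) bits.
record Code (Ω : Set) : Set₁ where
  field
    encode        : Ω → List Bool
    decode        : List Bool → Ω × List Bool
    decode-encode : ∀ x s → decode (encode x ++ s) ≡ (x , s)
    weight        : Ω → ℕ
    overhead      : ℕ
    length-encode : ∀ x → 2 ^ length (encode x) ℕ.≤ 2 ^ overhead ℕ.* (weight x ℕ.* weight x)
    -- The relation between a store and its successors; updates respect it, so that codes never get
    -- shorter along a run.
    _⊑_           : Ω → Ω → Set
    length-mono   : ∀ {x y} → x ⊑ y → length (encode x) ℕ.≤ length (encode y)

  read : List Bool → Ω
  read = proj₁ ∘ decode

  read-encode : ∀ x → read (encode x) ≡ x
  read-encode x = trans (cong read (sym (List.++-identityʳ (encode x)))) (cong proj₁ (decode-encode x []))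

-- Every digit of the bijective binary numeral follows a continuation bit, and one `false` ends the
-- code. It is self-delimiting at two bits per digit, which is the reason for the squared `weight`.
encodeᵇ : ℕᵇ → List Bool
encodeᵇ ℕᵇ.zero  = false ∷ []
encodeᵇ 2[1+ x ] = true ∷ false ∷ encodeᵇ x
encodeᵇ 1+[2 x ] = true ∷ true ∷ encodeᵇ x

decodeᵇ : List Bool → ℕᵇ × List Bool
decodeᵇ []                 = ℕᵇ.zero , []
decodeᵇ (false ∷ s)        = ℕᵇ.zero , s
decodeᵇ (true ∷ [])        = ℕᵇ.zero , []
decodeᵇ (true ∷ false ∷ s) = map₁ 2[1+_] (decodeᵇ s)
decodeᵇ (true ∷ true ∷ s)  = map₁ 1+[2_] (decodeᵇ s)

decode-encodeᵇ : ∀ x s → decodeᵇ (encodeᵇ x ++ s) ≡ (x , s)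
decode-encodeᵇ ℕᵇ.zero  s = refl
decode-encodeᵇ 2[1+ x ] s = cong (map₁ 2[1+_]) (decode-encodeᵇ x s)
decode-encodeᵇ 1+[2 x ] s = cong (map₁ 1+[2_]) (decode-encodeᵇ x s)

length-encodeᵇ : ∀ x → 2 ^ length (encodeᵇ x) ℕ.≤ 2 ℕ.* (suc (ℕᵇ.toℕ x) ℕ.* suc (ℕᵇ.toℕ x))
length-encodeᵇ ℕᵇ.zero  = ℕ.≤-refl
length-encodeᵇ 2[1+ x ] = begin
  2 ℕ.* (2 ℕ.* 2 ^ length (encodeᵇ x))          ≤⟨ ℕ.*-monoʳ-≤ 2 (ℕ.*-monoʳ-≤ 2 (length-encodeᵇ x)) ⟩
  2 ℕ.* (2 ℕ.* (2 ℕ.* (suc v ℕ.* suc v)))         ≡⟨ regroup v ⟩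
  2 ℕ.* ((2 ℕ.* suc v) ℕ.* (2 ℕ.* suc v))         ≤⟨ ℕ.*-monoʳ-≤ 2 (ℕ.*-mono-≤ (ℕ.n≤1+n (2 ℕ.* suc v)) (ℕ.n≤1+n (2 ℕ.* suc v))) ⟩
  2 ℕ.* (suc (2 ℕ.* suc v) ℕ.* suc (2 ℕ.* suc v)) ∎
  where
  open ℕ.≤-Reasoning
  v : ℕ
  v = ℕᵇ.toℕ x
  regroup : ∀ v → 2 ℕ.* (2 ℕ.* (2 ℕ.* (suc v ℕ.* suc v))) ≡ 2 ℕ.* ((2 ℕ.* suc v) ℕ.* (2 ℕ.* suc v))
  regroup = ℕ-Solver.solve-∀
length-encodeᵇ 1+[2 x ] = begin
  2 ℕ.* (2 ℕ.* 2 ^ length (encodeᵇ x))              ≤⟨ ℕ.*-monoʳ-≤ 2 (ℕ.*-monoʳ-≤ 2 (length-encodeᵇ x)) ⟩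
  2 ℕ.* (2 ℕ.* (2 ℕ.* (suc v ℕ.* suc v)))             ≡⟨ regroup v ⟩
  2 ℕ.* (suc (suc (2 ℕ.* v)) ℕ.* suc (suc (2 ℕ.* v))) ∎
  where
  open ℕ.≤-Reasoning
  v : ℕ
  v = ℕᵇ.toℕ x
  regroup : ∀ v → 2 ℕ.* (2 ℕ.* (2 ℕ.* (suc v ℕ.* suc v))) ≡ 2 ℕ.* (suc (suc (2 ℕ.* v)) ℕ.* suc (suc (2 ℕ.* v)))
  regroup = ℕ-Solver.solve-∀

length-encodeᵇ-suc : ∀ x → length (encodeᵇ x) ℕ.≤ length (encodeᵇ (ℕᵇ.suc x))
length-encodeᵇ-suc ℕᵇ.zero  = s≤s z≤n
length-encodeᵇ-suc 2[1+ x ] = s≤s (s≤s (length-encodeᵇ-suc x))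
length-encodeᵇ-suc 1+[2 x ] = ℕ.≤-refl

natCode : Code ℕ
natCode = record
  { encode        = encodeᵇ ∘ fromℕ'
  ; decode        = map₁ ℕᵇ.toℕ ∘ decodeᵇ
  ; decode-encode = λ x s → trans (cong (map₁ ℕᵇ.toℕ) (decode-encodeᵇ (fromℕ' x) s)) (cong (_, s) (ℕᵇ.toℕ-fromℕ' x))
  ; weight        = suc
  ; overhead      = 1
  ; length-encode = λ x → subst (λ v → 2 ^ length (encodeᵇ (fromℕ' x)) ℕ.≤ 2 ℕ.* (suc v ℕ.* suc v))
                                (ℕᵇ.toℕ-fromℕ' x) (length-encodeᵇ (fromℕ' x))
  ; _⊑_           = ℕ._≤′_
  ; length-mono   = mono-≤′
  }
  where
  mono-≤′ : ∀ {x y} → x ℕ.≤′ y → length (encodeᵇ (fromℕ' x)) ℕ.≤ length (encodeᵇ (fromℕ' y))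
  mono-≤′ ℕ.≤′-refl               = ℕ.≤-refl
  mono-≤′ (ℕ.≤′-step {n = y} x≤y) = ℕ.≤-trans (mono-≤′ x≤y) (length-encodeᵇ-suc (fromℕ' y))

module _ (c : Code Ω) where
  open Code c

  encodes : ∀ {N} → Vec Ω N → List Bool
  encodes []      = []
  encodes (x ∷ v) = encode x ++ encodes v

  decodes : ∀ N → List Bool → Vec Ω N × List Bool
  decodes zero    s = [] , s
  decodes (suc N) s = map₁ (read s ∷_) (decodes N (proj₂ (decode s)))

  decodes-encodes : ∀ {N} (v : Vec Ω N) s → decodes N (encodes v ++ s) ≡ (v , s)
  decodes-encodes []      s = refl
  decodes-encodes {suc N} (x ∷ v) s
    rewrite List.++-assoc (encode x) (encodes v) s | decode-encode x (encodes v ++ s) | decodes-encodes v s = refl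

  -- Weights multiply where code lengths add, so that the mean weight factors over independent
  -- components.
  weights : ∀ {N} → Vec Ω N → ℕ
  weights []      = 1
  weights (x ∷ v) = weight x ℕ.* weights v

  ι-weights : ∀ {N} (v : Vec Ω N) → ι (weights v) ≡ ∏ λ b → ι (weight (lookup v b))
  ι-weights []      = ι-1
  ι-weights (x ∷ v) = trans (ι-* (weight x) (weights v)) (cong (ι (weight x) *_) (ι-weights v))

  length-encodes : ∀ {N} (v : Vec Ω N) → 2 ^ length (encodes v) ℕ.≤ 2 ^ (N ℕ.* overhead) ℕ.* (weights v ℕ.* weights v)
  length-encodes []      = ℕ.≤-refl
  length-encodes {suc N} (x ∷ v) = begin
    2 ^ length (encode x ++ encodes v)
      ≡⟨ cong (2 ℕ.^_) (List.length-++ (encode x)) ⟩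
    2 ^ (length (encode x) ℕ.+ length (encodes v))
      ≡⟨ ℕ.^-distribˡ-+-* 2 (length (encode x)) (length (encodes v)) ⟩
    2 ^ length (encode x) ℕ.* 2 ^ length (encodes v)
      ≤⟨ ℕ.*-mono-≤ (length-encode x) (length-encodes v) ⟩
    (2 ^ overhead ℕ.* (weight x ℕ.* weight x)) ℕ.* (2 ^ (N ℕ.* overhead) ℕ.* (weights v ℕ.* weights v))
      ≡⟨ regroup (2 ^ overhead) (weight x) (2 ^ (N ℕ.* overhead)) (weights v) ⟩
    2 ^ overhead ℕ.* 2 ^ (N ℕ.* overhead) ℕ.* (weight x ℕ.* weights v ℕ.* (weight x ℕ.* weights v))
      ≡⟨ cong (ℕ._* (weight x ℕ.* weights v ℕ.* (weight x ℕ.* weights v))) (ℕ.^-distribˡ-+-* 2 overhead (N ℕ.* overhead)) ⟨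
    2 ^ (suc N ℕ.* overhead) ℕ.* (weight x ℕ.* weights v ℕ.* (weight x ℕ.* weights v)) ∎
    where
    open ℕ.≤-Reasoning
    regroup : ∀ a x b y → (a ℕ.* (x ℕ.* x)) ℕ.* (b ℕ.* (y ℕ.* y)) ≡ a ℕ.* b ℕ.* (x ℕ.* y ℕ.* (x ℕ.* y))
    regroup = ℕ-Solver.solve-∀

  vecCode : ∀ N → Code (Vec Ω N)
  vecCode N = record
    { encode        = encodes
    ; decode        = decodes N
    ; decode-encode = decodes-encodes
    ; weight        = weights
    ; overhead      = N ℕ.* overhead
    ; length-encode = length-encodes
    ; _⊑_           = λ v w → ∀ b → lookup v b ⊑ lookup w b
    ; length-mono   = λ {v} {w} → mono-pointwise v w
    }
    where
    mono-pointwise : ∀ {N} (v w : Vec Ω N) → (∀ b → lookup v b ⊑ lookup w b) → length (encodes v) ℕ.≤ length (encodes w)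
    mono-pointwise []      []      v⊑w = z≤n
    mono-pointwise (x ∷ v) (y ∷ w) v⊑w = subst₂ ℕ._≤_ (sym (List.length-++ (encode x))) (sym (List.length-++ (encode y)))
      (ℕ.+-mono-≤ (length-mono (v⊑w zero)) (mono-pointwise v w (v⊑w ∘ suc)))

-- The analysis concerns structured stores; this module transfers it to algorithms on bit strings.
module Machine {n : ℕ} (c : Code Store) (start : Rand Store) (step : Store → Fin n → Rand Store) (out : Store → ℚ)
               (step-⊑ : ∀ s i → Always (Code._⊑_ c s) (step s i)) where
  open Code c

  algorithm : StreamingAlgorithm n
  algorithm = record
    { init   = start >>= λ s → return (encode s)
    ; update = λ m i → step (read m) i >>= λ s → return (encode s)
    ; output = λ m → return (out (read m))
    }

  bits : Store → ℕ
  bits s = length (encode s)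

  steps-mono : ∀ s σ → Always (λ s′ → bits s ℕ.≤ bits s′) (steps step s σ)
  steps-mono s []      = ℕ.≤-refl
  steps-mono s (i ∷ σ) = Always->>= (step s i) (step-⊑ s i) λ s₁ s⊑s₁ →
    always-map (steps step s₁ σ) (λ _ → ℕ.≤-trans (length-mono s⊑s₁)) (steps-mono s₁ σ)

  -- The encoding never shrinks, so the peak is attained at the end.
  𝔼-runFrom : ∀ s σ φ → ⟦ 𝔼 (runFrom algorithm (encode s) σ) ⟧ φ ≡ ⟦ 𝔼 (steps step s σ) ⟧ λ s′ → φ (bits s′ , out s′)
  𝔼-runFrom s []      φ = cong (λ x → φ (bits s , out x)) (read-encode s)
  𝔼-runFrom s (i ∷ σ) φ = begin
    ⟦ 𝔼 (runFrom algorithm (encode s) (i ∷ σ)) ⟧ φ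
      ≡⟨ 𝔼->>= (step (read (encode s)) i >>= λ s₁ → return (encode s₁)) _ φ ⟩
    ⟦ 𝔼 (step (read (encode s)) i >>= λ s₁ → return (encode s₁)) ⟧ continue
      ≡⟨ 𝔼->>= (step (read (encode s)) i) (λ s₁ → return (encode s₁)) continue ⟩
    ⟦ 𝔼 (step (read (encode s)) i) ⟧ (λ s₁ → continue (encode s₁))
      ≡⟨ cong (λ x → ⟦ 𝔼 (step x i) ⟧ (λ s₁ → continue (encode s₁))) (read-encode s) ⟩
    ⟦ 𝔼 (step s i) ⟧ (λ s₁ → continue (encode s₁))
      ≡⟨ cong-⟦⟧ (𝔼 (step s i)) (λ s₁ → trans (𝔼->>= (runFrom algorithm (encode s₁) σ) _ φ)
           (𝔼-runFrom s₁ σ (λ (peak , v) → φ (bits s ℕ.⊔ peak , v)))) ⟩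
    (⟦ 𝔼 (step s i) ⟧ λ s₁ → ⟦ 𝔼 (steps step s₁ σ) ⟧ λ s′ → φ (bits s ℕ.⊔ bits s′ , out s′))
      ≡⟨ 𝔼->>= (step s i) (λ s₁ → steps step s₁ σ) (λ s′ → φ (bits s ℕ.⊔ bits s′ , out s′)) ⟨
    ⟦ 𝔼 (steps step s (i ∷ σ)) ⟧ (λ s′ → φ (bits s ℕ.⊔ bits s′ , out s′))
      ≡⟨ 𝔼-cong-Always (steps step s (i ∷ σ)) (always-map (steps step s (i ∷ σ))
           (λ s′ s≤s′ → cong (λ p → φ (p , out s′)) (ℕ.m≤n⇒m⊔n≡n s≤s′)) (steps-mono s (i ∷ σ))) ⟩
    ⟦ 𝔼 (steps step s (i ∷ σ)) ⟧ (λ s′ → φ (bits s′ , out s′)) ∎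
    where
    open ≡-Reasoning
    continue : Memory → ℚ
    continue m = ⟦ 𝔼 (runFrom algorithm m σ >>= λ (peak , v) → return (bits s ℕ.⊔ peak , v)) ⟧ φ

  𝔼-run : ∀ σ φ → ⟦ 𝔼 (run algorithm σ) ⟧ φ ≡ ⟦ 𝔼 start ⟧ λ s → ⟦ 𝔼 (steps step s σ) ⟧ λ s′ → φ (bits s′ , out s′)
  𝔼-run σ φ = trans (𝔼->>= (start >>= λ s → return (encode s)) (λ m → runFrom algorithm m σ) φ)
    (trans (𝔼->>= start (λ s → return (encode s)) (λ m → ⟦ 𝔼 (runFrom algorithm m σ) ⟧ φ))
      (cong-⟦⟧ (𝔼 start) λ s → 𝔼-runFrom s σ φ))

-- Medians

#_ : ∀ {P : Ω → Set} → Decidable P → List Ω → ℕ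
(# P?) xs = length (filter P? xs)

#-mono : ∀ {P Q : Ω → Set} (P? : Decidable P) (Q? : Decidable Q) {xs} → All (λ x → P x → Q x) xs → (# P?) xs ℕ.≤ (# Q?) xs
#-mono P? Q? [] = z≤n
#-mono P? Q? {x ∷ xs} (p⇒q ∷ imps) with P? x | Q? x
... | yes p | yes q = s≤s (#-mono P? Q? imps)
... | yes p | no ¬q = contradiction (p⇒q p) ¬q
... | no ¬p | yes q = ℕ.m≤n⇒m≤1+n (#-mono P? Q? imps)
... | no ¬p | no ¬q = #-mono P? Q? imps

#-cover : ∀ {P Q : Ω → Set} (P? : Decidable P) (Q? : Decidable Q) xs → (∀ x → ¬ P x → Q x) → length xs ℕ.≤ (# P?) xs ℕ.+ (# Q?) xs
#-cover P? Q? []       _    = z≤n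
#-cover P? Q? (x ∷ xs) ¬p⇒q with P? x | Q? x
... | yes p | yes q = s≤s (ℕ.≤-trans (#-cover P? Q? xs ¬p⇒q) (ℕ.+-monoʳ-≤ ((# P?) xs) (ℕ.n≤1+n _)))
... | yes p | no ¬q = s≤s (#-cover P? Q? xs ¬p⇒q)
... | no ¬p | yes q = subst (suc (length xs) ℕ.≤_) (sym (ℕ.+-suc ((# P?) xs) ((# Q?) xs))) (s≤s (#-cover P? Q? xs ¬p⇒q))
... | no ¬p | no ¬q = contradiction (¬p⇒q x ¬p) ¬q

IsCandidate : List ℚ → ℚ → Set
IsCandidate vs y = length vs ℕ.< 2 ℕ.* (# (ℚ._≤? y)) vs

isCandidate? : ∀ vs → Decidable (IsCandidate vs)
isCandidate? vs y = length vs ℕ.<? 2 ℕ.* (# (ℚ._≤? y)) vs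

-- The least entry that is at least more than half of the entries; the default
-- Extrema.max 0ℚ vs never matters, as the largest entry is a candidate.
median : List ℚ → ℚ
median vs = Extrema.min (Extrema.max 0ℚ vs) (filter (isCandidate? vs) vs)

module _ {Good : ℚ → Set} (bad? : Decidable (λ v → ¬ Good v)) {lo hi : ℚ}
         (vs : List ℚ)
         (few : 2 ℕ.* (# bad?) vs ℕ.< length vs) where

  private
    N : ℕ
    N = length vs

  -- At or below a candidate smaller than `lo` there are only bad entries, too few for the majority
  -- that makes it a candidate.
  lo≤median : (∀ v → Good v → lo ≤ v) → lo ≤ median vs
  lo≤median good⇒lo≤ = Extrema.v≤min⁺ lo≤max (All.map (λ {y} → lo≤candidate {y}) (All.all-filter (isCandidate? vs) vs))
    where
    lo≤candidate : ∀ {y} → IsCandidate vs y → lo ≤ y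
    lo≤candidate {y} cand with lo ℚ.≤? y
    ... | yes lo≤y = lo≤y
    ... | no lo≰y = contradiction (ℕ.<-trans cand (ℕ.≤-<-trans (ℕ.*-monoʳ-≤ 2 below) few)) (ℕ.<-irrefl refl)
      where
      below : (# (ℚ._≤? y)) vs ℕ.≤ (# bad?) vs
      below = #-mono (ℚ._≤? y) bad? (All.universal (λ v v≤y g → lo≰y (ℚ.≤-trans (good⇒lo≤ v g) v≤y)) vs)
    -- The minimum is taken over the default too, so the default needs the same lower bound: were it
    -- below `lo`, every entry would be bad.
    lo≤max : lo ≤ Extrema.max 0ℚ vs
    lo≤max with lo ℚ.≤? Extrema.max 0ℚ vs
    ... | yes p = p
    ... | no lo≰max = contradiction (ℕ.<-≤-trans few (ℕ.≤-trans (ℕ.≤-reflexive (sym (cong length all-bad))) (ℕ.m≤m+n ((# bad?) vs) _))) (ℕ.<-irrefl refl)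
      where
      all-bad : filter bad? vs ≡ vs
      all-bad = List.filter-all bad? (All.map (λ {v} v≤max g → lo≰max (ℚ.≤-trans (good⇒lo≤ v g) v≤max)) (Extrema.xs≤max 0ℚ vs))

  -- The entries up to `hi` include all good ones and form a strict majority; the largest of them is
  -- therefore a candidate, and it bounds the minimum.
  median≤hi : (∀ v → Good v → v ≤ hi) → median vs ≤ hi
  median≤hi good⇒≤hi = Extrema.min≤v⁺ (Extrema.max 0ℚ vs) (filter (isCandidate? vs) vs) (inj₂ found)
    where
    below : List ℚ
    below = filter (ℚ._≤? hi) vs

    most : N ℕ.< 2 ℕ.* length below
    most = ℕ.+-cancelʳ-< N N (2 ℕ.* length below) (begin-strict
      N ℕ.+ N                                  ≡⟨ cong (N ℕ.+_) (ℕ.+-identityʳ N) ⟨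
      2 ℕ.* N                                  ≤⟨ ℕ.*-monoʳ-≤ 2 (#-cover (ℚ._≤? hi) bad? vs (λ v v≰hi g → v≰hi (good⇒≤hi v g))) ⟩
      2 ℕ.* (length below ℕ.+ (# bad?) vs)     ≡⟨ ℕ.*-distribˡ-+ 2 (length below) ((# bad?) vs) ⟩
      2 ℕ.* length below ℕ.+ 2 ℕ.* (# bad?) vs <⟨ ℕ.+-monoʳ-< (2 ℕ.* length below) few ⟩
      2 ℕ.* length below ℕ.+ N                 ∎)
      where open ℕ.≤-Reasoning

    top : ∀ ys → 1 ℕ.≤ length ys → Σ[ g ∈ ℚ ] (g ∈ ys × All (_≤ g) ys)
    top (y ∷ ys) _ with Extrema.argmax-sel (λ v → v) y ys
    ... | inj₁ eq = y , here refl , ℚ.≤-refl ∷ subst (λ g → All (_≤ g) ys) eq (Extrema.xs≤max y ys)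
    ... | inj₂ ∈ys = Extrema.max y ys , there ∈ys , Extrema.⊥≤max y ys ∷ Extrema.xs≤max y ys

    nonempty : 1 ℕ.≤ length below
    nonempty with below | most
    ... | []    | ()
    ... | _ ∷ _ | _ = s≤s z≤n

    found : Any (_≤ hi) (filter (isCandidate? vs) vs)
    found with g , g∈below , below≤g ← top below nonempty
      with g∈vs , g≤hi ← ∈-filter⁻ (ℚ._≤? hi) {xs = vs} g∈below =
      lose (∈-filter⁺ (isCandidate? vs) g∈vs (ℕ.<-≤-trans most (ℕ.*-monoʳ-≤ 2
        (#-mono (ℚ._≤? hi) (ℚ._≤? g) {vs} (All.tabulate λ v∈vs v≤hi → All.lookup below≤g (∈-filter⁺ (ℚ._≤? hi) {xs = vs} v∈vs v≤hi)))))) g≤hi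

∏-≥1 : ∀ {N} {Y : Fin N → ℚ} → (∀ r → 1ℚ ≤ Y r) → 1ℚ ≤ ∏ Y
∏-≥1 {zero}  1≤Y = ℚ.≤-refl
∏-≥1 {suc N} {Y} 1≤Y = subst (_≤ Y zero * ∏ (Y ∘ suc)) (ℚ.*-identityˡ 1ℚ)
  (*-mono 0≤1 (ℚ.≤-trans 0≤1 (∏-≥1 (1≤Y ∘ suc))) (1≤Y zero) (∏-≥1 (1≤Y ∘ suc)))

∏-# : ∀ {P : Ω → Set} (P? : Decidable P) {N} (v : Fin N → Ω) (Y : Fin N → ℚ) →
  (∀ r → 1ℚ ≤ Y r) → (∀ r → P (v r) → ι 16 ≤ Y r) → ι (16 ^ (# P?) (tabulate v)) ≤ ∏ Y
∏-# P? {zero}  v Y 1≤Y 16≤Y = ℚ.≤-reflexive ι-1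
∏-# P? {suc N} v Y 1≤Y 16≤Y with P? (v zero)
... | yes p = begin
  ι (16 ℕ.* 16 ^ k)  ≡⟨ ι-* 16 (16 ^ k) ⟩
  ι 16 * ι (16 ^ k)  ≤⟨ *-mono (0≤ι 16) 0≤∏ (16≤Y zero p) IH ⟩
  Y zero * ∏ (Y ∘ suc) ∎
  where
  open ℚ.≤-Reasoning
  k : ℕ
  k = (# P?) (tabulate (v ∘ suc))
  IH : ι (16 ^ k) ≤ ∏ (Y ∘ suc)
  IH = ∏-# P? (v ∘ suc) (Y ∘ suc) (1≤Y ∘ suc) (λ r → 16≤Y (suc r))
  0≤∏ : 0ℚ ≤ ∏ (Y ∘ suc)
  0≤∏ = ℚ.≤-trans 0≤1 (∏-≥1 (1≤Y ∘ suc))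
... | no ¬p = begin
  ι (16 ^ k)         ≡⟨ ℚ.*-identityˡ (ι (16 ^ k)) ⟨
  1ℚ * ι (16 ^ k)    ≤⟨ *-mono 0≤1 (ℚ.≤-trans 0≤1 (∏-≥1 (1≤Y ∘ suc))) (1≤Y zero)
                                   (∏-# P? (v ∘ suc) (Y ∘ suc) (1≤Y ∘ suc) (λ r → 16≤Y (suc r))) ⟩
  Y zero * ∏ (Y ∘ suc) ∎
  where
  open ℚ.≤-Reasoning
  k : ℕ
  k = (# P?) (tabulate (v ∘ suc))

-- If at least half of the N factors reach 16 and the rest are at least 1, the product is at least
-- the square root of 16^N. This turns a bad median into a large product, ready for Markov's
-- inequality.
∏-majority : ∀ {P : Ω → Set} (P? : Decidable P) {N} (v : Fin N → Ω) (Y : Fin N → ℚ) →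
  (∀ r → 1ℚ ≤ Y r) → (∀ r → P (v r) → ι 16 ≤ Y r) → N ℕ.≤ 2 ℕ.* (# P?) (tabulate v) → ι (4 ^ N) ≤ ∏ Y
∏-majority P? {N} v Y 1≤Y 16≤Y many = ℚ.≤-trans (ι-mono (begin
  4 ^ N                           ≤⟨ ℕ.^-monoʳ-≤ 4 many ⟩
  4 ^ (2 ℕ.* (# P?) (tabulate v)) ≡⟨ ℕ.^-*-assoc 4 2 ((# P?) (tabulate v)) ⟨
  16 ^ (# P?) (tabulate v)        ∎)) (∏-# P? v Y 1≤Y 16≤Y)
  where open ℕ.≤-Reasoning

-- Frequency vectors

δ-sym : ∀ {n} (i j : Fin n) → δ i j ≡ δ j i
δ-sym zero    zero    = refl
δ-sym zero    (suc j) = refl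
δ-sym (suc i) zero    = refl
δ-sym (suc i) (suc j) = δ-sym i j

x[_] : ∀ {n} → List (Fin n) → Fin n → ℚ
x[ σ ] i = ι (frequency σ i)

x-∷ : ∀ {n} (j : Fin n) σ i → x[ j ∷ σ ] i ≡ δ i j + x[ σ ] i
x-∷ j σ i with i Fin.≟ j
... | yes _ = ι-suc (frequency σ i)
... | no _  = sym (ℚ.+-identityˡ (ι (frequency σ i)))

∑-x[] : ∀ {n} (φ : Fin n → ℚ) → ⟦ ∑ n ⟧ (λ i → φ i * x[ [] ] i) ≡ 0ℚ
∑-x[] {n} φ = trans (cong-⟦⟧ (∑ n) λ i → trans (cong (φ i *_) ι-0) (ℚ.*-zeroʳ (φ i))) (0-homo (∑ n))

-- An arrival adds a unit vector, so every linear statistic of the frequencies can be computed along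
-- the stream.
∑-x∷ : ∀ {n} (φ : Fin n → ℚ) j σ → ⟦ ∑ n ⟧ (λ i → φ i * x[ j ∷ σ ] i) ≡ φ j + ⟦ ∑ n ⟧ (λ i → φ i * x[ σ ] i)
∑-x∷ {n} φ j σ = begin
  ⟦ ∑ n ⟧ (λ i → φ i * x[ j ∷ σ ] i)
    ≡⟨ cong-⟦⟧ (∑ n) (λ i → trans (cong (φ i *_) (trans (x-∷ j σ i) (cong (_+ x[ σ ] i) (δ-sym i j)))) (distrib (φ i) (δ j i) (x[ σ ] i))) ⟩
  ⟦ ∑ n ⟧ (λ i → δ j i * φ i + φ i * x[ σ ] i)
    ≡⟨ ∑-+ (λ i → δ j i * φ i) (λ i → φ i * x[ σ ] i) ⟩
  ⟦ ∑ n ⟧ (λ i → δ j i * φ i) + ⟦ ∑ n ⟧ (λ i → φ i * x[ σ ] i)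
    ≡⟨ cong (_+ ⟦ ∑ n ⟧ (λ i → φ i * x[ σ ] i)) (∑-δ j φ) ⟩
  φ j + ⟦ ∑ n ⟧ (λ i → φ i * x[ σ ] i) ∎
  where
  open ≡-Reasoning
  distrib : ∀ p d x → p * (d + x) ≡ d * p + p * x
  distrib = solve-∀ ring

∑-x : ∀ {n} (σ : List (Fin n)) → ⟦ ∑ n ⟧ x[ σ ] ≡ ι (length σ)
∑-x {n} σ = trans (cong-⟦⟧ (∑ n) λ i → sym (ℚ.*-identityˡ (x[ σ ] i))) (go σ)
  where
  go : ∀ σ → ⟦ ∑ n ⟧ (λ i → 1ℚ * x[ σ ] i) ≡ ι (length σ)
  go []      = trans (∑-x[] (λ _ → 1ℚ)) (sym ι-0)
  go (j ∷ σ) = trans (∑-x∷ (λ _ → 1ℚ) j σ) (trans (cong (_+_ 1ℚ) (go σ)) (sym (ι-suc (length σ))))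

count-∑ : ∀ {n} (hit : Fin n → Bool) σ → ι (count hit σ) ≡ ⟦ ∑ n ⟧ λ i → (if hit i then 1ℚ else 0ℚ) * x[ σ ] i
count-∑ hit []      = trans ι-0 (sym (∑-x[] λ i → if hit i then 1ℚ else 0ℚ))
count-∑ {n} hit (j ∷ σ) = trans (split (hit j)) (sym (∑-x∷ (λ i → if hit i then 1ℚ else 0ℚ) j σ))
  where
  s : ℚ
  s = ⟦ ∑ n ⟧ λ i → (if hit i then 1ℚ else 0ℚ) * x[ σ ] i
  split : ∀ b → ι (if b then suc (count hit σ) else count hit σ) ≡ (if b then 1ℚ else 0ℚ) + s
  split true  = trans (ι-suc (count hit σ)) (cong (_+_ 1ℚ) (count-∑ hit σ))
  split false = trans (count-∑ hit σ) (sym (ℚ.+-identityˡ s))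

count≤length : ∀ (hit : Ω → Bool) σ → count hit σ ℕ.≤ length σ
count≤length hit []      = z≤n
count≤length hit (i ∷ σ) with hit i
... | true  = s≤s (count≤length hit σ)
... | false = ℕ.m≤n⇒m≤1+n (count≤length hit σ)

ι-sum : ∀ {n} (f : Fin n → ℕ) → ι (ℕΣ.sum f) ≡ ⟦ ∑ n ⟧ (λ i → ι (f i))
ι-sum {zero}  f = trans ι-0 (sym (∑-zero (λ i → ι (f i))))
ι-sum {suc n} f = trans (ι-+ (f zero) (ℕΣ.sum (f ∘ suc)))
  (trans (cong (_+_ (ι (f zero))) (ι-sum (f ∘ suc))) (sym (∑-suc λ i → ι (f i))))

ι-‖‖₂² : ∀ {n} (σ : List (Fin n)) → ι ‖ frequency σ ‖₂² ≡ ⟦ ∑ n ⟧ λ i → x[ σ ] i * x[ σ ] i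
ι-‖‖₂² {n} σ = trans (ι-sum (λ i → frequency σ i ^ 2)) (cong-⟦⟧ (∑ n) λ i →
  trans (cong (λ y → ι (frequency σ i ℕ.* y)) (ℕ.*-identityʳ (frequency σ i))) (ι-* (frequency σ i) (frequency σ i)))

ι-#-∷ : ∀ {P : Ω → Set} (P? : Decidable P) x xs → ι ((# P?) (x ∷ xs)) ≡ indicator P? x + ι ((# P?) xs)
ι-#-∷ P? x xs with P? x
... | yes _ = ι-suc ((# P?) xs)
... | no _  = sym (ℚ.+-identityˡ (ι ((# P?) xs)))

ι-#-tabulate : ∀ {P : Ω → Set} (P? : Decidable P) {n} (v : Fin n → Ω) →
  ι ((# P?) (tabulate v)) ≡ ⟦ ∑ n ⟧ λ i → indicator P? (v i)
ι-#-tabulate P? {zero}  v = trans ι-0 (sym (∑-zero λ i → indicator P? (v i)))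
ι-#-tabulate P? {suc n} v = trans (ι-#-∷ P? (v zero) (tabulate (v ∘ suc)))
  (trans (cong (_+_ (indicator P? (v zero))) (ι-#-tabulate P? (v ∘ suc))) (sym (∑-suc λ i → indicator P? (v i))))

-- Cauchy-Schwarz on the support: with m the length of the stream, the squares (m - k x_i)² are
-- summed over the non-zero entries, of which there are at most k. This is where sparsity enters.
length²≤k*F₂ : ∀ {n} k .{{_ : ℕ.NonZero k}} (σ : List (Fin n)) → ‖ frequency σ ‖₀ ℕ.≤ k →
  ι (length σ) * ι (length σ) ≤ ι k * ⟦ ∑ n ⟧ (λ i → x[ σ ] i * x[ σ ] i)
length²≤k*F₂ {n} k σ sparse = *-cancel-≤ {ι k} {m * m} {ι k * F} (0<ι k)
  (≤-via (regroup (ι k) m F) (p≤q⇒0≤q-p summed))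
  where
  open ℚ.≤-Reasoning
  m F : ℚ
  m = ι (length σ)
  F = ⟦ ∑ n ⟧ λ i → x[ σ ] i * x[ σ ] i
  nonzero? : Decidable (λ i → ¬ frequency σ i ≡ 0)
  nonzero? i = ¬? (frequency σ i ℕ.≟ 0)
  regroup : ∀ k m F → k * (k * F) - k * (m * m) ≡ m * m * k + k * k * F - 2ℚ * m * k * m
  regroup = solve-∀ ring
  square : ∀ m k x → m * m * 1ℚ + k * k * (x * x) - 2ℚ * m * k * x ≡ (m - k * x) * (m - k * x)
  square = solve-∀ ring
  vanish : ∀ m k → 2ℚ * m * k * 0ℚ ≡ m * m * 0ℚ + k * k * (0ℚ * 0ℚ)
  vanish = solve-∀ ring
  entry : ∀ y → 2ℚ * m * ι k * ι y ≤ m * m * (if does (¬? (y ℕ.≟ 0)) then 1ℚ else 0ℚ) + ι k * ι k * (ι y * ι y)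
  entry zero    = ℚ.≤-reflexive (subst (λ x → 2ℚ * m * ι k * x ≡ m * m * 0ℚ + ι k * ι k * (x * x)) (sym ι-0) (vanish m (ι k)))
  entry (suc y) = ≤-via (square m (ι k) (ι (suc y))) (0≤p² (m - ι k * ι (suc y)))
  summed : 2ℚ * m * ι k * m ≤ m * m * ι k + ι k * ι k * F
  summed = begin
    2ℚ * m * ι k * m
      ≡⟨ cong (2ℚ * m * ι k *_) (∑-x σ) ⟨
    2ℚ * m * ι k * ⟦ ∑ n ⟧ x[ σ ]
      ≡⟨ ∑-* (2ℚ * m * ι k) x[ σ ] ⟨
    ⟦ ∑ n ⟧ (λ i → 2ℚ * m * ι k * x[ σ ] i)
      ≤⟨ ∑ n .mono (λ i → entry (frequency σ i)) ⟩
    ⟦ ∑ n ⟧ (λ i → m * m * indicator nonzero? i + ι k * ι k * (x[ σ ] i * x[ σ ] i))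
      ≡⟨ ∑-+ (λ i → m * m * indicator nonzero? i) (λ i → ι k * ι k * (x[ σ ] i * x[ σ ] i)) ⟩
    ⟦ ∑ n ⟧ (λ i → m * m * indicator nonzero? i) + ⟦ ∑ n ⟧ (λ i → ι k * ι k * (x[ σ ] i * x[ σ ] i))
      ≡⟨ cong₂ _+_ (∑-* (m * m) (indicator nonzero?)) (∑-* (ι k * ι k) (λ i → x[ σ ] i * x[ σ ] i)) ⟩
    m * m * ⟦ ∑ n ⟧ (indicator nonzero?) + ι k * ι k * F
      ≡⟨ cong (λ z → m * m * z + ι k * ι k * F) (ι-#-tabulate nonzero? (λ i → i)) ⟨
    m * m * ι ‖ frequency σ ‖₀ + ι k * ι k * F
      ≤⟨ ℚ.+-monoˡ-≤ (ι k * ι k * F) (*-monoˡ (0≤p² m) (ι-mono sparse)) ⟩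
    m * m * ι k + ι k * ι k * F ∎

-- Accuracy of the estimate

-- Unlike the opaque `ι` this computes on numerals, so that the ring solver can calculate with the
-- constants.
#ℚ_ : ℕ → ℚ
#ℚ a = ℤ.+ a / 1

0≤#ℚ : ∀ a → 0ℚ ≤ #ℚ a
0≤#ℚ a = subst (0ℚ ≤_) (ι-fromℕ a) (0≤ι a)

-- With q = quad c, H = quad e and φ = form c e, positivity of quad (c ± 4E e) bounds the cross term 2φ.
module _ {E s G q H φ : ℚ} (Es≡1 : E * s ≡ 1ℚ) (0≤E : 0ℚ ≤ E) (0≤s : 0ℚ ≤ s) (s≤1 : s ≤ 1ℚ) (0≤G : 0ℚ ≤ G) (0≤H : 0ℚ ≤ H)
         (20H≤ : #ℚ 20 * H ≤ G * (s * s))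
         where

  private
    20EH≤ : #ℚ 20 * (E * H) ≤ G * s
    20EH≤ = subst₂ _≤_ (commute E H) (trans (regroup E G s) (trans (cong (G * s *_) Es≡1) (ℚ.*-identityʳ (G * s)))) (*-monoˡ 0≤E 20H≤)
      where
      commute : ∀ E H → E * (#ℚ 20 * H) ≡ #ℚ 20 * (E * H)
      commute = solve-∀ ring
      regroup : ∀ E G s → E * (G * (s * s)) ≡ G * s * (E * s)
      regroup = solve-∀ ring

    0≤sG : 0ℚ ≤ s * G
    0≤sG = 0≤* 0≤s 0≤G

  -- Positivity gives 2φ ≤ s q / 4 + 4 E H. In units of s G the error is at most 1/4 from q - G,
  -- 5/16 from s q / 4, 1/5 from 4 E H and 1/20 from H, together less than 1. The certificate is
  -- this computation multiplied by 80.
  accuracy-upper : 0ℚ ≤ q + (2ℚ * - (#ℚ 4 * E) * φ + - (#ℚ 4 * E) * - (#ℚ 4 * E) * H) →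
    #ℚ 4 * q ≤ #ℚ 4 * G + s * G → q + (2ℚ * φ + H) ≤ (1ℚ + s) * G
  accuracy-upper psd q≤ = *-cancel-≤ {#ℚ 80} {q + (2ℚ * φ + H)} {(1ℚ + s) * G} (ℚ.positive⁻¹ (#ℚ 80))
    (≤-via (certificate E s G q H φ)
      (0≤+ (0≤+ (0≤+ (0≤+ (0≤* (0≤+ (0≤#ℚ 20) (0≤* (0≤#ℚ 5) 0≤s)) (p≤q⇒0≤q-p q≤))
                          (0≤* (0≤#ℚ 20) cross))
                     (0≤* (0≤#ℚ 16) (p≤q⇒0≤q-p 20EH≤)))
                (0≤* (0≤#ℚ 4) (p≤q⇒0≤q-p 20H≤)))
           (0≤+ (0≤* (0≤#ℚ 15) 0≤sG) (0≤* (0≤* (0≤#ℚ 9) 0≤sG) (p≤q⇒0≤q-p s≤1)))))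
    where
    certificate : ∀ E s G q H φ → #ℚ 80 * ((1ℚ + s) * G) - #ℚ 80 * (q + (2ℚ * φ + H))
      ≡ (#ℚ 20 + #ℚ 5 * s) * (#ℚ 4 * G + s * G - #ℚ 4 * q) + #ℚ 20 * (s * q - #ℚ 8 * 1ℚ * φ + #ℚ 16 * E * 1ℚ * H)
        + #ℚ 16 * (G * s - #ℚ 20 * (E * H)) + #ℚ 4 * (G * (s * s) - #ℚ 20 * H)
        + (#ℚ 15 * (s * G) + #ℚ 9 * (s * G) * (1ℚ - s))
    certificate = solve-∀ ring
    expand : ∀ E s q H φ → s * (q + (2ℚ * - (#ℚ 4 * E) * φ + - (#ℚ 4 * E) * - (#ℚ 4 * E) * H))
      ≡ s * q - #ℚ 8 * (E * s) * φ + #ℚ 16 * E * (E * s) * H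
    expand = solve-∀ ring
    cross : 0ℚ ≤ s * q - #ℚ 8 * 1ℚ * φ + #ℚ 16 * E * 1ℚ * H
    cross = subst (0ℚ ≤_) (trans (expand E s q H φ) (cong (λ e → s * q - #ℚ 8 * e * φ + #ℚ 16 * E * e * H) Es≡1)) (0≤* 0≤s psd)

  -- Now the summand H only helps, and 2φ ≥ - s q / 4 - 4 E H leaves at least (1 - s/4)² G - s G /
  -- 5.
  accuracy-lower : 0ℚ ≤ q + (2ℚ * (#ℚ 4 * E) * φ + #ℚ 4 * E * (#ℚ 4 * E) * H) →
    #ℚ 4 * G - s * G ≤ #ℚ 4 * q → (1ℚ - s) * G ≤ q + (2ℚ * φ + H)
  accuracy-lower psd ≤q = *-cancel-≤ {#ℚ 80} {(1ℚ - s) * G} {q + (2ℚ * φ + H)} (ℚ.positive⁻¹ (#ℚ 80))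
    (≤-via (certificate E s G q H φ)
      (0≤+ (0≤+ (0≤+ (0≤+ (0≤* (0≤+ (0≤#ℚ 15) (0≤* (0≤#ℚ 5) (p≤q⇒0≤q-p s≤1))) (p≤q⇒0≤q-p ≤q))
                          (0≤* (0≤#ℚ 20) cross))
                     (0≤* (0≤#ℚ 16) (p≤q⇒0≤q-p 20EH≤)))
                (0≤* (0≤#ℚ 80) 0≤H))
           (0≤+ (0≤* (0≤#ℚ 24) 0≤sG) (0≤* (0≤#ℚ 5) (0≤* 0≤s 0≤sG)))))
    where
    certificate : ∀ E s G q H φ → #ℚ 80 * (q + (2ℚ * φ + H)) - #ℚ 80 * ((1ℚ - s) * G)
      ≡ (#ℚ 15 + #ℚ 5 * (1ℚ - s)) * (#ℚ 4 * q - (#ℚ 4 * G - s * G)) + #ℚ 20 * (s * q + #ℚ 8 * 1ℚ * φ + #ℚ 16 * E * 1ℚ * H)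
        + #ℚ 16 * (G * s - #ℚ 20 * (E * H)) + #ℚ 80 * H
        + (#ℚ 24 * (s * G) + #ℚ 5 * (s * (s * G)))
    certificate = solve-∀ ring
    expand : ∀ E s q H φ → s * (q + (2ℚ * (#ℚ 4 * E) * φ + #ℚ 4 * E * (#ℚ 4 * E) * H))
      ≡ s * q + #ℚ 8 * (E * s) * φ + #ℚ 16 * E * (E * s) * H
    expand = solve-∀ ring
    cross : 0ℚ ≤ s * q + #ℚ 8 * 1ℚ * φ + #ℚ 16 * E * 1ℚ * H
    cross = subst (0ℚ ≤_) (trans (expand E s q H φ) (cong (λ e → s * q + #ℚ 8 * e * φ + #ℚ 16 * E * e * H) Es≡1)) (0≤* 0≤s psd)

0≤∏ : ∀ {N} {f : Fin N → ℚ} → (∀ b → 0ℚ ≤ f b) → 0ℚ ≤ ∏ f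
0≤∏ {zero}  0≤f = 0≤1
0≤∏ {suc N} 0≤f = 0≤* (0≤f zero) (0≤∏ (0≤f ∘ suc))

∏-mono : ∀ {N} {f g : Fin N → ℚ} → (∀ b → 0ℚ ≤ f b) → (∀ b → f b ≤ g b) → ∏ f ≤ ∏ g
∏-mono {zero}  0≤f f≤g = ℚ.≤-refl
∏-mono {suc N} {f} {g} 0≤f f≤g = *-mono (0≤f zero) (ℚ.≤-trans (0≤∏ (0≤f ∘ suc)) tail≤) (f≤g zero) tail≤
  where
  tail≤ : ∏ (f ∘ suc) ≤ ∏ (g ∘ suc)
  tail≤ = ∏-mono (0≤f ∘ suc) (f≤g ∘ suc)

∏-const : ∀ N c → ∏ {N} (λ _ → ι c) ≡ ι (c ^ N)
∏-const zero    c = sym ι-1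
∏-const (suc N) c = trans (cong (ι c *_) (∏-const N c)) (sym (ι-* c (c ^ N)))

+1/6 : ℚ
+1/6 = ℤ.+ 1 / 6

-- A single sketch: a seed and one Morris counter per bucket

module Sketch (β⁻ A⁻ n : ℕ) where
  open Buckets β⁻ public
  open Derandomised β⁻ n public
  open Morris A⁻ public

  hit : Hash n → Fin B → Fin n → Bool
  hit f b i = does (lookup f i Fin.≟ b)

  bucketStep : Hash n → Fin B → ℕ → Fin n → Rand ℕ
  bucketStep f b = step (hit f b)

  -- The seed is the head of the vector, as a number, so that the code for numbers serves seed and
  -- counters alike.
  SketchState : Set
  SketchState = Vec ℕ (suc B)

  sketchCode : Code SketchState
  sketchCode = vecCode natCode (suc B)

  sketchStart : Rand SketchState
  sketchStart = drawSeed >>= λ τ → return (toℕ τ ∷ replicate B 0)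

  sketchStep : SketchState → Fin n → Rand SketchState
  sketchStep (τ ∷ X) i = parallel (bucketStep (hashes τ)) X i >>= λ X′ → return (τ ∷ X′)

  estimates : Vec ℕ B → Fin B → ℚ
  estimates X b = estimate (lookup X b)

  sketchOutput : SketchState → ℚ
  sketchOutput (τ ∷ X) = recip β⁻ * quad (estimates X)

  increment-≤′ : ∀ x → Always (x ℕ.≤′_) (increment x)
  increment-≤′ x i = go (toℕ i ℕ.<ᵇ A ^ x)
    where
    go : ∀ b → x ℕ.≤′ (if b then suc x else x)
    go true  = ℕ.≤′-step ℕ.≤′-refl
    go false = ℕ.≤′-refl

  sketchStep-⊑ : ∀ s i → Always (Code._⊑_ sketchCode s) (sketchStep s i)
  sketchStep-⊑ (τ ∷ X) i = Always->>= (parallel (bucketStep (hashes τ)) X i)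
    (Always-sequence (λ b → bucketStep (hashes τ) b (lookup X b) i) grow)
    (λ X′ X⊑X′ → λ { zero → ℕ.≤′-refl ; (suc b) → X⊑X′ b })
    where
    grow : ∀ b → Always (lookup X b ℕ.≤′_) (bucketStep (hashes τ) b (lookup X b) i)
    grow b with hit (hashes τ) b i
    ... | true  = increment-≤′ (lookup X b)
    ... | false = ℕ.≤′-refl

  bucketSteps : Hash n → List (Fin n) → Rand (Vec ℕ B)
  bucketSteps f = steps (parallel (bucketStep f)) (replicate B 0)

  𝔼-final : List (Fin n) → (SketchState → ℚ) → ℚ
  𝔼-final σ φ = ⟦ 𝔼 sketchStart ⟧ λ s → ⟦ 𝔼 (steps sketchStep s σ) ⟧ φ

  -- The seed never changes, so the sketch can be analysed conditionally on it, where the hash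
  -- function is fixed and the counters are independent.
  𝔼-sketch : ∀ σ φ → 𝔼-final σ φ
    ≡ ⟦ 𝔼 drawSeed ⟧ λ τ → ⟦ 𝔼 (bucketSteps (hashes (toℕ τ)) σ) ⟧ λ X → φ (toℕ τ ∷ X)
  𝔼-sketch σ φ = trans (𝔼->>= drawSeed (λ τ → return (toℕ τ ∷ replicate B 0)) (λ s → ⟦ 𝔼 (steps sketchStep s σ) ⟧ φ))
    (cong-⟦⟧ (𝔼 drawSeed) λ τ → go (toℕ τ) (replicate B 0) σ)
    where
    go : ∀ τ X σ → ⟦ 𝔼 (steps sketchStep (τ ∷ X) σ) ⟧ φ ≡ ⟦ 𝔼 (steps (parallel (bucketStep (hashes τ))) X σ) ⟧ λ X′ → φ (τ ∷ X′)
    go τ X []      = refl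
    go τ X (i ∷ σ) = begin
      ⟦ 𝔼 (steps sketchStep (τ ∷ X) (i ∷ σ)) ⟧ φ
        ≡⟨ 𝔼->>= (sketchStep (τ ∷ X) i) (λ s → steps sketchStep s σ) φ ⟩
      (⟦ 𝔼 (sketchStep (τ ∷ X) i) ⟧ λ s → ⟦ 𝔼 (steps sketchStep s σ) ⟧ φ)
        ≡⟨ 𝔼->>= (parallel (bucketStep (hashes τ)) X i) (λ X′ → return (τ ∷ X′)) (λ s → ⟦ 𝔼 (steps sketchStep s σ) ⟧ φ) ⟩
      (⟦ 𝔼 (parallel (bucketStep (hashes τ)) X i) ⟧ λ X′ → ⟦ 𝔼 (steps sketchStep (τ ∷ X′) σ) ⟧ φ)
        ≡⟨ cong-⟦⟧ (𝔼 (parallel (bucketStep (hashes τ)) X i)) (λ X′ → go τ X′ σ) ⟩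
      (⟦ 𝔼 (parallel (bucketStep (hashes τ)) X i) ⟧ λ X′ → ⟦ 𝔼 (steps (parallel (bucketStep (hashes τ))) X′ σ) ⟧ λ X″ → φ (τ ∷ X″))
        ≡⟨ 𝔼->>= (parallel (bucketStep (hashes τ)) X i) (λ X′ → steps (parallel (bucketStep (hashes τ))) X′ σ) (λ X″ → φ (τ ∷ X″)) ⟨
      ⟦ 𝔼 (steps (parallel (bucketStep (hashes τ))) X (i ∷ σ)) ⟧ (λ X″ → φ (τ ∷ X″)) ∎
      where open ≡-Reasoning

  error² : Hash n → List (Fin n) → Vec ℕ B → ℚ
  error² f σ X = ⟦ ∑ B ⟧ λ b → (estimates X b - load f x[ σ ] b) * (estimates X b - load f x[ σ ] b)

  count-load : ∀ f σ b → ι (count (hit f b) σ) ≡ load f x[ σ ] b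
  count-load f σ b = count-∑ (hit f b) σ

  -- A bucket that receives c arrivals has mean squared error at most α c². One factor c is replaced
  -- by the length m of the stream, and the remaining factors sum to m.
  𝔼-error²≤ : ∀ f σ → ⟦ 𝔼 (bucketSteps f σ) ⟧ (error² f σ) ≤ α * (ι (length σ) * ι (length σ))
  𝔼-error²≤ f σ = begin
    ⟦ 𝔼 (bucketSteps f σ) ⟧ (error² f σ)
      ≡⟨ 𝔼-comm (∑ B) (bucketSteps f σ) (λ b X → sqErr b (lookup X b)) ⟨
    (⟦ ∑ B ⟧ λ b → ⟦ 𝔼 (bucketSteps f σ) ⟧ λ X → sqErr b (lookup X b))
      ≡⟨ cong-⟦⟧ (∑ B) (λ b → trans (𝔼-parallel-lookup (bucketStep f) b (sqErr b) (replicate B 0) σ)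
           (cong (λ x → ⟦ 𝔼 (steps (bucketStep f b) x σ) ⟧ (sqErr b)) (Vec.lookup-replicate b 0))) ⟩
    (⟦ ∑ B ⟧ λ b → ⟦ 𝔼 (steps (bucketStep f b) 0 σ) ⟧ (sqErr b))
      ≤⟨ ∑ B .mono (λ b → ℚ.≤-trans (𝔼-error² (hit f b) (load f x[ σ ] b) 0 σ) (bucket≤ b)) ⟩
    (⟦ ∑ B ⟧ λ b → α * m * load f x[ σ ] b)
      ≡⟨ ∑-* (α * m) (load f x[ σ ]) ⟩
    α * m * ⟦ ∑ B ⟧ (load f x[ σ ])
      ≡⟨ cong (α * m *_) (trans (∑-load f x[ σ ]) (∑-x σ)) ⟩
    α * m * m
      ≡⟨ ℚ.*-assoc α m m ⟩
    α * (m * m) ∎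
    where
    open ℚ.≤-Reasoning
    m : ℚ
    m = ι (length σ)
    sqErr : Fin B → ℕ → ℚ
    sqErr b X = (estimate X - load f x[ σ ] b) * (estimate X - load f x[ σ ] b)
    simplify : ∀ a c α → (a * (1ℚ - 1ℚ) + c - c) * (a * (1ℚ - 1ℚ) + c - c) + α * (c * (a * (1ℚ - 1ℚ)) + c * c) ≡ α * (c * c)
    simplify = solve-∀ ring
    bucket≤ : ∀ b → let c = ι (count (hit f b) σ) in
      (estimate 0 + c - load f x[ σ ] b) * (estimate 0 + c - load f x[ σ ] b) + α * (c * estimate 0 + c * c) ≤ α * m * load f x[ σ ] b
    bucket≤ b = begin
      (estimate 0 + c - load f x[ σ ] b) * (estimate 0 + c - load f x[ σ ] b) + α * (c * estimate 0 + c * c)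
        ≡⟨ cong (λ l → (estimate 0 + c - l) * (estimate 0 + c - l) + α * (c * estimate 0 + c * c)) (count-load f σ b) ⟨
      (estimate 0 + c - c) * (estimate 0 + c - c) + α * (c * estimate 0 + c * c)
        ≡⟨ simplify (ι A) c α ⟩
      α * (c * c)
        ≤⟨ *-monoˡ 0≤α (*-monoʳ (0≤ι (count (hit f b) σ)) (ι-mono (count≤length (hit f b) σ))) ⟩
      α * (m * c)
        ≡⟨ ℚ.*-assoc α m c ⟨
      α * m * c
        ≡⟨ cong (α * m *_) (count-load f σ b) ⟩
      α * m * load f x[ σ ] b ∎
      where
      c : ℚ
      c = ι (count (hit f b) σ)

  -- The seed contributes at most `t`, and given the seed the mean of the product over the counters
  -- is the product of the bounds in `𝔼-counter`.
  𝔼-weight≤ : ∀ ℓ σ → length σ ℕ.≤ 2 ^ ℓ →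
    𝔼-final σ (λ s → ι (Code.weight sketchCode s)) ≤ ι (t ℕ.* (A ℕ.* (ℓ ℕ.+ 3)) ^ B)
  𝔼-weight≤ ℓ σ m≤2^ℓ = begin
    𝔼-final σ (λ s → ι (Code.weight sketchCode s))
      ≡⟨ 𝔼-sketch σ (λ s′ → ι (Code.weight sketchCode s′)) ⟩
    (⟦ 𝔼 drawSeed ⟧ λ τ → ⟦ 𝔼 (bucketSteps (hashes (toℕ τ)) σ) ⟧ λ X → ι (suc (toℕ τ) ℕ.* weights natCode X))
      ≤⟨ 𝔼 drawSeed .mono perSeed ⟩
    ⟦ 𝔼 drawSeed ⟧ (λ _ → ι (t ℕ.* W ^ B))
      ≡⟨ 𝔼-const drawSeed (ι (t ℕ.* W ^ B)) ⟩
    ι (t ℕ.* W ^ B) ∎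
    where
    open ℚ.≤-Reasoning
    W : ℕ
    W = A ℕ.* (ℓ ℕ.+ 3)
    suc-toℕ≤ : ∀ τ → suc (toℕ {suc t⁻} τ) ℕ.≤ t
    suc-toℕ≤ τ = subst (suc (toℕ τ) ℕ.≤_) suc-t⁻ (Fin.toℕ<n τ)
    perSeed : ∀ τ → ⟦ 𝔼 (bucketSteps (hashes (toℕ τ)) σ) ⟧ (λ X → ι (suc (toℕ τ) ℕ.* weights natCode X)) ≤ ι (t ℕ.* W ^ B)
    perSeed τ = begin
      ⟦ 𝔼 (bucketSteps f σ) ⟧ (λ X → ι (suc (toℕ τ) ℕ.* weights natCode X))
        ≡⟨ cong-⟦⟧ (𝔼 (bucketSteps f σ)) (λ X → trans (ι-* (suc (toℕ τ)) (weights natCode X)) (cong (ι (suc (toℕ τ)) *_) (ι-weights natCode X))) ⟩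
      ⟦ 𝔼 (bucketSteps f σ) ⟧ (λ X → ι (suc (toℕ τ)) * ∏ λ b → ι (suc (lookup X b)))
        ≡⟨ 𝔼 (bucketSteps f σ) .*-homo (ι (suc (toℕ τ))) (λ X → ∏ λ b → ι (suc (lookup X b))) ⟩
      ι (suc (toℕ τ)) * ⟦ 𝔼 (bucketSteps f σ) ⟧ (λ X → ∏ λ b → ι (suc (lookup X b)))
        ≡⟨ cong (ι (suc (toℕ τ)) *_) (𝔼-parallel-∏ (bucketStep f) (λ _ x → ι (suc x)) (replicate B 0) σ) ⟩
      ι (suc (toℕ τ)) * ∏ (λ b → ⟦ 𝔼 (steps (bucketStep f b) (lookup (replicate B 0) b) σ) ⟧ λ x → ι (suc x))
        ≤⟨ *-mono (0≤ι (suc (toℕ τ))) (0≤∏ {B} {λ _ → ι W} λ _ → 0≤ι W) (ι-mono (suc-toℕ≤ τ)) (∏-mono nonneg-bucket bucket≤) ⟩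
      ι t * ∏ {B} (λ _ → ι W)
        ≡⟨ cong (ι t *_) (∏-const B W) ⟩
      ι t * ι (W ^ B)
        ≡⟨ ι-* t (W ^ B) ⟨
      ι (t ℕ.* W ^ B) ∎
      where
      f : Hash n
      f = hashes (toℕ τ)
      nonneg-bucket : ∀ b → 0ℚ ≤ ⟦ 𝔼 (steps (bucketStep f b) (lookup (replicate B 0) b) σ) ⟧ λ x → ι (suc x)
      nonneg-bucket b = nonneg (𝔼 (steps (bucketStep f b) (lookup (replicate B 0) b) σ)) λ x → 0≤ι (suc x)
      bucket≤ : ∀ b → ⟦ 𝔼 (steps (bucketStep f b) (lookup (replicate B 0) b) σ) ⟧ (λ x → ι (suc x)) ≤ ι W
      bucket≤ b = subst (λ x → ⟦ 𝔼 (steps (bucketStep f b) x σ) ⟧ (λ x → ι (suc x)) ≤ ι W) (sym (Vec.lookup-replicate b 0))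
        (𝔼-counter (hit f b) ℓ σ (ℕ.≤-trans (count≤length (hit f b) σ) m≤2^ℓ))

  module Analysis (E k : ℕ) .{{_ : ℕ.NonZero E}} .{{_ : ℕ.NonZero k}}
                  (β≡ : β ≡ 1440 ℕ.* (E ℕ.* E)) (A≡ : A ≡ 1200 ℕ.* (k ℕ.* (E ℕ.* E)))
                  (σ : List (Fin n)) (sparse : ‖ frequency σ ‖₀ ℕ.≤ k) (0<F₂ : 0 ℕ.< ‖ frequency σ ‖₂²) where

    -- `s` is 1/E and `z` is 1/F. The factors u = 1 / (6 β F²) and v = 600 E² / F scale the hashing
    -- error and the counting error to means of at most ½.
    e s F z u v : ℚ
    e = ι E
    s = recip (pred E)
    F = F₂ x[ σ ]
    z = recip (pred ‖ frequency σ ‖₂²)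
    u = z * z * recip (pred (6 ℕ.* β))
    v = #ℚ 600 * (e * e) * z

    es≡1 : e * s ≡ 1ℚ
    es≡1 = trans (ℚ.*-comm e s) (recip-pred E)

    zF≡1 : z * F ≡ 1ℚ
    zF≡1 = trans (cong (z *_) (sym (ι-‖‖₂² σ))) (recip-pred ‖ frequency σ ‖₂² {{ℕ.>-nonZero 0<F₂}})

    0<F : 0ℚ < F
    0<F = subst (0ℚ <_) (ι-‖‖₂² σ) (0<ι ‖ frequency σ ‖₂² {{ℕ.>-nonZero 0<F₂}})

    ι-#ℚ : ∀ a b → ι (a ℕ.* b) ≡ #ℚ a * ι b
    ι-#ℚ a b = trans (ι-* a b) (cong (_* ι b) (ι-fromℕ a))

    ιβ≡ : ι β ≡ #ℚ 1440 * (e * e)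
    ιβ≡ = trans (cong ι β≡) (trans (ι-#ℚ 1440 (E ℕ.* E)) (cong (#ℚ 1440 *_) (ι-* E E)))

    ιA≡ : ι A ≡ #ℚ 1200 * (ι k * (e * e))
    ιA≡ = trans (cong ι A≡) (trans (ι-#ℚ 1200 (k ℕ.* (E ℕ.* E)))
      (cong (#ℚ 1200 *_) (trans (ι-* k (E ℕ.* E)) (cong (ι k *_) (ι-* E E)))))

    6βuFF≡1 : #ℚ 6 * ι β * u * (F * F) ≡ 1ℚ
    6βuFF≡1 = begin
      #ℚ 6 * ι β * (z * z * ρ) * (F * F)     ≡⟨ regroup (ι β) z ρ F ⟩
      ρ * (#ℚ 6 * ι β) * ((z * F) * (z * F)) ≡⟨ cong₂ (λ a b → ρ * a * (b * b)) (sym (ι-#ℚ 6 β)) zF≡1 ⟩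
      ρ * ι (6 ℕ.* β) * (1ℚ * 1ℚ)            ≡⟨ cong (_* (1ℚ * 1ℚ)) (recip-* (pred (6 ℕ.* β))) ⟩
      1ℚ * (1ℚ * 1ℚ)                         ≡⟨ refl ⟩
      1ℚ                                     ∎
      where
      open ≡-Reasoning
      ρ : ℚ
      ρ = recip (pred (6 ℕ.* β))
      regroup : ∀ b z r F → #ℚ 6 * b * (z * z * r) * (F * F) ≡ r * (#ℚ 6 * b) * ((z * F) * (z * F))
      regroup = solve-∀ ring

    2vαkF≡1 : #ℚ 2 * (v * (α * (ι k * F))) ≡ 1ℚ
    2vαkF≡1 = begin
      #ℚ 2 * (#ℚ 600 * (e * e) * z * (α * (ι k * F))) ≡⟨ regroup e z α (ι k) F ⟩
      α * (#ℚ 1200 * (ι k * (e * e))) * (z * F)       ≡⟨ cong₂ (λ a b → α * a * b) (sym ιA≡) zF≡1 ⟩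
      α * ι A * 1ℚ                                    ≡⟨ cong (_* 1ℚ) (recip-* A⁻) ⟩
      1ℚ * 1ℚ                                         ≡⟨ refl ⟩
      1ℚ                                              ∎
      where
      open ≡-Reasoning
      regroup : ∀ e z α k F → #ℚ 2 * (#ℚ 600 * (e * e) * z * (α * (k * F))) ≡ α * (#ℚ 1200 * (k * (e * e))) * (z * F)
      regroup = solve-∀ ring

    0≤e : 0ℚ ≤ e
    0≤e = 0≤ι E

    0≤s : 0ℚ ≤ s
    0≤s = 0≤recip (pred E)

    0≤z : 0ℚ ≤ z
    0≤z = 0≤recip (pred ‖ frequency σ ‖₂²)

    0≤u : 0ℚ ≤ u
    0≤u = 0≤* (0≤* 0≤z 0≤z) (0≤recip (pred (6 ℕ.* β)))

    0≤v : 0ℚ ≤ v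
    0≤v = 0≤* (0≤* (0≤#ℚ 600) (0≤* 0≤e 0≤e)) 0≤z

    -- Each of the two error terms has mean at most ½, and is at least 15 as soon as it is too
    -- large for an accuracy of 1/E; this is what the constants 1440 and 1200 are for.
    penalty : SketchState → ℚ
    penalty (τ ∷ X) = 1ℚ + (u * (excess (hashes τ) x[ σ ] * excess (hashes τ) x[ σ ]) + v * error² (hashes τ) σ X)

    1≤penalty : ∀ s → 1ℚ ≤ penalty s
    1≤penalty (τ ∷ X) = ≤-via (drop (u * (excess (hashes τ) x[ σ ] * excess (hashes τ) x[ σ ]) + v * error² (hashes τ) σ X))
      (0≤+ (0≤* 0≤u (0≤p² (excess (hashes τ) x[ σ ]))) (0≤* 0≤v (nonneg (∑ B) λ b → 0≤p² (estimates X b - load (hashes τ) x[ σ ] b))))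
      where
      drop : ∀ p → 1ℚ + p - 1ℚ ≡ p
      drop = solve-∀ ring

    𝔼-penalty≤ : 𝔼-final σ penalty ≤ #ℚ 2
    𝔼-penalty≤ = begin
      𝔼-final σ penalty
        ≡⟨ 𝔼-sketch σ penalty ⟩
      (⟦ 𝔼 drawSeed ⟧ λ τ → ⟦ 𝔼 (bucketSteps (hashes (toℕ τ)) σ) ⟧ λ X → 1ℚ + (u * Z² τ + v * error² (hashes (toℕ τ)) σ X))
        ≤⟨ 𝔼 drawSeed .mono perSeed ⟩
      ⟦ 𝔼 drawSeed ⟧ (λ τ → 1ℚ + v * (α * (ι k * F)) + (u * Z² τ + 0ℚ))
        ≡⟨ 𝔼-affine drawSeed (1ℚ + v * (α * (ι k * F))) u Z² (λ _ → 0ℚ) ⟩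
      1ℚ + v * (α * (ι k * F)) + (u * ⟦ 𝔼 drawSeed ⟧ Z² + ⟦ 𝔼 drawSeed ⟧ (λ _ → 0ℚ))
        ≤⟨ ℚ.+-monoʳ-≤ (1ℚ + v * (α * (ι k * F))) (ℚ.+-mono-≤ (*-monoˡ 0≤u (𝔼-seed-excess² x[ σ ] 0<F)) (ℚ.≤-reflexive (𝔼-const drawSeed 0ℚ))) ⟩
      1ℚ + v * (α * (ι k * F)) + (u * (3ℚ * ι β * (F * F)) + 0ℚ)
        ≡⟨ halves (v * (α * (ι k * F))) u (ι β) F ⟩
      1ℚ + ½ * (#ℚ 2 * (v * (α * (ι k * F)))) + ½ * (#ℚ 6 * ι β * u * (F * F))
        ≡⟨ cong₂ (λ a b → 1ℚ + ½ * a + ½ * b) 2vαkF≡1 6βuFF≡1 ⟩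
      1ℚ + ½ * 1ℚ + ½ * 1ℚ
        ≡⟨ refl ⟩
      #ℚ 2 ∎
      where
      open ℚ.≤-Reasoning
      Z² : Fin (suc t⁻) → ℚ
      Z² τ = excess (hashes (toℕ τ)) x[ σ ] * excess (hashes (toℕ τ)) x[ σ ]
      halves : ∀ p u β F → 1ℚ + p + (u * (3ℚ * β * (F * F)) + 0ℚ) ≡ 1ℚ + ½ * (#ℚ 2 * p) + ½ * (#ℚ 6 * β * u * (F * F))
      halves = solve-∀ ring
      arrange : ∀ a b c → 1ℚ + (a + b * c) ≡ 1ℚ + a + (b * c + 0ℚ)
      arrange = solve-∀ ring
      arrange′ : ∀ a b → 1ℚ + a + (b + 0ℚ) ≡ 1ℚ + b + (a + 0ℚ)
      arrange′ = solve-∀ ring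
      perSeed : ∀ τ → ⟦ 𝔼 (bucketSteps (hashes (toℕ τ)) σ) ⟧ (λ X → 1ℚ + (u * Z² τ + v * error² (hashes (toℕ τ)) σ X))
        ≤ 1ℚ + v * (α * (ι k * F)) + (u * Z² τ + 0ℚ)
      perSeed τ = begin
        ⟦ 𝔼 r ⟧ (λ X → 1ℚ + (u * Z² τ + v * error² f σ X))
          ≡⟨ cong-⟦⟧ (𝔼 r) (λ X → arrange (u * Z² τ) v (error² f σ X)) ⟩
        ⟦ 𝔼 r ⟧ (λ X → 1ℚ + u * Z² τ + (v * error² f σ X + 0ℚ))
          ≡⟨ 𝔼-affine r (1ℚ + u * Z² τ) v (error² f σ) (λ _ → 0ℚ) ⟩
        1ℚ + u * Z² τ + (v * ⟦ 𝔼 r ⟧ (error² f σ) + ⟦ 𝔼 r ⟧ (λ _ → 0ℚ))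
          ≤⟨ ℚ.+-monoʳ-≤ (1ℚ + u * Z² τ) (ℚ.+-mono-≤ (*-monoˡ 0≤v
               (ℚ.≤-trans (𝔼-error²≤ f σ) (*-monoˡ 0≤α (length²≤k*F₂ k σ sparse)))) (ℚ.≤-reflexive (𝔼-const r 0ℚ))) ⟩
        1ℚ + u * Z² τ + (v * (α * (ι k * F)) + 0ℚ)
          ≡⟨ arrange′ (u * Z² τ) (v * (α * (ι k * F))) ⟩
        1ℚ + v * (α * (ι k * F)) + (u * Z² τ + 0ℚ) ∎
        where
        f : Hash n
        f = hashes (toℕ τ)
        r : Rand (Vec ℕ B)
        r = bucketSteps f σ

    private
      G : ℚ
      G = ι β * F

      0≤G : 0ℚ ≤ G
      0≤G = 0≤* (0≤ι β) (ℚ.<⇒≤ 0<F)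

      s≤1 : s ≤ 1ℚ
      s≤1 = begin
        s      ≡⟨ ℚ.*-identityˡ s ⟨
        1ℚ * s ≤⟨ *-monoʳ 0≤s (1≤ι E) ⟩
        e * s  ≡⟨ es≡1 ⟩
        1ℚ     ∎
        where open ℚ.≤-Reasoning

      4Z≤sG : ∀ Z → #ℚ 16 * (e * e) * (Z * Z) ≤ G * G → #ℚ 4 * Z ≤ s * G
      4Z≤sG Z small = p²≤q²⇒p≤q (0≤* 0≤s 0≤G) (begin
        #ℚ 4 * Z * (#ℚ 4 * Z)               ≡⟨ shape Z ⟩
        1ℚ * 1ℚ * (#ℚ 16 * (Z * Z))         ≡⟨ cong (λ o → o * o * (#ℚ 16 * (Z * Z))) es≡1 ⟨
        e * s * (e * s) * (#ℚ 16 * (Z * Z)) ≡⟨ regroup e s Z ⟩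
        s * s * (#ℚ 16 * (e * e) * (Z * Z)) ≤⟨ *-monoˡ (0≤p² s) small ⟩
        s * s * (G * G)                     ≡⟨ interchange s G ⟩
        s * G * (s * G)                     ∎)
        where
        open ℚ.≤-Reasoning
        shape : ∀ Z → #ℚ 4 * Z * (#ℚ 4 * Z) ≡ 1ℚ * 1ℚ * (#ℚ 16 * (Z * Z))
        shape = solve-∀ ring
        regroup : ∀ e s Z → e * s * (e * s) * (#ℚ 16 * (Z * Z)) ≡ s * s * (#ℚ 16 * (e * e) * (Z * Z))
        regroup = solve-∀ ring
        interchange : ∀ s G → s * s * (G * G) ≡ s * G * (s * G)
        interchange = solve-∀ ring

    module _ (τ : ℕ) (X : Vec ℕ B)
             (Z²≤ : #ℚ 16 * (e * e) * (excess (hashes τ) x[ σ ] * excess (hashes τ) x[ σ ]) ≤ G * G)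
             (err≤ : #ℚ 40 * (e * e) * error² (hashes τ) σ X ≤ F) where

      private
        c d : Fin B → ℚ
        c = load (hashes τ) x[ σ ]
        d b = estimates X b - c b

        q H φ Z : ℚ
        q = quad c
        H = quad d
        φ = form c d
        Z = excess (hashes τ) x[ σ ]

        psd : ∀ μ → 0ℚ ≤ q + (2ℚ * μ * φ + μ * μ * H)
        psd μ = subst (0ℚ ≤_) (quad-affine c d μ) (0≤quad λ b → c b + μ * d b)

        output≡ : quad (estimates X) ≡ q + (2ℚ * φ + H)
        output≡ = trans (quad-cong λ b → shape (estimates X b) (c b)) (trans (quad-affine c d 1ℚ) (unit q φ H))
          where
          shape : ∀ x c → x ≡ c + 1ℚ * (x - c)
          shape = solve-∀ ring
          unit : ∀ q φ H → q + (2ℚ * 1ℚ * φ + 1ℚ * 1ℚ * H) ≡ q + (2ℚ * φ + H)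
          unit = solve-∀ ring

        -- The 40 of the hypothesis on the counting error is this 20 times the 2 of B ≤ 2 β.
        20H≤ : #ℚ 20 * H ≤ G * (s * s)
        20H≤ = begin
          #ℚ 20 * H                               ≤⟨ *-monoˡ (0≤#ℚ 20) (quad≤ d) ⟩
          #ℚ 20 * (ι B * err)                     ≤⟨ *-monoˡ (0≤#ℚ 20) (*-monoʳ 0≤err ιB≤) ⟩
          #ℚ 20 * ((ι β + ι β) * err)             ≡⟨ shape (ι β) err ⟩
          1ℚ * 1ℚ * (ι β * (#ℚ 40 * err))         ≡⟨ cong (λ o → o * o * (ι β * (#ℚ 40 * err))) es≡1 ⟨
          e * s * (e * s) * (ι β * (#ℚ 40 * err)) ≡⟨ regroup e s (ι β) err ⟩
          ι β * (s * s) * (#ℚ 40 * (e * e) * err) ≤⟨ *-monoˡ (0≤* (0≤ι β) (0≤p² s)) err≤ ⟩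
          ι β * (s * s) * F                       ≡⟨ commute (ι β) (s * s) F ⟩
          G * (s * s)                             ∎
          where
          open ℚ.≤-Reasoning
          err : ℚ
          err = error² (hashes τ) σ X
          0≤err : 0ℚ ≤ err
          0≤err = nonneg (∑ B) λ b → 0≤p² (d b)
          ιB≤ : ι B ≤ ι β + ι β
          ιB≤ = subst (_≤ ι β + ι β) (sym (ι-suc β)) (ℚ.+-monoˡ-≤ (ι β) (1≤ι β))
          shape : ∀ b r → #ℚ 20 * ((b + b) * r) ≡ 1ℚ * 1ℚ * (b * (#ℚ 40 * r))
          shape = solve-∀ ring
          regroup : ∀ e s b r → e * s * (e * s) * (b * (#ℚ 40 * r)) ≡ b * (s * s) * (#ℚ 40 * (e * e) * r)
          regroup = solve-∀ ring
          commute : ∀ b s F → b * s * F ≡ b * F * s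
          commute = solve-∀ ring

        scale : ∀ a → recip β⁻ * (a * G) ≡ a * F
        scale a = trans (regroup (recip β⁻) a (ι β) F) (trans (cong (_* (a * F)) (recip-* β⁻)) (ℚ.*-identityˡ (a * F)))
          where
          regroup : ∀ r a b F → r * (a * (b * F)) ≡ r * b * (a * F)
          regroup = solve-∀ ring

      output≤ : sketchOutput (τ ∷ X) ≤ (1ℚ + s) * F
      output≤ = subst (recip β⁻ * quad (estimates X) ≤_) (scale (1ℚ + s)) (*-monoˡ (0≤recip β⁻)
        (subst (_≤ (1ℚ + s) * G) (sym output≡)
          (accuracy-upper {e} {s} {G} {q} {H} {φ} es≡1 0≤e 0≤s s≤1 0≤G (0≤quad d) 20H≤ (psd (- (#ℚ 4 * e)))
            (≤-via (shape q G (s * G)) (p≤q⇒0≤q-p (4Z≤sG Z Z²≤))))))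
        where
        shape : ∀ q G r → #ℚ 4 * G + r - #ℚ 4 * q ≡ r - #ℚ 4 * (q - G)
        shape = solve-∀ ring

      ≤output : (1ℚ - s) * F ≤ sketchOutput (τ ∷ X)
      ≤output = subst (_≤ recip β⁻ * quad (estimates X)) (scale (1ℚ - s)) (*-monoˡ (0≤recip β⁻)
        (subst ((1ℚ - s) * G ≤_) (sym output≡)
          (accuracy-lower {e} {s} {G} {q} {H} {φ} es≡1 0≤e 0≤s s≤1 0≤G (0≤quad d) 20H≤ (psd (#ℚ 4 * e))
            (≤-via (shape q G (s * G)) (p≤q⇒0≤q-p (4Z≤sG (- Z) (subst (λ y → #ℚ 16 * (e * e) * y ≤ G * G) (neg² Z) Z²≤)))))))
        where
        shape : ∀ q G r → #ℚ 4 * q - (#ℚ 4 * G - r) ≡ r - #ℚ 4 * - (q - G)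
        shape = solve-∀ ring
        neg² : ∀ Z → Z * Z ≡ - Z * - Z
        neg² = solve-∀ ring

    -- Here u Z² ≥ u G² / (16 E²) = β / (96 E²), and 1440 / 96 = 15.
    15≤uZ² : ∀ {Z²} → G * G ≤ #ℚ 16 * (e * e) * Z² → #ℚ 15 ≤ u * Z²
    15≤uZ² {Z²} large = *-cancel-≤ {#ℚ 16 * (e * e)} {#ℚ 15} {u * Z²} 0<16ee (begin
      #ℚ 16 * (e * e) * #ℚ 15                   ≡⟨ 240ee (e * e) ⟩
      #ℚ 1440 * (e * e) * (+1/6 * 1ℚ)           ≡⟨ cong₂ (λ a b → a * (+1/6 * b)) (sym ιβ≡) (sym 6βuFF≡1) ⟩
      ι β * (+1/6 * (#ℚ 6 * ι β * u * (F * F))) ≡⟨ regroup (ι β) u F ⟩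
      u * (G * G)                               ≤⟨ *-monoˡ 0≤u large ⟩
      u * (#ℚ 16 * (e * e) * Z²)                ≡⟨ commute u (#ℚ 16 * (e * e)) Z² ⟩
      #ℚ 16 * (e * e) * (u * Z²)                ∎)
      where
      open ℚ.≤-Reasoning
      0<16ee : 0ℚ < #ℚ 16 * (e * e)
      0<16ee = subst (0ℚ <_) (trans (ι-#ℚ 16 (E ℕ.* E)) (cong (#ℚ 16 *_) (ι-* E E))) (0<ι (16 ℕ.* (E ℕ.* E)) {{ℕ.m*n≢0 16 (E ℕ.* E) {{_}} {{ℕ.m*n≢0 E E}}}})
      240ee : ∀ y → #ℚ 16 * y * #ℚ 15 ≡ #ℚ 1440 * y * (+1/6 * 1ℚ)
      240ee = solve-∀ ring
      regroup : ∀ b u F → b * (+1/6 * (#ℚ 6 * b * u * (F * F))) ≡ u * (b * F * (b * F))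
      regroup = solve-∀ ring
      commute : ∀ u a z → u * (a * z) ≡ a * (u * z)
      commute = solve-∀ ring

    -- The constant is 600 / 40, the numerator of `v` over the threshold for the error.
    15≤v*err : ∀ {err} → F ≤ #ℚ 40 * (e * e) * err → #ℚ 15 ≤ v * err
    15≤v*err {err} large = begin
      #ℚ 15                               ≡⟨ ℚ.*-identityʳ (#ℚ 15) ⟨
      #ℚ 15 * 1ℚ                          ≡⟨ cong (#ℚ 15 *_) zF≡1 ⟨
      #ℚ 15 * (z * F)                     ≡⟨ ℚ.*-assoc (#ℚ 15) z F ⟨
      #ℚ 15 * z * F                       ≤⟨ *-monoˡ (0≤* (0≤#ℚ 15) 0≤z) large ⟩
      #ℚ 15 * z * (#ℚ 40 * (e * e) * err) ≡⟨ regroup e z err ⟩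
      v * err                             ∎
      where
      open ℚ.≤-Reasoning
      regroup : ∀ e z r → #ℚ 15 * z * (#ℚ 40 * (e * e) * r) ≡ #ℚ 600 * (e * e) * z * r
      regroup = solve-∀ ring

    F≡fromℕ : F ≡ fromℕ ‖ frequency σ ‖₂²
    F≡fromℕ = trans (sym (ι-‖‖₂² σ)) (ι-fromℕ ‖ frequency σ ‖₂²)

    relax : ∀ {ε V} → s ≤ ε → (1ℚ - s) * F ≤ V → V ≤ (1ℚ + s) * F → V isA1± ε ApproxOf fromℕ ‖ frequency σ ‖₂²
    relax {ε} {V} s≤ε lower upper =
      subst (λ f → V isA1± ε ApproxOf f) F≡fromℕ
        ( ℚ.≤-trans (*-monoʳ (ℚ.<⇒≤ 0<F) (ℚ.+-monoʳ-≤ 1ℚ (ℚ.neg-antimono-≤ s≤ε))) lower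
        , ℚ.≤-trans upper (*-monoʳ (ℚ.<⇒≤ 0<F) (ℚ.+-monoʳ-≤ 1ℚ s≤ε)))

    1+15≤ : ∀ {p} → #ℚ 15 ≤ p → ι 16 ≤ 1ℚ + p
    1+15≤ {p} 15≤p = subst (_≤ 1ℚ + p) (sym (ι-fromℕ 16)) (ℚ.+-monoʳ-≤ 1ℚ 15≤p)

    inaccurate⇒16≤penalty : ∀ {ε} → s ≤ ε → ∀ S →
      ¬ (sketchOutput S isA1± ε ApproxOf fromℕ ‖ frequency σ ‖₂²) → ι 16 ≤ penalty S
    inaccurate⇒16≤penalty {ε} s≤ε (τ ∷ X) inaccurate =
      decide (#ℚ 16 * (e * e) * Z² ℚ.≤? G * G) (#ℚ 40 * (e * e) * err ℚ.≤? F)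
      where
      Z² err : ℚ
      Z² = excess (hashes τ) x[ σ ] * excess (hashes τ) x[ σ ]
      err = error² (hashes τ) σ X
      0≤err : 0ℚ ≤ err
      0≤err = nonneg (∑ B) λ b → 0≤p² (estimates X b - load (hashes τ) x[ σ ] b)
      0≤Z² : 0ℚ ≤ Z²
      0≤Z² = 0≤p² (excess (hashes τ) x[ σ ])
      decide : Dec (#ℚ 16 * (e * e) * Z² ≤ G * G) → Dec (#ℚ 40 * (e * e) * err ≤ F) → ι 16 ≤ 1ℚ + (u * Z² + v * err)
      decide (yes Z²≤) (yes err≤) = contradiction (relax {V = sketchOutput (τ ∷ X)} s≤ε (≤output τ X Z²≤ err≤) (output≤ τ X Z²≤ err≤)) inaccurate
      decide (no Z²≰) _ = 1+15≤ (subst (_≤ u * Z² + v * err) (ℚ.+-identityʳ (#ℚ 15))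
        (ℚ.+-mono-≤ (15≤uZ² (ℚ.<⇒≤ (ℚ.≰⇒> Z²≰))) (0≤* 0≤v 0≤err)))
      decide (yes _) (no err≰) = 1+15≤ (subst (_≤ u * Z² + v * err) (ℚ.+-identityˡ (#ℚ 15))
        (ℚ.+-mono-≤ (0≤* 0≤u 0≤Z²) (15≤v*err (ℚ.<⇒≤ (ℚ.≰⇒> err≰)))))

-- Logarithms and ceilings

⌈log₂⌉-positive : ∀ {n} → 2 ℕ.≤ n → 1 ℕ.≤ ⌈log₂ n ⌉
⌈log₂⌉-positive {n} 2≤n = subst (ℕ._≤ ⌈log₂ n ⌉) (⌈log₂2^n⌉≡n 1) (⌈log₂⌉-mono-≤ 2≤n)

n≤2^⌈log₂n⌉ : ∀ n → n ℕ.≤ 2 ^ ⌈log₂ n ⌉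
n≤2^⌈log₂n⌉ = <-rec (λ n → n ℕ.≤ 2 ^ ⌈log₂ n ⌉) λ where
    0 _ → z≤n
    1 _ → ℕ.m^n>0 2 ⌈log₂ 1 ⌉
    n@(suc (suc n′)) rec → begin
      n                               ≤⟨ n≤2*⌈n/2⌉ n ⟩
      2 ℕ.* ℕ.⌈ n /2⌉                 ≤⟨ ℕ.*-monoʳ-≤ 2 (rec (ℕ.⌈n/2⌉<n n′)) ⟩
      2 ℕ.* 2 ^ ⌈log₂ ℕ.⌈ n /2⌉ ⌉   ≡⟨ cong (λ e → 2 ℕ.* 2 ^ e) (⌈log₂⌈n/2⌉⌉≡⌈log₂n⌉∸1 n) ⟩
      2 ^ (1 ℕ.+ (⌈log₂ n ⌉ ℕ.∸ 1)) ≡⟨ cong (2 ℕ.^_) (ℕ.m+[n∸m]≡n (⌈log₂⌉-positive {n} (s≤s (s≤s z≤n)))) ⟩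
      2 ^ ⌈log₂ n ⌉                 ∎
  where
  open ℕ.≤-Reasoning
  n≤2*⌈n/2⌉ : ∀ n → n ℕ.≤ 2 ℕ.* ℕ.⌈ n /2⌉
  n≤2*⌈n/2⌉ n = begin
    n                       ≡⟨ ℕ.⌊n/2⌋+⌈n/2⌉≡n n ⟨
    ℕ.⌊ n /2⌋ ℕ.+ ℕ.⌈ n /2⌉ ≤⟨ ℕ.+-monoˡ-≤ ℕ.⌈ n /2⌉ (ℕ.⌊n/2⌋≤⌈n/2⌉ n) ⟩
    ℕ.⌈ n /2⌉ ℕ.+ ℕ.⌈ n /2⌉ ≡⟨ cong (ℕ.⌈ n /2⌉ ℕ.+_) (ℕ.+-identityʳ ℕ.⌈ n /2⌉) ⟨
    2 ℕ.* ℕ.⌈ n /2⌉         ∎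

module _ (p : ℚ) (0≤p : 0ℚ ≤ p) where

  private
    N D f : ℤ
    N = ↥ p
    D = ↧ p
    f = floor (- p)

    0≤N : ℤ.0ℤ ℤ.≤ N
    0≤N = subst₂ ℤ._≤_ (ℤ.*-zeroˡ D) (ℤ.*-identityʳ N) (ℚ.drop-*≤* 0≤p)

    floor-neg : ∀ q → floor (- q) ≡ (ℤ.- ↥ q) ℤ./ ↧ q
    floor-neg (mkℚ ℤ.-[1+ n ]   d _) = refl
    floor-neg (mkℚ (ℤ.+ zero)   d _) = refl
    floor-neg (mkℚ (ℤ.+ suc n)  d _) = refl

    ceiling≡ : ∀ q → ceiling q ≡ ℤ.- floor (- q)
    ceiling≡ (mkℚ _ _ _) = refl

    fD≤-N : f ℤ.* D ℤ.≤ ℤ.- N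
    fD≤-N = subst (λ g → g ℤ.* D ℤ.≤ ℤ.- N) (sym (floor-neg p)) (ℤ.[n/d]*d≤n (ℤ.- N) D)

    -N<sfD : ℤ.- N ℤ.< ℤ.suc f ℤ.* D
    -N<sfD = subst (λ g → ℤ.- N ℤ.< ℤ.suc g ℤ.* D)
      (trans (sym (ℤ.div-pos-is-/ℕ (ℤ.- N) (↧ₙ p))) (sym (floor-neg p))) (ℤ.n<s[n/ℕd]*d (ℤ.- N) (↧ₙ p))

    c : ℤ
    c = ceiling p

    f≤0 : f ℤ.≤ ℤ.0ℤ
    f≤0 = ℤ.*-cancelʳ-≤-pos f ℤ.0ℤ D (ℤ.≤-trans fD≤-N (subst (ℤ.- N ℤ.≤_) (sym (ℤ.*-zeroˡ D)) (ℤ.neg-mono-≤ 0≤N)))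

    +∣c∣≡-f : ℤ.+ ℤ.∣ c ∣ ≡ ℤ.- f
    +∣c∣≡-f = trans (cong (λ g → ℤ.+ ℤ.∣ g ∣) (ceiling≡ p)) (ℤ.0≤i⇒+∣i∣≡i (ℤ.neg-mono-≤ f≤0))

    ι∣c∣ : toℚᵘ (ι ℤ.∣ c ∣) ℚᵘ.≃ ℚᵘ.mkℚᵘ (ℤ.- f) 0
    ι∣c∣ = ℚᵘ.≃-trans (fromℕᵘ ℤ.∣ c ∣) (ℚᵘ.≃-reflexive (cong (λ g → ℚᵘ.mkℚᵘ g 0) +∣c∣≡-f))

  p≤⌈p⌉ : p ≤ ι ℤ.∣ ceiling p ∣
  p≤⌈p⌉ = ℚ.toℚᵘ-cancel-≤ (begin
    toℚᵘ p                   ≤⟨ ℚᵘ.*≤* (subst₂ (λ n d → n ℤ.* ℤ.1ℤ ℤ.≤ (ℤ.- f) ℤ.* d) (sym (ℚ.↥ᵘ-toℚᵘ p)) (sym (ℚ.↧ᵘ-toℚᵘ p)) N≤) ⟩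
    ℚᵘ.mkℚᵘ (ℤ.- f) 0        ≃⟨ ι∣c∣ ⟨
    toℚᵘ (ι ℤ.∣ ceiling p ∣) ∎)
    where
    open ℚᵘ.≤-Reasoning
    N≤ : N ℤ.* ℤ.1ℤ ℤ.≤ (ℤ.- f) ℤ.* D
    N≤ = subst₂ ℤ._≤_ (trans (ℤ.neg-involutive N) (sym (ℤ.*-identityʳ N))) (ℤ.neg-distribˡ-* f D) (ℤ.neg-mono-≤ fD≤-N)

  ⌈p⌉≤p+1 : ι ℤ.∣ ceiling p ∣ ≤ p + 1ℚ
  ⌈p⌉≤p+1 = ℚ.toℚᵘ-cancel-≤ (begin
    toℚᵘ (ι ℤ.∣ ceiling p ∣) ≃⟨ ι∣c∣ ⟩
    ℚᵘ.mkℚᵘ (ℤ.- f) 0        ≤⟨ ℚᵘ.*≤* bound ⟩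
    toℚᵘ p ℚᵘ.+ toℚᵘ 1ℚ      ≃⟨ ℚ.toℚᵘ-homo-+ p 1ℚ ⟨
    toℚᵘ (p + 1ℚ)            ∎)
    where
    open ℚᵘ.≤-Reasoning
    drop : ∀ f D N → (ℤ.1ℤ ℤ.+ f) ℤ.* D ℤ.- (ℤ.- N) ≡ (N ℤ.* ℤ.1ℤ ℤ.+ ℤ.1ℤ ℤ.* D) ℤ.* ℤ.1ℤ ℤ.- (ℤ.- f) ℤ.* D
    drop = ℤ-Solver.solve-∀
    bound′ : (ℤ.- f) ℤ.* D ℤ.≤ (N ℤ.* ℤ.1ℤ ℤ.+ ℤ.1ℤ ℤ.* D) ℤ.* ℤ.1ℤ
    bound′ = ℤ.0≤i-j⇒j≤i (subst (ℤ.0ℤ ℤ.≤_) (drop f D N) (ℤ.i≤j⇒0≤j-i (ℤ.<⇒≤ -N<sfD)))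
    bound : (ℤ.- f) ℤ.* ℚᵘ.↧ (toℚᵘ p ℚᵘ.+ toℚᵘ 1ℚ) ℤ.≤ ℚᵘ.↥ (toℚᵘ p ℚᵘ.+ toℚᵘ 1ℚ) ℤ.* ℤ.1ℤ
    bound = subst (λ d → (ℤ.- f) ℤ.* d ℤ.≤ ℚᵘ.↥ (toℚᵘ p ℚᵘ.+ toℚᵘ 1ℚ) ℤ.* ℤ.1ℤ) (sym (↧≡ p)) (subst (λ n → (ℤ.- f) ℤ.* D ℤ.≤ n ℤ.* ℤ.1ℤ) (sym (↥≡ p)) bound′)
      where
      ↥≡ : ∀ q → ℚᵘ.↥ (toℚᵘ q ℚᵘ.+ toℚᵘ 1ℚ) ≡ ↥ q ℤ.* ℤ.1ℤ ℤ.+ ℤ.1ℤ ℤ.* ↧ q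
      ↥≡ (mkℚ _ _ _) = refl
      ↧≡ : ∀ q → ℚᵘ.↧ (toℚᵘ q ℚᵘ.+ toℚᵘ 1ℚ) ≡ ↧ q
      ↧≡ (mkℚ n d _) = cong (λ d → ℤ.+ suc d) (ℕ.*-identityʳ d)

-- e stands for 1 / ε²; the left-hand side is the bound of fits for the parameters chosen below.
bits-arith : ∀ {B c e L lk lℓ ln} → 1 ℕ.≤ B → B ℕ.≤ c ℕ.* e → 1 ℕ.≤ L → 1 ℕ.≤ lk →
  let R = suc L
      g = 15 ℕ.+ 2 ℕ.* lk ℕ.+ lℓ in
  R ℕ.* (suc B ℕ.* 1) ℕ.+ 2 ℕ.* (R ℕ.* (4 ℕ.* (B ℕ.+ ln ℕ.+ 1) ℕ.+ B ℕ.* g) ℕ.+ R)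
    ℕ.≤ L ℕ.* (108 ℕ.* c ℕ.* e ℕ.* (lk ℕ.+ lℓ) ℕ.+ 16 ℕ.* ln)
bits-arith {B} {c} {e} {L} {lk} {lℓ} {ln} 1≤B B≤ce 1≤L 1≤lk = begin
  R ℕ.* (suc B ℕ.* 1) ℕ.+ 2 ℕ.* (R ℕ.* (4 ℕ.* (B ℕ.+ ln ℕ.+ 1) ℕ.+ B ℕ.* (15 ℕ.+ 2 ℕ.* lk ℕ.+ lℓ)) ℕ.+ R)
    ≡⟨ shape R B ln lk lℓ ⟩
  R ℕ.* (11 ℕ.* 1 ℕ.+ 39 ℕ.* B ℕ.+ (4 ℕ.* lk ℕ.+ 2 ℕ.* lℓ) ℕ.* B ℕ.+ 8 ℕ.* ln)
    ≤⟨ ℕ.*-mono-≤ (ℕ.+-monoˡ-≤ L 1≤L) (ℕ.+-monoˡ-≤ (8 ℕ.* ln) (ℕ.+-monoˡ-≤ ((4 ℕ.* lk ℕ.+ 2 ℕ.* lℓ) ℕ.* B) (ℕ.+-monoˡ-≤ (39 ℕ.* B) (ℕ.*-monoʳ-≤ 11 1≤B)))) ⟩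
  (L ℕ.+ L) ℕ.* (11 ℕ.* B ℕ.+ 39 ℕ.* B ℕ.+ (4 ℕ.* lk ℕ.+ 2 ℕ.* lℓ) ℕ.* B ℕ.+ 8 ℕ.* ln)
    ≡⟨ collect L B lk lℓ ln ⟩
  (L ℕ.+ L) ℕ.* ((50 ℕ.* 1 ℕ.+ 4 ℕ.* lk ℕ.+ 2 ℕ.* lℓ) ℕ.* B ℕ.+ 8 ℕ.* ln)
    ≤⟨ ℕ.*-monoʳ-≤ (L ℕ.+ L) (ℕ.+-monoˡ-≤ (8 ℕ.* ln) (ℕ.*-mono-≤
         (ℕ.+-mono-≤ (ℕ.+-monoˡ-≤ (4 ℕ.* lk) (ℕ.*-monoʳ-≤ 50 1≤lk)) (ℕ.*-monoˡ-≤ lℓ (ℕ.m≤m+n 2 52))) B≤ce)) ⟩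
  (L ℕ.+ L) ℕ.* ((50 ℕ.* lk ℕ.+ 4 ℕ.* lk ℕ.+ 54 ℕ.* lℓ) ℕ.* (c ℕ.* e) ℕ.+ 8 ℕ.* ln)
    ≡⟨ finish L lk lℓ c e ln ⟩
  L ℕ.* (108 ℕ.* c ℕ.* e ℕ.* (lk ℕ.+ lℓ) ℕ.+ 16 ℕ.* ln) ∎
  where
  open ℕ.≤-Reasoning
  R : ℕ
  R = suc L
  shape : ∀ R B ln lk lℓ →
    R ℕ.* (suc B ℕ.* 1) ℕ.+ 2 ℕ.* (R ℕ.* (4 ℕ.* (B ℕ.+ ln ℕ.+ 1) ℕ.+ B ℕ.* (15 ℕ.+ 2 ℕ.* lk ℕ.+ lℓ)) ℕ.+ R)
      ≡ R ℕ.* (11 ℕ.* 1 ℕ.+ 39 ℕ.* B ℕ.+ (4 ℕ.* lk ℕ.+ 2 ℕ.* lℓ) ℕ.* B ℕ.+ 8 ℕ.* ln)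
  shape = ℕ-Solver.solve-∀
  collect : ∀ L B lk lℓ ln → (L ℕ.+ L) ℕ.* (11 ℕ.* B ℕ.+ 39 ℕ.* B ℕ.+ (4 ℕ.* lk ℕ.+ 2 ℕ.* lℓ) ℕ.* B ℕ.+ 8 ℕ.* ln)
    ≡ (L ℕ.+ L) ℕ.* ((50 ℕ.* 1 ℕ.+ 4 ℕ.* lk ℕ.+ 2 ℕ.* lℓ) ℕ.* B ℕ.+ 8 ℕ.* ln)
  collect = ℕ-Solver.solve-∀
  finish : ∀ L lk lℓ c e ln → (L ℕ.+ L) ℕ.* ((50 ℕ.* lk ℕ.+ 4 ℕ.* lk ℕ.+ 54 ℕ.* lℓ) ℕ.* (c ℕ.* e) ℕ.+ 8 ℕ.* ln)
    ≡ L ℕ.* (108 ℕ.* c ℕ.* e ℕ.* (lk ℕ.+ lℓ) ℕ.+ 16 ℕ.* ln)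
  finish = ℕ-Solver.solve-∀

-- Independent copies and the probability of success

𝔼-mono-Always : ∀ {A : Set} (r : Rand A) {φ ψ} → Always (λ a → φ a ≤ ψ a) r → ⟦ 𝔼 r ⟧ φ ≤ ⟦ 𝔼 r ⟧ ψ
𝔼-mono-Always (return a)    φ≤ψ = φ≤ψ
𝔼-mono-Always (uniform d f) φ≤ψ = *-monoˡ (0≤recip d) (∑ (suc d) .mono λ i → 𝔼-mono-Always (f i) (φ≤ψ i))

recip-ratio : ∀ a b c .{{_ : ℕ.NonZero b}} .{{_ : ℕ.NonZero c}} → a ℕ.* b ℕ.≤ c → recip (pred c) * ι a ≤ recip (pred b)
recip-ratio a b c ab≤c = begin
  rc * ι a                ≡⟨ ℚ.*-identityʳ (rc * ι a) ⟨
  rc * ι a * 1ℚ           ≡⟨ cong (rc * ι a *_) (recip-pred b) ⟨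
  rc * ι a * (rb * ι b)   ≡⟨ regroup rc (ι a) rb (ι b) ⟩
  rb * (rc * (ι a * ι b)) ≡⟨ cong (λ p → rb * (rc * p)) (ι-* a b) ⟨
  rb * (rc * ι (a ℕ.* b)) ≤⟨ *-monoˡ (0≤recip (pred b)) (*-monoˡ (0≤recip (pred c)) (ι-mono ab≤c)) ⟩
  rb * (rc * ι c)         ≡⟨ cong (rb *_) (recip-pred c) ⟩
  rb * 1ℚ                 ≡⟨ ℚ.*-identityʳ rb ⟩
  rb                      ∎
  where
  open ℚ.≤-Reasoning
  rb rc : ℚ
  rb = recip (pred b)
  rc = recip (pred c)
  regroup : ∀ rc a rb b → rc * a * (rb * b) ≡ rb * (rc * (a * b))
  regroup = solve-∀ ring

1≤recip* : ∀ c .{{_ : ℕ.NonZero c}} {p} → ι c ≤ p → 1ℚ ≤ recip (pred c) * p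
1≤recip* c {p} c≤p = subst (_≤ recip (pred c) * p)
  (recip-pred c) (*-monoˡ (0≤recip (pred c)) c≤p)

module Boosted (β⁻ A⁻ n R : ℕ) where
  open Sketch β⁻ A⁻ n public

  State : Set
  State = Vec SketchState R

  stateCode : Code State
  stateCode = vecCode sketchCode R

  initial : Rand State
  initial = sequence λ _ → sketchStart

  stepAll : State → Fin n → Rand State
  stepAll = parallel λ _ → sketchStep

  outputs : State → Fin R → ℚ
  outputs S r = sketchOutput (lookup S r)

  output : State → ℚ
  output S = median (tabulate (outputs S))

  stepAll-⊑ : ∀ S i → Always (Code._⊑_ stateCode S) (stepAll S i)
  stepAll-⊑ S i = Always-sequence (λ r → sketchStep (lookup S r) i) (λ r → sketchStep-⊑ (lookup S r) i)

  open Machine stateCode initial stepAll output stepAll-⊑ public using (algorithm; bits; 𝔼-run)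

  outcome : List (Fin n) → Rand State
  outcome σ = initial >>= λ S → steps stepAll S σ

  𝔼-outcome-∏ : ∀ (g : SketchState → ℚ) σ → ⟦ 𝔼 (outcome σ) ⟧ (λ S → ∏ λ r → g (lookup S r))
    ≡ ∏ {R} λ _ → 𝔼-final σ g
  𝔼-outcome-∏ g σ = begin
    ⟦ 𝔼 (outcome σ) ⟧ (λ S → ∏ λ r → g (lookup S r))
      ≡⟨ 𝔼->>= initial (λ S → steps stepAll S σ) (λ S → ∏ λ r → g (lookup S r)) ⟩
    (⟦ 𝔼 initial ⟧ λ S → ⟦ 𝔼 (steps stepAll S σ) ⟧ λ S′ → ∏ λ r → g (lookup S′ r))
      ≡⟨ cong-⟦⟧ (𝔼 initial) (λ S → 𝔼-parallel-∏ (λ (_ : Fin R) → sketchStep) (λ _ → g) S σ) ⟩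
    (⟦ 𝔼 initial ⟧ λ S → ∏ λ r → ⟦ 𝔼 (steps sketchStep (lookup S r) σ) ⟧ g)
      ≡⟨ 𝔼-sequence-∏ (λ (_ : Fin R) → sketchStart) (λ _ s → ⟦ 𝔼 (steps sketchStep s σ) ⟧ g) ⟩
    ∏ {R} (λ _ → 𝔼-final σ g) ∎
    where open ≡-Reasoning

  module _ (σ : List (Fin n)) (bound ε q : ℚ) (w : ℕ)
           (small⇒fits : ∀ S → Code.weight stateCode S ℕ.≤ 2 ^ w → fromℕ (bits S) ≤ bound)
           (penalty : SketchState → ℚ) (1≤penalty : ∀ s → 1ℚ ≤ penalty s)
           (penalised : Always (λ S → ∀ r → ¬ (outputs S r isA1± ε ApproxOf q) → ι 16 ≤ penalty (lookup S r)) (outcome σ)) where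

    weight : State → ℚ
    weight S = ι (Code.weight stateCode S)

    Penalised : State → Set
    Penalised S = ∀ r → ¬ (outputs S r isA1± ε ApproxOf q) → ι 16 ≤ penalty (lookup S r)

    penalties : State → ℚ
    penalties S = ∏ λ r → penalty (lookup S r)

    -- A pointwise bound on the indicator of failure: the first term is at least 1 when the weight
    -- exceeds 2^w, the second when at least half of the copies are inaccurate. Taking the mean
    -- performs Markov's inequality and the union bound together.
    failure : State → ℚ
    failure S = recip (pred (2 ^ w)) * weight S + recip (pred (4 ^ R)) * penalties S

    success : State → ℚ
    success S = indicator (succeeds? bound ε q) (bits S , output S)

    bad? : Decidable (λ v → ¬ (v isA1± ε ApproxOf q))
    bad? v = ¬? (v isA1± ε ApproxOf? q)

    private instance
      2^w≢0 : ℕ.NonZero (2 ^ w)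
      2^w≢0 = ℕ.m^n≢0 2 w
      4^R≢0 : ℕ.NonZero (4 ^ R)
      4^R≢0 = ℕ.m^n≢0 4 R

    0≤recip*weight : ∀ S → 0ℚ ≤ recip (pred (2 ^ w)) * weight S
    0≤recip*weight S = 0≤* (0≤recip (pred (2 ^ w))) (0≤ι (Code.weight stateCode S))

    0≤recip*penalties : ∀ S → 0ℚ ≤ recip (pred (4 ^ R)) * penalties S
    0≤recip*penalties S = 0≤* (0≤recip (pred (4 ^ R))) (ℚ.≤-trans 0≤1 (∏-≥1 λ r → 1≤penalty (lookup S r)))

    0≤success : ∀ S → 0ℚ ≤ success S
    0≤success S with does (succeeds? bound ε q (bits S , output S))
    ... | true  = 0≤1
    ... | false = ℚ.≤-refl

    succeeded : ∀ S → Succeeds bound ε q (bits S , output S) → success S ≡ 1ℚ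
    succeeded S ok = cong (λ b → if b then 1ℚ else 0ℚ) (dec-true (succeeds? bound ε q (bits S , output S)) ok)

    accurate : ∀ S → 2 ℕ.* (# bad?) (tabulate (outputs S)) ℕ.< R → output S isA1± ε ApproxOf q
    accurate S few =
        lo≤median {λ v → v isA1± ε ApproxOf q} bad? {(1ℚ - ε) * q} {(1ℚ + ε) * q} (tabulate (outputs S)) few′ (λ _ → proj₁)
      , median≤hi {λ v → v isA1± ε ApproxOf q} bad? {(1ℚ - ε) * q} {(1ℚ + ε) * q} (tabulate (outputs S)) few′ (λ _ → proj₂)
      where
      few′ : 2 ℕ.* (# bad?) (tabulate (outputs S)) ℕ.< length (tabulate (outputs S))
      few′ = subst (2 ℕ.* (# bad?) (tabulate (outputs S)) ℕ.<_) (sym (List.length-tabulate (outputs S))) few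

    1-failure≤success : ∀ S → Penalised S → 1ℚ - failure S ≤ success S
    1-failure≤success S pen = decide (Code.weight stateCode S ℕ.≤? 2 ^ w) (2 ℕ.* (# bad?) (tabulate (outputs S)) ℕ.<? R)
      where
      1≤failure⇒ : 1ℚ ≤ failure S → 1ℚ - failure S ≤ success S
      1≤failure⇒ 1≤ = ℚ.≤-trans {1ℚ - failure S} {0ℚ} (≤-via (flip-sign (failure S)) (p≤q⇒0≤q-p 1≤)) (0≤success S)
        where
        flip-sign : ∀ f → 0ℚ - (1ℚ - f) ≡ f - 1ℚ
        flip-sign = solve-∀ ring
      decide : Dec (Code.weight stateCode S ℕ.≤ 2 ^ w) → Dec (2 ℕ.* (# bad?) (tabulate (outputs S)) ℕ.< R) → 1ℚ - failure S ≤ success S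
      decide (no large) _ = 1≤failure⇒ (subst (_≤ failure S) (ℚ.+-identityʳ 1ℚ)
        (ℚ.+-mono-≤ (1≤recip* (2 ^ w) {weight S} (ι-mono (ℕ.<⇒≤ (ℕ.≰⇒> large)))) (0≤recip*penalties S)))
      decide (yes _) (no many) = 1≤failure⇒ (subst (_≤ failure S) (ℚ.+-identityˡ 1ℚ)
        (ℚ.+-mono-≤ (0≤recip*weight S) (1≤recip* (4 ^ R) {penalties S}
          (∏-majority bad? (outputs S) (λ r → penalty (lookup S r)) (λ r → 1≤penalty (lookup S r)) pen (ℕ.≮⇒≥ many)))))
      decide (yes small) (yes few) = subst (1ℚ - failure S ≤_) (sym (succeeded S (small⇒fits S small , accurate S few)))
        (≤-via (cancel (failure S)) (0≤+ (0≤recip*weight S) (0≤recip*penalties S)))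
        where
        cancel : ∀ f → 1ℚ - (1ℚ - f) ≡ f
        cancel = solve-∀ ring

    -- By independence the mean total weight is at most M^R, so a threshold 2^R times larger fails
    -- with probability at most 2^-R. The penalties have mean at most 2^R against the threshold 4^R.
    success-probability : ∀ M → M ^ R ℕ.* 2 ^ R ℕ.≤ 2 ^ w →
      𝔼-final σ (λ s → ι (Code.weight sketchCode s)) ≤ ι M →
      𝔼-final σ penalty ≤ ι 2 →
      1ℚ - (recip (pred (2 ^ R)) + recip (pred (2 ^ R))) ≤ Pr (succeeds? bound ε q) (run algorithm σ)
    success-probability M M^R≤ 𝔼weight≤ 𝔼penalty≤ = begin
      1ℚ - (h + h)
        ≤⟨ ℚ.+-monoʳ-≤ 1ℚ (ℚ.neg-antimono-≤ (ℚ.+-mono-≤ weight-part penalty-part)) ⟩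
      1ℚ - (rw * ⟦ 𝔼 (outcome σ) ⟧ weight + r4 * ⟦ 𝔼 (outcome σ) ⟧ penalties)
        ≡⟨ linear ⟨
      ⟦ 𝔼 (outcome σ) ⟧ (λ S → 1ℚ - failure S)
        -- Inaccuracy is known to be penalised only at reachable states; for the empty stream this
        -- restriction matters.
        ≤⟨ 𝔼-mono-Always (outcome σ) (always-map (outcome σ) 1-failure≤success penalised) ⟩
      ⟦ 𝔼 (outcome σ) ⟧ success
        ≡⟨ 𝔼->>= initial (λ S → steps stepAll S σ) success ⟩
      (⟦ 𝔼 initial ⟧ λ S → ⟦ 𝔼 (steps stepAll S σ) ⟧ success)
        ≡⟨ 𝔼-run σ (indicator (succeeds? bound ε q)) ⟨
      ⟦ 𝔼 (run algorithm σ) ⟧ (indicator (succeeds? bound ε q))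
        ≡⟨ Pr≡𝔼 (succeeds? bound ε q) (run algorithm σ) ⟨
      Pr (succeeds? bound ε q) (run algorithm σ) ∎
      where
      open ℚ.≤-Reasoning
      h rw r4 : ℚ
      h = recip (pred (2 ^ R))
      rw = recip (pred (2 ^ w))
      r4 = recip (pred (4 ^ R))
      instance
        2^R≢0 : ℕ.NonZero (2 ^ R)
        2^R≢0 = ℕ.m^n≢0 2 R
      weight-part : rw * ⟦ 𝔼 (outcome σ) ⟧ weight ≤ h
      weight-part = begin
        rw * ⟦ 𝔼 (outcome σ) ⟧ weight
          ≡⟨ cong (rw *_) (trans (cong-⟦⟧ (𝔼 (outcome σ)) (ι-weights sketchCode)) (𝔼-outcome-∏ (λ s → ι (Code.weight sketchCode s)) σ)) ⟩
        rw * ∏ {R} (λ _ → 𝔼-final σ (λ s → ι (Code.weight sketchCode s)))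
          ≤⟨ *-monoˡ (0≤recip (pred (2 ^ w))) (∏-mono {R} (λ _ → nonneg (𝔼 sketchStart) λ s → nonneg (𝔼 (steps sketchStep s σ)) λ s′ → 0≤ι (Code.weight sketchCode s′)) (λ _ → 𝔼weight≤)) ⟩
        rw * ∏ {R} (λ _ → ι M)
          ≡⟨ cong (rw *_) (∏-const R M) ⟩
        rw * ι (M ^ R)
          ≤⟨ recip-ratio (M ^ R) (2 ^ R) (2 ^ w) M^R≤ ⟩
        h ∎
      2^R*2^R≡4^R : 2 ^ R ℕ.* 2 ^ R ≡ 4 ^ R
      2^R*2^R≡4^R = trans (sym (ℕ.^-distribˡ-+-* 2 R R)) (trans (cong (λ m → 2 ^ (R ℕ.+ m)) (sym (ℕ.+-identityʳ R))) (sym (ℕ.^-*-assoc 2 2 R)))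
      penalty-part : r4 * ⟦ 𝔼 (outcome σ) ⟧ penalties ≤ h
      penalty-part = begin
        r4 * ⟦ 𝔼 (outcome σ) ⟧ penalties
          ≡⟨ cong (r4 *_) (𝔼-outcome-∏ penalty σ) ⟩
        r4 * ∏ {R} (λ _ → 𝔼-final σ penalty)
          ≤⟨ *-monoˡ (0≤recip (pred (4 ^ R))) (∏-mono {R} (λ _ → nonneg (𝔼 sketchStart) λ s → nonneg (𝔼 (steps sketchStep s σ)) λ s′ → ℚ.≤-trans 0≤1 (1≤penalty s′)) (λ _ → 𝔼penalty≤)) ⟩
        r4 * ∏ {R} (λ _ → ι 2)
          ≡⟨ cong (r4 *_) (∏-const R 2) ⟩
        r4 * ι (2 ^ R)
          ≤⟨ recip-ratio (2 ^ R) (2 ^ R) (4 ^ R) (ℕ.≤-reflexive 2^R*2^R≡4^R) ⟩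
        h ∎
      shape : ∀ a b x y → 1ℚ - (a * x + b * y) ≡ 1ℚ + (- a * x + - b * y)
      shape = solve-∀ ring
      linear : ⟦ 𝔼 (outcome σ) ⟧ (λ S → 1ℚ - failure S) ≡ 1ℚ - (rw * ⟦ 𝔼 (outcome σ) ⟧ weight + r4 * ⟦ 𝔼 (outcome σ) ⟧ penalties)
      linear = begin-equality
        ⟦ 𝔼 (outcome σ) ⟧ (λ S → 1ℚ - failure S)
          ≡⟨ cong-⟦⟧ (𝔼 (outcome σ)) (λ S → shape rw r4 (weight S) (penalties S)) ⟩
        ⟦ 𝔼 (outcome σ) ⟧ (λ S → 1ℚ + (- rw * weight S + - r4 * penalties S))
          ≡⟨ 𝔼-affine (outcome σ) 1ℚ (- rw) weight (λ S → - r4 * penalties S) ⟩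
        1ℚ + (- rw * ⟦ 𝔼 (outcome σ) ⟧ weight + ⟦ 𝔼 (outcome σ) ⟧ (λ S → - r4 * penalties S))
          ≡⟨ cong (λ p → 1ℚ + (- rw * ⟦ 𝔼 (outcome σ) ⟧ weight + p)) (𝔼 (outcome σ) .*-homo (- r4) penalties) ⟩
        1ℚ + (- rw * ⟦ 𝔼 (outcome σ) ⟧ weight + - r4 * ⟦ 𝔼 (outcome σ) ⟧ penalties)
          ≡⟨ shape rw r4 (⟦ 𝔼 (outcome σ) ⟧ weight) (⟦ 𝔼 (outcome σ) ⟧ penalties) ⟨
        1ℚ - (rw * ⟦ 𝔼 (outcome σ) ⟧ weight + r4 * ⟦ 𝔼 (outcome σ) ⟧ penalties) ∎

  fits : ∀ w S → Code.weight stateCode S ℕ.≤ 2 ^ w → bits S ℕ.≤ R ℕ.* (suc B ℕ.* 1) ℕ.+ 2 ℕ.* w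
  fits w S small = 2^-cancel-≤ (begin
    2 ^ bits S
      ≤⟨ Code.length-encode stateCode S ⟩
    2 ^ overhead ℕ.* (Code.weight stateCode S ℕ.* Code.weight stateCode S)
      ≤⟨ ℕ.*-monoʳ-≤ (2 ^ overhead) (ℕ.*-mono-≤ small small) ⟩
    2 ^ overhead ℕ.* (2 ^ w ℕ.* 2 ^ w)
      ≡⟨ cong (2 ^ overhead ℕ.*_) (ℕ.^-distribˡ-+-* 2 w w) ⟨
    2 ^ overhead ℕ.* 2 ^ (w ℕ.+ w)
      ≡⟨ ℕ.^-distribˡ-+-* 2 overhead (w ℕ.+ w) ⟨
    2 ^ (overhead ℕ.+ (w ℕ.+ w))
      ≡⟨ cong (λ m → 2 ^ (overhead ℕ.+ (w ℕ.+ m))) (ℕ.+-identityʳ w) ⟨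
    2 ^ (overhead ℕ.+ 2 ℕ.* w) ∎)
    where
    open ℕ.≤-Reasoning
    overhead : ℕ
    overhead = R ℕ.* (suc B ℕ.* 1)
    2^-cancel-≤ : ∀ {a b} → 2 ^ a ℕ.≤ 2 ^ b → a ℕ.≤ b
    2^-cancel-≤ {a} {b} le = ℕ.≮⇒≥ λ b<a → ℕ.<⇒≱ (ℕ.^-monoʳ-< 2 (s≤s (s≤s z≤n)) b<a) le

-- Choice of the parameters and assembly

spaceConstant : ℕ
-- This is 4 · 108 · 1441: E² is at most 4/ε², 108 comes from `bits-arith`, and B is at most 1441
-- E².
spaceConstant = 622512

recip≤ : ∀ E .{{_ : ℕ.NonZero E}} {r ε} → 0ℚ ≤ ε → r * ε ≡ 1ℚ → r ≤ ι E → recip (pred E) ≤ ε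
recip≤ E {r} {ε} 0≤ε rε≡1 r≤E = begin
  s             ≡⟨ ℚ.*-identityʳ s ⟨
  s * 1ℚ        ≡⟨ cong (s *_) rε≡1 ⟨
  s * (r * ε)   ≤⟨ *-monoˡ (0≤recip (pred E)) (*-monoʳ 0≤ε r≤E) ⟩
  s * (ι E * ε) ≡⟨ ℚ.*-assoc s (ι E) ε ⟨
  s * ι E * ε   ≡⟨ cong (_* ε) (recip-pred E) ⟩
  1ℚ * ε        ≡⟨ ℚ.*-identityˡ ε ⟩
  ε             ∎
  where
  open ℚ.≤-Reasoning
  s : ℚ
  s = recip (pred E)

square≤ : ∀ {a r ε y} → 0ℚ ≤ a → 0ℚ ≤ r → a ≤ r + r → r * ε ≡ 1ℚ → y * (ε * ε) ≡ 1ℚ → a * a ≤ #ℚ 4 * y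
square≤ {a} {r} {ε} {y} 0≤a 0≤r a≤2r rε≡1 yεε≡1 = begin
  a * a                          ≤⟨ *-mono 0≤a (0≤+ 0≤r 0≤r) a≤2r a≤2r ⟩
  (r + r) * (r + r)              ≡⟨ shape r ⟩
  #ℚ 4 * (1ℚ * (r * r))          ≡⟨ cong (λ o → #ℚ 4 * (o * (r * r))) yεε≡1 ⟨
  #ℚ 4 * (y * (ε * ε) * (r * r)) ≡⟨ regroup y ε r ⟩
  #ℚ 4 * (y * (r * ε * (r * ε))) ≡⟨ cong (λ o → #ℚ 4 * (y * (o * o))) rε≡1 ⟩
  #ℚ 4 * (y * (1ℚ * 1ℚ))         ≡⟨ cong (#ℚ 4 *_) (ℚ.*-identityʳ y) ⟩
  #ℚ 4 * y                       ∎
  where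
  open ℚ.≤-Reasoning
  shape : ∀ r → (r + r) * (r + r) ≡ #ℚ 4 * (1ℚ * (r * r))
  shape = solve-∀ ring
  regroup : ∀ y ε r → #ℚ 4 * (y * (ε * ε) * (r * r)) ≡ #ℚ 4 * (y * (r * ε * (r * ε)))
  regroup = solve-∀ ring

product≤ : ∀ k E K {r} → ι E ≤ r + r → ι k * r ≤ ι K → k ℕ.* E ℕ.≤ 2 ℕ.* K
product≤ k E K {r} E≤2r kr≤K = ι-cancel-≤ {k ℕ.* E} {2 ℕ.* K} (begin
  ι (k ℕ.* E)      ≡⟨ ι-* k E ⟩
  ι k * ι E        ≤⟨ *-monoˡ (0≤ι k) E≤2r ⟩
  ι k * (r + r)    ≡⟨ distrib (ι k) r ⟩
  #ℚ 2 * (ι k * r) ≤⟨ *-monoˡ (0≤#ℚ 2) kr≤K ⟩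
  #ℚ 2 * ι K       ≡⟨ cong (_* ι K) (ι-fromℕ 2) ⟨
  ι 2 * ι K        ≡⟨ ι-* 2 K ⟨
  ι (2 ℕ.* K)      ∎)
  where
  open ℚ.≤-Reasoning
  distrib : ∀ k r → k * (r + r) ≡ #ℚ 2 * (k * r)
  distrib = solve-∀ ring

-- One copy beyond `L` halves the failure probability of each of the two events, which pays for
-- there being two of them.
2/2^1+L≤ : ∀ L D {r δ} → 0ℚ ≤ δ → r * δ ≡ 1ℚ → r ≤ ι D → D ℕ.≤ 2 ^ L →
  recip (pred (2 ^ suc L)) + recip (pred (2 ^ suc L)) ≤ δ
2/2^1+L≤ L D {r} {δ} 0≤δ rδ≡1 r≤D D≤2^L = *-cancel-≤ {ι (2 ^ L)} {h + h} {δ} (0<ι (2 ^ L) {{ℕ.m^n≢0 2 L}}) (begin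
  ι (2 ^ L) * (h + h)    ≡⟨ regroup (ι (2 ^ L)) h ⟩
  h * (#ℚ 2 * ι (2 ^ L)) ≡⟨ cong (λ a → h * (a * ι (2 ^ L))) (ι-fromℕ 2) ⟨
  h * (ι 2 * ι (2 ^ L))  ≡⟨ cong (h *_) (ι-* 2 (2 ^ L)) ⟨
  h * ι (2 ^ suc L)      ≡⟨ recip-pred (2 ^ suc L) {{ℕ.m^n≢0 2 (suc L)}} ⟩
  1ℚ                       ≡⟨ rδ≡1 ⟨
  r * δ                    ≤⟨ *-monoʳ 0≤δ (ℚ.≤-trans r≤D (ι-mono D≤2^L)) ⟩
  ι (2 ^ L) * δ          ∎)
  where
  open ℚ.≤-Reasoning
  h : ℚ
  h = recip (pred (2 ^ suc L))
  regroup : ∀ a h → a * (h + h) ≡ h * (#ℚ 2 * a)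
  regroup = solve-∀ ring

-- Charges log A to log (k/ε): 1200 k E² is at most 2^11 (k E)², and k E is at most 2^(1 + lk), so
-- the exponent is 11 + 2 + 2 lk.
counterBase≤ : ∀ k E K lk .{{_ : ℕ.NonZero k}} → k ℕ.* E ℕ.≤ 2 ℕ.* K → K ℕ.≤ 2 ^ lk →
  1200 ℕ.* (k ℕ.* (E ℕ.* E)) ℕ.≤ 2 ^ (13 ℕ.+ 2 ℕ.* lk)
counterBase≤ k E K lk kE≤2K K≤2^lk = begin
  1200 ℕ.* (k ℕ.* (E ℕ.* E))                   ≤⟨ ℕ.*-mono-≤ {1200} {2048} (ℕ.m≤m+n 1200 848) (ℕ.m≤m*n (k ℕ.* (E ℕ.* E)) k) ⟩
  2048 ℕ.* (k ℕ.* (E ℕ.* E) ℕ.* k)             ≡⟨ cong (2048 ℕ.*_) (regroup k E) ⟩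
  2048 ℕ.* (k ℕ.* E ℕ.* (k ℕ.* E))             ≤⟨ ℕ.*-monoʳ-≤ 2048 (ℕ.*-mono-≤ kE≤ kE≤) ⟩
  2 ^ 11 ℕ.* (2 ^ suc lk ℕ.* 2 ^ suc lk) ≡⟨ cong (2 ^ 11 ℕ.*_) (ℕ.^-distribˡ-+-* 2 (suc lk) (suc lk)) ⟨
  2 ^ 11 ℕ.* 2 ^ (suc lk ℕ.+ suc lk)       ≡⟨ ℕ.^-distribˡ-+-* 2 11 (suc lk ℕ.+ suc lk) ⟨
  2 ^ (11 ℕ.+ (suc lk ℕ.+ suc lk))           ≡⟨ cong (2 ℕ.^_) (exponent lk) ⟩
  2 ^ (13 ℕ.+ 2 ℕ.* lk)                      ∎
  where
  open ℕ.≤-Reasoning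
  regroup : ∀ k E → k ℕ.* (E ℕ.* E) ℕ.* k ≡ k ℕ.* E ℕ.* (k ℕ.* E)
  regroup = ℕ-Solver.solve-∀
  exponent : ∀ l → 11 ℕ.+ (suc l ℕ.+ suc l) ≡ 13 ℕ.+ 2 ℕ.* l
  exponent = ℕ-Solver.solve-∀
  kE≤ : k ℕ.* E ℕ.≤ 2 ^ suc lk
  kE≤ = ℕ.≤-trans kE≤2K (ℕ.*-monoʳ-≤ 2 K≤2^lk)

-- The crude B ≤ 2^B suffices, as the B counters take at least a bit each anyway.
seeds≤ : ∀ B n ln → n ℕ.≤ 2 ^ ln → (B ℕ.* suc n) ^ 4 ℕ.≤ 2 ^ (4 ℕ.* (B ℕ.+ ln ℕ.+ 1))
seeds≤ B n ln n≤2^ln = begin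
  (B ℕ.* suc n) ^ 4                  ≤⟨ ℕ.^-monoˡ-≤ 4 (ℕ.*-mono-≤ (n≤2^n B) suc-n≤) ⟩
  (2 ^ B ℕ.* 2 ^ (ln ℕ.+ 1)) ^ 4 ≡⟨ cong (_^ 4) (ℕ.^-distribˡ-+-* 2 B (ln ℕ.+ 1)) ⟨
  (2 ^ (B ℕ.+ (ln ℕ.+ 1))) ^ 4     ≡⟨ ℕ.^-*-assoc 2 (B ℕ.+ (ln ℕ.+ 1)) 4 ⟩
  2 ^ ((B ℕ.+ (ln ℕ.+ 1)) ℕ.* 4)     ≡⟨ cong (2 ℕ.^_) (exponent B ln) ⟩
  2 ^ (4 ℕ.* (B ℕ.+ ln ℕ.+ 1))       ∎
  where
  open ℕ.≤-Reasoning
  exponent : ∀ b l → (b ℕ.+ (l ℕ.+ 1)) ℕ.* 4 ≡ 4 ℕ.* (b ℕ.+ l ℕ.+ 1)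
  exponent = ℕ-Solver.solve-∀
  n≤2^n : ∀ n → n ℕ.≤ 2 ^ n
  n≤2^n zero    = z≤n
  n≤2^n (suc n) = ℕ.+-mono-≤ (ℕ.m^n>0 2 n) (subst (n ℕ.≤_) (sym (ℕ.+-identityʳ (2 ^ n))) (n≤2^n n))
  suc-n≤ : suc n ℕ.≤ 2 ^ (ln ℕ.+ 1)
  suc-n≤ = begin
    1 ℕ.+ n               ≤⟨ ℕ.+-mono-≤ (ℕ.m^n>0 2 ln) n≤2^ln ⟩
    2 ^ ln ℕ.+ 2 ^ ln ≡⟨ cong (2 ^ ln ℕ.+_) (ℕ.+-identityʳ (2 ^ ln)) ⟨
    2 ^ suc ln          ≡⟨ cong (2 ℕ.^_) (ℕ.+-comm ln 1) ⟨
    2 ^ (ln ℕ.+ 1)      ∎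

weight≤ : ∀ t A B R a lk ℓ lℓ → t ℕ.≤ 2 ^ a → A ℕ.≤ 2 ^ (13 ℕ.+ 2 ℕ.* lk) → ℓ ℕ.≤ 2 ^ lℓ →
  (t ℕ.* (A ℕ.* (ℓ ℕ.+ 3)) ^ B) ^ R ℕ.* 2 ^ R ℕ.≤ 2 ^ (R ℕ.* (a ℕ.+ B ℕ.* (15 ℕ.+ 2 ℕ.* lk ℕ.+ lℓ)) ℕ.+ R)
weight≤ t A B R a lk ℓ lℓ t≤ A≤ ℓ≤ = begin
  (t ℕ.* (A ℕ.* (ℓ ℕ.+ 3)) ^ B) ^ R ℕ.* 2 ^ R
    ≤⟨ ℕ.*-monoˡ-≤ (2 ^ R) (ℕ.^-monoˡ-≤ R (ℕ.*-mono-≤ t≤ (ℕ.^-monoˡ-≤ B counter≤2^g))) ⟩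
  (2 ^ a ℕ.* (2 ^ g) ^ B) ^ R ℕ.* 2 ^ R
    ≡⟨ cong (λ p → (2 ^ a ℕ.* p) ^ R ℕ.* 2 ^ R) (power g B) ⟩
  (2 ^ a ℕ.* 2 ^ (B ℕ.* g)) ^ R ℕ.* 2 ^ R
    ≡⟨ cong (λ p → p ^ R ℕ.* 2 ^ R) (ℕ.^-distribˡ-+-* 2 a (B ℕ.* g)) ⟨
  (2 ^ (a ℕ.+ B ℕ.* g)) ^ R ℕ.* 2 ^ R
    ≡⟨ cong (ℕ._* 2 ^ R) (power (a ℕ.+ B ℕ.* g) R) ⟩
  2 ^ (R ℕ.* (a ℕ.+ B ℕ.* g)) ℕ.* 2 ^ R
    ≡⟨ ℕ.^-distribˡ-+-* 2 (R ℕ.* (a ℕ.+ B ℕ.* g)) R ⟨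
  2 ^ (R ℕ.* (a ℕ.+ B ℕ.* g) ℕ.+ R) ∎
  where
  open ℕ.≤-Reasoning
  g : ℕ
  g = 15 ℕ.+ 2 ℕ.* lk ℕ.+ lℓ
  power : ∀ x y → (2 ^ x) ^ y ≡ 2 ^ (y ℕ.* x)
  power x y = trans (ℕ.^-*-assoc 2 x y) (cong (2 ℕ.^_) (ℕ.*-comm x y))
  exponent : ∀ a b → 13 ℕ.+ 2 ℕ.* a ℕ.+ (2 ℕ.+ b) ≡ 15 ℕ.+ 2 ℕ.* a ℕ.+ b
  exponent = ℕ-Solver.solve-∀
  counter≤2^g : A ℕ.* (ℓ ℕ.+ 3) ℕ.≤ 2 ^ g
  counter≤2^g = begin
    A ℕ.* (ℓ ℕ.+ 3)
      -- Both ℓ and 3 are charged to 2^lℓ, which makes a factor 4; its exponent 2 and the 13 of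
      -- `counterBase≤` add up to 15.
      ≤⟨ ℕ.*-mono-≤ A≤ (ℕ.+-mono-≤ ℓ≤ (ℕ.*-monoʳ-≤ 3 (ℕ.m^n>0 2 lℓ))) ⟩
    2 ^ (13 ℕ.+ 2 ℕ.* lk) ℕ.* (2 ^ 2 ℕ.* 2 ^ lℓ)
      ≡⟨ cong (2 ^ (13 ℕ.+ 2 ℕ.* lk) ℕ.*_) (ℕ.^-distribˡ-+-* 2 2 lℓ) ⟨
    2 ^ (13 ℕ.+ 2 ℕ.* lk) ℕ.* 2 ^ (2 ℕ.+ lℓ)
      ≡⟨ ℕ.^-distribˡ-+-* 2 (13 ℕ.+ 2 ℕ.* lk) (2 ℕ.+ lℓ) ⟨
    2 ^ (13 ℕ.+ 2 ℕ.* lk ℕ.+ (2 ℕ.+ lℓ))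
      ≡⟨ cong (2 ℕ.^_) (exponent lk lℓ) ⟩
    2 ^ g ∎

space≤ : ∀ L a E lk lℓ ln C {y} → 4 ℕ.* a ≡ C → 16 ℕ.≤ C → ι E * ι E ≤ #ℚ 4 * y →
  ι (L ℕ.* (a ℕ.* (E ℕ.* E) ℕ.* (lk ℕ.+ lℓ) ℕ.+ 16 ℕ.* ln)) ≤ ι C * (y * ι L * (ι lk + ι lℓ) + ι ln * ι L)
space≤ L a E lk lℓ ln C {y} 4a≡C 16≤C E²≤4y = begin
  ι (L ℕ.* (a ℕ.* (E ℕ.* E) ℕ.* (lk ℕ.+ lℓ) ℕ.+ 16 ℕ.* ln))
    ≡⟨ cast ⟩
  ι L * (ι a * (ι E * ι E) * (ι lk + ι lℓ) + ι 16 * ι ln)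
    ≤⟨ *-monoˡ (0≤ι L) (ℚ.+-mono-≤ (*-monoʳ (0≤+ (0≤ι lk) (0≤ι lℓ)) (*-monoˡ (0≤ι a) E²≤4y)) (*-monoʳ (0≤ι ln) (ι-mono 16≤C))) ⟩
  ι L * (ι a * (#ℚ 4 * y) * (ι lk + ι lℓ) + ι C * ι ln)
    ≡⟨ regroup (ι L) (ι a) y (ι lk + ι lℓ) (ι C) (ι ln) ⟩
  #ℚ 4 * ι a * (y * ι L * (ι lk + ι lℓ)) + ι C * (ι ln * ι L)
    ≡⟨ cong (λ c → c * (y * ι L * (ι lk + ι lℓ)) + ι C * (ι ln * ι L))
         (trans (cong (_* ι a) (sym (ι-fromℕ 4))) (trans (sym (ι-* 4 a)) (cong ι 4a≡C))) ⟩
  ι C * (y * ι L * (ι lk + ι lℓ)) + ι C * (ι ln * ι L)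
    ≡⟨ ℚ.*-distribˡ-+ (ι C) (y * ι L * (ι lk + ι lℓ)) (ι ln * ι L) ⟨
  ι C * (y * ι L * (ι lk + ι lℓ) + ι ln * ι L) ∎
  where
  open ℚ.≤-Reasoning
  cast : ι (L ℕ.* (a ℕ.* (E ℕ.* E) ℕ.* (lk ℕ.+ lℓ) ℕ.+ 16 ℕ.* ln)) ≡ ι L * (ι a * (ι E * ι E) * (ι lk + ι lℓ) + ι 16 * ι ln)
  cast = trans (ι-* L (a ℕ.* (E ℕ.* E) ℕ.* (lk ℕ.+ lℓ) ℕ.+ 16 ℕ.* ln)) (cong (ι L *_)
    (trans (ι-+ (a ℕ.* (E ℕ.* E) ℕ.* (lk ℕ.+ lℓ)) (16 ℕ.* ln)) (cong₂ _+_
      (trans (ι-* (a ℕ.* (E ℕ.* E)) (lk ℕ.+ lℓ)) (cong₂ _*_ (trans (ι-* a (E ℕ.* E)) (cong (ι a *_) (ι-* E E))) (ι-+ lk lℓ)))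
      (ι-* 16 ln))))
  regroup : ∀ L a y b C l → L * (a * (#ℚ 4 * y) * b + C * l) ≡ #ℚ 4 * a * (y * L * b) + C * (l * L)
  regroup = solve-∀ ring

module Solution (β⁻ A⁻ n k E L lk ln : ℕ) .{{_ : ℕ.NonZero k}} .{{_ : ℕ.NonZero E}} {ε δ : ℚ} (1/E≤ε : recip (pred E) ≤ ε) where
  open Boosted β⁻ A⁻ n (suc L) public

  module _ (β≡ : β ≡ 1440 ℕ.* (E ℕ.* E)) (A≡ : A ≡ 1200 ℕ.* (k ℕ.* (E ℕ.* E)))
           (A≤ : 1200 ℕ.* (k ℕ.* (E ℕ.* E)) ℕ.≤ 2 ^ (13 ℕ.+ 2 ℕ.* lk))
           (n≤ : n ℕ.≤ 2 ^ ln) (1≤L : 1 ℕ.≤ L) (1≤lk : 1 ℕ.≤ lk)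
           (2/2^R≤δ : recip (pred (2 ^ suc L)) + recip (pred (2 ^ suc L)) ≤ δ)
           (σ : List (Fin n)) (sparse : ‖ frequency σ ‖₀ ℕ.≤ k) where

    ℓ lℓ w : ℕ
    ℓ = ⌈log₂ length σ ⌉
    lℓ = ⌈log₂ ℓ ⌉
    w = suc L ℕ.* (4 ℕ.* (B ℕ.+ ln ℕ.+ 1) ℕ.+ B ℕ.* (15 ℕ.+ 2 ℕ.* lk ℕ.+ lℓ)) ℕ.+ suc L

    B≤ : B ℕ.≤ 1441 ℕ.* (E ℕ.* E)
    B≤ = ℕ.≤-trans (ℕ.≤-reflexive (cong suc β≡)) (ℕ.+-monoˡ-≤ (1440 ℕ.* (E ℕ.* E)) (ℕ.>-nonZero⁻¹ (E ℕ.* E) {{ℕ.m*n≢0 E E}}))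

    bits≤ : ∀ S → Code.weight stateCode S ℕ.≤ 2 ^ w →
      bits S ℕ.≤ L ℕ.* (108 ℕ.* 1441 ℕ.* (E ℕ.* E) ℕ.* (lk ℕ.+ lℓ) ℕ.+ 16 ℕ.* ln)
    bits≤ S small = ℕ.≤-trans (fits w S small) (bits-arith {B} {1441} {E ℕ.* E} {L} {lk} {lℓ} {ln} (s≤s z≤n) B≤ 1≤L 1≤lk)

    module _ (bound : ℚ) (bound≥ : ι (L ℕ.* (108 ℕ.* 1441 ℕ.* (E ℕ.* E) ℕ.* (lk ℕ.+ lℓ) ℕ.+ 16 ℕ.* ln)) ≤ bound) where

      q : ℚ
      q = fromℕ ‖ frequency σ ‖₂²

      -- The penalty is left abstract because that of `Analysis` divides by F₂, which is 0 for the
      -- empty stream.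
      conclude : ∀ (penalty : SketchState → ℚ) → (∀ s → 1ℚ ≤ penalty s) →
        Always (λ S → ∀ r → ¬ (outputs S r isA1± ε ApproxOf q) → ι 16 ≤ penalty (lookup S r)) (outcome σ) →
        𝔼-final σ penalty ≤ ι 2 →
        1ℚ - δ ≤ Pr (succeeds? bound ε q) (run algorithm σ)
      conclude penalty 1≤penalty penalised 𝔼≤2 = ℚ.≤-trans (ℚ.+-monoʳ-≤ 1ℚ (ℚ.neg-antimono-≤ 2/2^R≤δ))
        (success-probability σ bound ε q w
          (λ S small → subst (_≤ bound) (ι-fromℕ (bits S)) (ℚ.≤-trans (ι-mono (bits≤ S small)) bound≥))
          penalty 1≤penalty penalised (t ℕ.* (A ℕ.* (ℓ ℕ.+ 3)) ^ B)
          (weight≤ t A B (suc L) (4 ℕ.* (B ℕ.+ ln ℕ.+ 1)) lk ℓ lℓ (seeds≤ B n ln n≤)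
            (subst (ℕ._≤ 2 ^ (13 ℕ.+ 2 ℕ.* lk)) (sym A≡) A≤) (n≤2^⌈log₂n⌉ ℓ))
          (𝔼-weight≤ ℓ σ (n≤2^⌈log₂n⌉ (length σ)))
          𝔼≤2)

      nonempty : 1 ℕ.≤ length σ → 1ℚ - δ ≤ Pr (succeeds? bound ε q) (run algorithm σ)
      nonempty 1≤m = conclude penalty 1≤penalty
        (always (λ S r → inaccurate⇒16≤penalty 1/E≤ε (lookup S r)) (outcome σ))
        (subst (𝔼-final σ penalty ≤_) (sym (ι-fromℕ 2)) 𝔼-penalty≤)
        where
        0<F₂ : 0 ℕ.< ‖ frequency σ ‖₂²
        0<F₂ = ℕ.n≢0⇒n>0 λ F₂≡0 → ℚ.<-irrefl refl (ℚ.<-≤-trans (0<m²) (ℚ.≤-trans (length²≤k*F₂ k σ sparse)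
          (ℚ.≤-reflexive (trans (cong (ι k *_) (trans (sym (ι-‖‖₂² σ)) (trans (cong ι F₂≡0) ι-0))) (ℚ.*-zeroʳ (ι k))))))
          where
          0<m² : 0ℚ < ι (length σ) * ι (length σ)
          0<m² = ℚ.<-≤-trans (ℚ.positive⁻¹ 1ℚ) (subst (_≤ ι (length σ) * ι (length σ)) (ℚ.*-identityˡ 1ℚ)
            (*-mono 0≤1 (0≤ι (length σ)) 1≤ιm 1≤ιm))
            where
            1≤ιm : 1ℚ ≤ ι (length σ)
            1≤ιm = 1≤ι (length σ) {{ℕ.>-nonZero 1≤m}}
        open Analysis E k β≡ A≡ σ sparse 0<F₂

  output-empty : Always (λ s → sketchOutput s ≡ 0ℚ) sketchStart
  output-empty i = begin
    recip β⁻ * quad (estimates (replicate B 0)) ≡⟨ cong (recip β⁻ *_) (quad-cong λ b → trans (cong estimate (Vec.lookup-replicate b 0)) (vanish (ι A))) ⟩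
    recip β⁻ * quad (λ _ → 0ℚ)                  ≡⟨ cong (λ z → recip β⁻ * (ι B * z - ⟦ ∑ B ⟧ (λ _ → 0ℚ) * ⟦ ∑ B ⟧ (λ _ → 0ℚ))) (0-homo (∑ B)) ⟩
    recip β⁻ * (ι B * 0ℚ - ⟦ ∑ B ⟧ (λ _ → 0ℚ) * ⟦ ∑ B ⟧ (λ _ → 0ℚ))
                                                     ≡⟨ cong (λ z → recip β⁻ * (ι B * 0ℚ - z * z)) (0-homo (∑ B)) ⟩
    recip β⁻ * (ι B * 0ℚ - 0ℚ * 0ℚ) ≡⟨ zero-form (recip β⁻) (ι B) ⟩
    0ℚ                              ∎
    where
    open ≡-Reasoning
    vanish : ∀ a → a * (1ℚ - 1ℚ) ≡ 0ℚ
    vanish = solve-∀ ring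
    zero-form : ∀ r b → r * (b * 0ℚ - 0ℚ * 0ℚ) ≡ 0ℚ
    zero-form = solve-∀ ring

  empty-exact : Always (λ S → ∀ r → outputs S r isA1± ε ApproxOf fromℕ ‖ frequency {n} [] ‖₂²) (outcome [])
  empty-exact = Always->>= {P = λ S → ∀ r → outputs S r ≡ 0ℚ} initial
    (Always-sequence {N = suc L} {P = λ _ s → sketchOutput s ≡ 0ℚ} (λ _ → sketchStart) (λ _ → output-empty)) λ S zeros r →
    subst (λ z → outputs S r isA1± ε ApproxOf z) (sym q≡0) (subst (λ v → v isA1± ε ApproxOf 0ℚ) (sym (zeros r))
      (ℚ.≤-reflexive (ℚ.*-zeroʳ (1ℚ - ε)) , ℚ.≤-reflexive (sym (ℚ.*-zeroʳ (1ℚ + ε)))))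
    where
    q≡0 : fromℕ ‖ frequency {n} [] ‖₂² ≡ 0ℚ
    q≡0 = trans (sym (ι-fromℕ ‖ frequency {n} [] ‖₂²)) (trans (ι-‖‖₂² {n} []) (∑-x[] {n} x[ [] ]))

  solves : (bound : ℕ → ℚ) →
    (∀ m → ι (L ℕ.* (108 ℕ.* 1441 ℕ.* (E ℕ.* E) ℕ.* (lk ℕ.+ ⌈log₂ ⌈log₂ m ⌉ ⌉) ℕ.+ 16 ℕ.* ln)) ≤ bound m) →
    β ≡ 1440 ℕ.* (E ℕ.* E) → A ≡ 1200 ℕ.* (k ℕ.* (E ℕ.* E)) → 1200 ℕ.* (k ℕ.* (E ℕ.* E)) ℕ.≤ 2 ^ (13 ℕ.+ 2 ℕ.* lk) →
    n ℕ.≤ 2 ^ ln → 1 ℕ.≤ L → 1 ℕ.≤ lk → recip (pred (2 ^ suc L)) + recip (pred (2 ^ suc L)) ≤ δ →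
    ∀ σ → ‖ frequency σ ‖₀ ℕ.≤ k → 1ℚ - δ ≤ Pr (succeeds? (bound (length σ)) ε (fromℕ ‖ frequency σ ‖₂²)) (run algorithm σ)
  solves bound bound≥ β≡ A≡ A≤ n≤ 1≤L 1≤lk 2/2^R≤δ []      sparse =
    -- All outputs are exactly 0 on the empty stream, so no copy is inaccurate and the constant
    -- penalty 1 will do.
    conclude β≡ A≡ A≤ n≤ 1≤L 1≤lk 2/2^R≤δ [] sparse (bound 0) (bound≥ 0) (λ _ → 1ℚ) (λ _ → ℚ.≤-refl)
      (always-map (outcome []) (λ S exact r inexact → contradiction (exact r) inexact) empty-exact)
      (subst (_≤ ι 2) (sym (trans (cong-⟦⟧ (𝔼 sketchStart) λ s → 𝔼-const (steps sketchStep s []) 1ℚ) (𝔼-const sketchStart 1ℚ))) (1≤ι 2))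
  solves bound bound≥ β≡ A≡ A≤ n≤ 1≤L 1≤lk 2/2^R≤δ (i ∷ σ) sparse =
    nonempty β≡ A≡ A≤ n≤ 1≤L 1≤lk 2/2^R≤δ (i ∷ σ) sparse (bound (length (i ∷ σ))) (bound≥ (length (i ∷ σ))) (s≤s z≤n)

module Parameters (n k : ℕ) (ε δ : ℚ) .{{_ : ℕ.NonZero k}} .{{_ : Positive ε}} .{{_ : Positive δ}}
                  (ε<1 : ε < 1ℚ) (δ<1 : δ < 1ℚ) where

  private instance
    ε≢0 : NonZero ε
    ε≢0 = ℚ.pos⇒nonZero ε
    δ≢0 : NonZero δ
    δ≢0 = ℚ.pos⇒nonZero δ
    ε²≢0 : NonZero (ε * ε)
    ε²≢0 = ℚ.pos⇒nonZero (ε * ε) {{ℚ.pos*pos⇒pos ε ε}}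

  1<recip : ∀ p .{{_ : Positive p}} → p < 1ℚ → 1ℚ < (1/ p) {{ℚ.pos⇒nonZero p}}
  1<recip p p<1 = subst₂ _<_ (ℚ.*-inverseˡ p) (ℚ.*-identityʳ (1/ p)) (ℚ.*-monoʳ-<-pos (1/ p) {{ℚ.1/pos⇒pos p}} p<1)
    where instance
      p≢0 : NonZero p
      p≢0 = ℚ.pos⇒nonZero p

  0≤1< : ∀ {p} → 1ℚ < p → 0ℚ ≤ p
  0≤1< 1<p = ℚ.≤-trans 0≤1 (ℚ.<⇒≤ 1<p)

  -- Strictness matters: it makes the rounded logarithms of 1/δ and k/ε at least 1, so that additive
  -- constants can be absorbed into them.
  2≤⌈⌉ : ∀ p → 1ℚ < p → 2 ℕ.≤ ℤ.∣ ceiling p ∣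
  2≤⌈⌉ p 1<p = ℕ.≰⇒> λ c≤1 → ℚ.<-irrefl refl (ℚ.<-≤-trans 1<p
    (ℚ.≤-trans (p≤⌈p⌉ p (0≤1< 1<p)) (subst (ι ℤ.∣ ceiling p ∣ ≤_) ι-1 (ι-mono c≤1))))

  K D L lk ln : ℕ
  K = ℤ.∣ ceiling (fromℕ k ÷ ε) ∣
  D = ℤ.∣ ceiling (1/ δ) ∣
  L = ⌈log₂ D ⌉
  lk = ⌈log₂ K ⌉
  ln = ⌈log₂ n ⌉

  1<1/ε : 1ℚ < 1/ ε
  1<1/ε = 1<recip ε ε<1

  1<1/δ : 1ℚ < 1/ δ
  1<1/δ = 1<recip δ δ<1

  1<k/ε : 1ℚ < fromℕ k ÷ ε
  1<k/ε = ℚ.<-≤-trans 1<1/ε (subst (_≤ fromℕ k * 1/ ε) (ℚ.*-identityˡ (1/ ε))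
    (*-monoʳ (0≤1< 1<1/ε) (subst (1ℚ ≤_) (ι-fromℕ k) (1≤ι k))))

  opaque
    E : ℕ
    E = ℤ.∣ ceiling (1/ ε) ∣

    2≤E : 2 ℕ.≤ E
    2≤E = 2≤⌈⌉ (1/ ε) 1<1/ε

    1/ε≤E : 1/ ε ≤ ι E
    1/ε≤E = p≤⌈p⌉ (1/ ε) (0≤1< 1<1/ε)

    -- Rounding up adds at most 1, which is less than 1/ε.
    E≤2/ε : ι E ≤ 1/ ε + 1/ ε
    E≤2/ε = ℚ.≤-trans (⌈p⌉≤p+1 (1/ ε) (0≤1< 1<1/ε)) (ℚ.+-monoʳ-≤ (1/ ε) (ℚ.<⇒≤ 1<1/ε))

  instance
    E≢0 : ℕ.NonZero E
    E≢0 = ℕ.>-nonZero (ℕ.<⇒≤ 2≤E)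

  1/E≤ε : recip (pred E) ≤ ε
  1/E≤ε = recip≤ E (ℚ.<⇒≤ (ℚ.positive⁻¹ ε)) (ℚ.*-inverseˡ ε) 1/ε≤E

  E²≤4/ε² : ι E * ι E ≤ #ℚ 4 * 1/ (ε * ε)
  E²≤4/ε² = square≤ {y = 1/ (ε * ε)} (0≤ι E) (0≤1< 1<1/ε) E≤2/ε (ℚ.*-inverseˡ ε) (ℚ.*-inverseˡ (ε * ε))

  kE≤2K : k ℕ.* E ℕ.≤ 2 ℕ.* K
  kE≤2K = product≤ k E K E≤2/ε (subst (λ a → a * 1/ ε ≤ ι K) (sym (ι-fromℕ k)) (p≤⌈p⌉ (fromℕ k ÷ ε) (0≤1< 1<k/ε)))

  2/2^R≤δ : recip (pred (2 ^ suc L)) + recip (pred (2 ^ suc L)) ≤ δ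
  2/2^R≤δ = 2/2^1+L≤ L D (ℚ.<⇒≤ (ℚ.positive⁻¹ δ)) (ℚ.*-inverseˡ δ) (p≤⌈p⌉ (1/ δ) (0≤1< 1<1/δ)) (n≤2^⌈log₂n⌉ D)

  private instance
    E²≢0 : ℕ.NonZero (E ℕ.* E)
    E²≢0 = ℕ.m*n≢0 E E
    kE²≢0 : ℕ.NonZero (k ℕ.* (E ℕ.* E))
    kE²≢0 = ℕ.m*n≢0 k (E ℕ.* E)

  opaque
    β⁻ A⁻ : ℕ
    β⁻ = pred (1440 ℕ.* (E ℕ.* E))
    A⁻ = pred (1200 ℕ.* (k ℕ.* (E ℕ.* E)))

    β≡ : suc β⁻ ≡ 1440 ℕ.* (E ℕ.* E)
    β≡ = ℕ.suc-pred (1440 ℕ.* (E ℕ.* E)) {{ℕ.m*n≢0 1440 (E ℕ.* E)}}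

    A≡ : suc A⁻ ≡ 1200 ℕ.* (k ℕ.* (E ℕ.* E))
    A≡ = ℕ.suc-pred (1200 ℕ.* (k ℕ.* (E ℕ.* E))) {{ℕ.m*n≢0 1200 (k ℕ.* (E ℕ.* E))}}

  open Solution β⁻ A⁻ n k E L lk ln {ε} {δ} 1/E≤ε public using (algorithm; solves)

  bound≥ : ∀ m → ι (L ℕ.* (108 ℕ.* 1441 ℕ.* (E ℕ.* E) ℕ.* (lk ℕ.+ ⌈log₂ ⌈log₂ m ⌉ ⌉) ℕ.+ 16 ℕ.* ln)) ≤ fromℕ spaceConstant * spaceBound n k ε δ m
  bound≥ m = subst (ι (L ℕ.* (108 ℕ.* 1441 ℕ.* (E ℕ.* E) ℕ.* (lk ℕ.+ lℓ) ℕ.+ 16 ℕ.* ln)) ≤_) cast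
    (space≤ L (108 ℕ.* 1441) E lk lℓ ln spaceConstant {1/ (ε * ε)} refl (ℕ.m≤m+n 16 622496) E²≤4/ε²)
    where
    lℓ : ℕ
    lℓ = ⌈log₂ ⌈log₂ m ⌉ ⌉
    cast : ι spaceConstant * (1/ (ε * ε) * ι L * (ι lk + ι lℓ) + ι ln * ι L) ≡ fromℕ spaceConstant * spaceBound n k ε δ m
    cast = cong₂ _*_ (ι-fromℕ spaceConstant) (trans
      (cong₂ (λ b c → 1/ (ε * ε) * ι L * b + c * ι L) (cong₂ _+_ (ι-fromℕ lk) (ι-fromℕ lℓ)) (ι-fromℕ ln))
      (cong (λ a → 1/ (ε * ε) * a * (fromℕ lk + fromℕ lℓ) + fromℕ ln * a) (ι-fromℕ L)))

  solution : ∀ σ → ‖ frequency σ ‖₀ ℕ.≤ k →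
    1ℚ - δ ≤ Pr (succeeds? (fromℕ spaceConstant * spaceBound n k ε δ (length σ)) ε (fromℕ ‖ frequency σ ‖₂²)) (run algorithm σ)
  solution = solves (λ m → fromℕ spaceConstant * spaceBound n k ε δ m) bound≥ β≡ A≡ (counterBase≤ k E K lk kE≤2K (n≤2^⌈log₂n⌉ K))
    (n≤2^⌈log₂n⌉ n) (⌈log₂⌉-positive (2≤⌈⌉ (1/ δ) 1<1/δ)) (⌈log₂⌉-positive (2≤⌈⌉ (fromℕ k ÷ ε) 1<k/ε)) 2/2^R≤δ

theorem4 : ∃[ C ] ∀ (n k : ℕ) (ε δ : ℚ) .{{_ : ℕ.NonZero k}} .{{_ : Positive ε}} .{{_ : Positive δ}} →
    ε < 1ℚ → δ < 1ℚ →
    ∃[ 𝒜 ] ∀ (σ : List (Fin n)) → ‖ frequency σ ‖₀ ℕ.≤ k →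
    1ℚ - δ ≤ Pr (succeeds? (fromℕ C * spaceBound n k ε δ (length σ)) ε (fromℕ ‖ frequency σ ‖₂²))
    (run 𝒜 σ)
theorem4 = spaceConstant , λ n k ε δ ε<1 δ<1 → Parameters.algorithm n k ε δ ε<1 δ<1 , Parameters.solution n k ε δ ε<1 δ<1
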